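{- For every integer $k \ge 1$ there is a connected graph on $14k$ vertices whose line graph has signature $k+1$. In particular $\sup\{\, s(L(G)) : G \text{ a connected graph} \,\} = \infty$; that is, there is no constant $C$ such that $n^{+}(L(G)) \le n^{ - }(L(G)) + C$ for every connected graph $G$.
   Context: All graphs are finite and simple. For a graph $H$ with adjacency matrix $A(H)$, $n^{+}(H)$ and $n^{ - }(H)$ denote the numbers of positive and negative eigenvalues of $A(H)$, counted with multiplicity, and the signature is $s(H) = n^{+}(H) - n^{ - }(H)$. The line graph $L(G)$ has the edges of $G$ as vertices, two being adjacent when they are distinct and share an endpoint. -}

module Defs where

open import Level using (0ℓ; suc)
open import Algebra.Bundles using (CommutativeRing)
open import Data.Nat as ℕ using (ℕ; NonZero)
open import Data.Integer as ℤ using (ℤ; +_)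
open import Data.Fin as Fin using (Fin)
import Data.Fin.Properties as Fin
open import Data.List using (List; length; filter; lookup; allFin; cartesianProduct)
open import Data.Vec.Functional using (Vector)
open import Data.Product using (∃; ∃-syntax; _×_; _,_)
open import Data.Sum using (_⊎_)
open import Relation.Nullary using (¬_; yes; no)
open import Relation.Nullary.Decidable using (_×-dec_; _⊎-dec_; ¬?)
open import Relation.Unary as U using (Pred; Satisfiable)
open import Relation.Binary using (Rel; Symmetric; Decidable; IsStrictTotalOrder)
open import Relation.Binary.PropositionalEquality using (_≡_; refl; sym)
open import Relation.Binary.Construct.Closure.ReflexiveTransitive using (Star)

------------------------------------------------------------------------
-- Graphs

-- Finite simple graphs on the vertex set Fin n.
record Graph (n : ℕ) : Set (suc 0ℓ) where
  infix 4 _~_ _~?_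
  field
    _~_    : Rel (Fin n) 0ℓ
    _~?_   : Decidable _~_
    ~-sym  : Symmetric _~_
    ~-irr  : ∀ v → ¬ (v ~ v)

-- The graph without vertices does not count as connected.
Connected : ∀ {n} → Graph n → Set
Connected {n} G = NonZero n × (∀ u v → Star (Graph._~_ G) u v)

module _ {n : ℕ} (G : Graph n) where
  open Graph G

  -- The edge {u , v} is represented by the pair (u , v) with u < v,
  -- so each edge occurs exactly once in the list.
  IsEdge : Pred (Fin n × Fin n) 0ℓ
  IsEdge (u , v) = u Fin.< v × u ~ v

  isEdge? : U.Decidable IsEdge
  isEdge? (u , v) = (u Fin.<? v) ×-dec (u ~? v)

  edges : List (Fin n × Fin n)
  edges = filter isEdge? (cartesianProduct (allFin n) (allFin n))

_∈ₑ_ : ∀ {n} → Fin n → Fin n × Fin n → Set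
w ∈ₑ (u , v) = w ≡ u ⊎ w ≡ v

ShareEndpoint : ∀ {n} → Rel (Fin n × Fin n) 0ℓ
ShareEndpoint e f = ∃[ w ] (w ∈ₑ e × w ∈ₑ f)

shareEndpoint? : ∀ {n} → Decidable (ShareEndpoint {n})
shareEndpoint? (u , v) (x , y) = Fin.any? λ w →
  ((w Fin.≟ u) ⊎-dec (w Fin.≟ v)) ×-dec ((w Fin.≟ x) ⊎-dec (w Fin.≟ y))

-- The vertex a of the line graph stands for the a-th edge of G.
lineGraph : ∀ {n} (G : Graph n) → Graph (length (edges G))
lineGraph G = record
  { _~_   = λ a b → ¬ (a ≡ b) × ShareEndpoint (edge a) (edge b)
  ; _~?_  = λ a b → ¬? (a Fin.≟ b) ×-dec shareEndpoint? (edge a) (edge b)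
  ; ~-sym = λ { (a≢b , w , p , q) → (λ b≡a → a≢b (sym b≡a)) , w , q , p }
  ; ~-irr = λ { a (a≢a , _) → a≢a refl }
  }
  where edge = lookup (edges G)

------------------------------------------------------------------------
-- The real numbers

-- A complete ordered field with decidable order.  Classically these axioms
-- determine ℝ up to unique isomorphism.
record RealNumbers : Set (suc 0ℓ) where
  field
    commutativeRing : CommutativeRing 0ℓ 0ℓ

  open CommutativeRing commutativeRing public
    using (Carrier; _≈_; _+_; _*_; -_; 0#; 1#)

  infix 4 _<_ _≤_
  field
    _<_                : Rel Carrier 0ℓ
    isStrictTotalOrder : IsStrictTotalOrder _≈_ _<_
    0<1                : 0# < 1#
    +-monoˡ-<          : ∀ z {x y} → x < y → x + z < y + z
    *-pos              : ∀ {x y} → 0# < x → 0# < y → 0# < x * y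
    inverse            : ∀ x → ¬ (x ≈ 0#) → ∃[ y ] x * y ≈ 1#

  open IsStrictTotalOrder isStrictTotalOrder public using (_≟_; _<?_)

  _≤_ : Rel Carrier 0ℓ
  x ≤ y = ¬ (y < x)

  UpperBound : Pred Carrier 0ℓ → Pred Carrier 0ℓ
  UpperBound S u = ∀ x → S x → x ≤ u

  field
    supremum : ∀ (S : Pred Carrier 0ℓ) → Satisfiable S → Satisfiable (UpperBound S) →
               ∃[ s ] (UpperBound S s × (∀ u → UpperBound S u → s ≤ u))

------------------------------------------------------------------------
-- Eigenvalues and signature

module Spectra (ℝ : RealNumbers) where
  open RealNumbers ℝ
  open import Algebra.Properties.CommutativeMonoid.Sum
    (CommutativeRing.+-commutativeMonoid commutativeRing) using (sum)

  Matrix : ℕ → Set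
  Matrix m = Fin m → Fin m → Carrier

  infix 4 _≋_
  _≋_ : ∀ {m} → Rel (Vector Carrier m) 0ℓ
  v ≋ w = ∀ i → v i ≈ w i

  infixr 7 _*ᵥ_ _·ᵥ_
  _*ᵥ_ : ∀ {m} → Matrix m → Vector Carrier m → Vector Carrier m
  (M *ᵥ v) i = sum λ j → M i j * v j

  _·ᵥ_ : ∀ {m} → Carrier → Vector Carrier m → Vector Carrier m
  (μ ·ᵥ v) i = μ * v i

  0ᵥ : ∀ {m} → Vector Carrier m
  0ᵥ _ = 0#

  combination : ∀ {m d} → Vector Carrier d → Vector (Vector Carrier m) d → Vector Carrier m
  combination c b i = sum λ j → c j * b j i

  record IsBasis {m d} (W : Pred (Vector Carrier m) 0ℓ) (b : Vector (Vector Carrier m) d) : Set where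
    field
      member      : ∀ j → W (b j)
      independent : ∀ c → combination c b ≋ 0ᵥ → c ≋ 0ᵥ
      spanning    : ∀ v → W v → ∃[ c ] v ≋ combination c b

  HasDimension : ∀ {m} → Pred (Vector Carrier m) 0ℓ → ℕ → Set
  HasDimension {m} W d = ∃ λ (b : Vector (Vector Carrier m) d) → IsBasis W b

  Eigenspace : ∀ {m} → Matrix m → Carrier → Pred (Vector Carrier m) 0ℓ
  Eigenspace M μ v = M *ᵥ v ≋ μ ·ᵥ v

  -- λs lists the real eigenvalues of M with multiplicity: each real μ occurs
  -- dim ker (M − μ I) times (so not at all if μ is not an eigenvalue).
  -- For symmetric M these are all the eigenvalues, and geometric and
  -- algebraic multiplicities agree.
  IsSpectrum : ∀ {m} → Matrix m → List Carrier → Set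
  IsSpectrum M λs = ∀ μ → HasDimension (Eigenspace M μ) (length (filter (μ ≟_) λs))

  adjacencyMatrix : ∀ {n} → Graph n → Matrix n
  adjacencyMatrix G u v with Graph._~?_ G u v
  ... | yes _ = 1#
  ... | no  _ = 0#

  -- HasInertia H p q states n⁺(H) = p and n⁻(H) = q.  The spectrum of a
  -- real matrix is unique up to reordering, so this is a partial function
  -- of H, and it is total by the spectral theorem.
  HasInertia : ∀ {n} → Graph n → ℕ → ℕ → Set
  HasInertia H p q = ∃ λ (λs : List Carrier) →
    IsSpectrum (adjacencyMatrix H) λs ×
    length (filter (0# <?_) λs) ≡ p ×
    length (filter (_<? 0#) λs) ≡ q

  HasSignature : ∀ {n} → Graph n → ℤ → Set
  HasSignature H s = ∃[ p ] ∃[ q ] (HasInertia H p q × s ≡ + p ℤ.- + q)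

{-# OPTIONS --safe #-}
module Submission where

open import Defs
open import Level using (0ℓ)
open import Algebra.Bundles using (CommutativeRing; CommutativeMonoid)
import Algebra.Properties.CommutativeMonoid.Sum
import Algebra.Solver.Ring
open import Algebra.Solver.Ring.AlmostCommutativeRing using (fromCommutativeRing; _-Raw-AlmostCommutative⟶_)
open import Data.Bool using (true; false; if_then_else_)
open import Data.Fin as Fin using (Fin; zero; suc; #_; punchIn; punchOut; combine; remQuot; inject₁; splitAt; _↑ˡ_; _↑ʳ_)
import Data.Fin.Induction as Fin
import Data.Fin.Properties as Fin
open import Data.Integer as ℤ using (ℤ; +_; -[1+_]; +0; +[1+_])
import Data.Integer.Properties as ℤ
open import Data.List as List using (List; length; filter; tabulate; lookup; allFin; cartesianProduct; map)
open import Data.List.Properties using (length-tabulate)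
open import Data.List.Membership.DecPropositional using (_∈?_)
open import Data.List.Membership.Propositional using (_∈_)
open import Data.List.Membership.Propositional.Properties using (∈-lookup)
import Data.List.Relation.Unary.All as All
import Data.List.Relation.Unary.All.Properties as All
import Data.List.Relation.Unary.AllPairs as AllPairs
open import Data.List.Relation.Unary.Unique.Propositional using (Unique)
import Data.List.Relation.Unary.Unique.Propositional.Properties as Unique
open import Data.Maybe using (Maybe; just; nothing)
open import Data.Nat as ℕ using (ℕ; zero; suc)
import Data.Nat.Properties as ℕ
import Data.Nat.Solver as ℕ
open import Data.Product using (∃; ∃-syntax; _×_; _,_; proj₁; proj₂; uncurry)
open import Data.Product.Properties using (≡-dec)
open import Data.Sum using (_⊎_; inj₁; inj₂; swap)
open import Data.Vec.Functional as Vector using (Vector; _++_)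
open import Data.Vec.Functional.Properties using (lookup-++ˡ; lookup-++ʳ)
open import Function using (_∘_; id)
open import Relation.Binary using (IsPreorder; IsStrictTotalOrder; tri<; tri≈; tri>)
open import Relation.Binary.Construct.Closure.ReflexiveTransitive as Star using (Star; _◅_; _◅◅_)
open import Relation.Binary.PropositionalEquality as ≡ using (_≡_)
open import Relation.Nullary using (¬_; Dec; yes; no; does; contradiction)
open import Relation.Nullary.Decidable using (¬?; _×-dec_; _⊎-dec_; from-yes; toWitness)
open import Relation.Unary using (Pred; Decidable)

-- The line graph of G has adjacency matrix BᵀB − 2I for the incidence matrix B, and BBᵀ is the signless
-- Laplacian Q.  Since 0 ≤ ‖2x − Bᵀy‖² for y = Bx and 0 ≤ ‖Bx − 2y‖² for x = Bᵀy, an N-dimensional subspace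
-- on which Q − 2I is negative definite and a complementary P-dimensional one on which it is positive definite
-- give n⁺ ≥ P and n⁻ ≥ |E| − P for the line graph, hence equality.  There is a graph on 14 vertices with
-- 16 edges for which P = 9, and deleting a certain vertex lowers P to 8.  Join k copies of it along a star
-- through the copies of that vertex: the k − 1 new edges add to Q a positive semidefinite form that vanishes
-- where these k vertices do, so still P = 9k, while |E| = 17k − 1.  The signature is 2P − |E| = k + 1.
--
-- The eigenvalues exist by the spectral theorem: the supremum of the Rayleigh quotients of a symmetric matrix
-- is an eigenvalue, and deflation produces the others.

-- Each gadget contributes 2 · 9 - 16 = 2 to the signature, and each linking edge costs 1, because
-- it raises |E| without raising P. The k - 1 edges of a tree thus leave 2k - (k - 1) = k + 1, and
-- connectedness costs only half of the gain. The condition on the deleted vertex means that the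
-- negative definite subspace of a copy, of dimension 5, can be taken inside the hyperplane where
-- the coordinate of that vertex is 0. The links are squares of sums of such coordinates, so they do
-- not disturb negativity there, while on the positive side they can only help. Subspaces are given
-- as kernels of families of linear forms. Complementarity of dimensions is then an equation between
-- the numbers of forms, pulling back along B amounts to composing forms with B, and every dimension
-- argument becomes the existence of a nonzero solution of an underdetermined system. The gadget
-- itself enters through two identities between integer matrices, both decided by evaluation.

private
  module ℤΣ = Algebra.Properties.CommutativeMonoid.Sum ℤ.+-0-commutativeMonoid
  variable m n k r d p : ℕ

-- Ordered field arithmetic and a ring solver with integer coefficients.

module OrderedField (ℝ : RealNumbers) where
  open RealNumbers ℝ
  open CommutativeRing commutativeRing public
    hiding (Carrier; _≈_; _+_; _*_; -_; 0#; 1#; zero)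
  open IsStrictTotalOrder isStrictTotalOrder public
    using (compare) renaming (trans to <-trans; irrefl to <-irrefl; <-resp-≈ to <-resp)
  open import Algebra.Properties.Semiring.Mult semiring
    using (×-homo-+; ×1-homo-*) renaming (_×_ to _⊗_)
  open import Algebra.Properties.Ring ring
    using (-0#≈0#; -‿involutive; -‿distribˡ-*; -‿distribʳ-*; -‿+-comm) public
  import Relation.Binary.Reasoning.Setoid setoid as ≈

  -- The interpretation of the solver's constants. `ι (+ 1)` is `1# + 0#` and not `1#`, which is why
  -- some solver calls below treat `1#` as one more variable `o`.
  ι : ℤ → Carrier
  ι (+ n)    = n ⊗ 1#
  ι -[1+ n ] = - (suc n ⊗ 1#)

  ι-⊖ : ∀ m n → ι (m ℤ.⊖ n) ≈ m ⊗ 1# - n ⊗ 1#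
  ι-⊖ zero    zero    = sym (-‿inverseʳ 0#)
  ι-⊖ zero    (suc n) = sym (+-identityˡ _)
  ι-⊖ (suc m) zero    = sym (trans (+-congˡ -0#≈0#) (+-identityʳ _))
  ι-⊖ (suc m) (suc n) = ≈.begin
    ι (suc m ℤ.⊖ suc n)                   ≈.≡⟨ ≡.cong ι (ℤ.[1+m]⊖[1+n]≡m⊖n m n) ⟩
    ι (m ℤ.⊖ n)                           ≈.≈⟨ ι-⊖ m n ⟩
    m ⊗ 1# - n ⊗ 1#                       ≈.≈⟨ +-congʳ (+-identityˡ _) ⟨
    0# + m ⊗ 1# - n ⊗ 1#                  ≈.≈⟨ +-congʳ (+-congʳ (-‿inverseʳ 1#)) ⟨
    1# - 1# + m ⊗ 1# - n ⊗ 1#             ≈.≈⟨ +-congʳ (+-assoc _ _ _) ⟩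
    1# + (- 1# + m ⊗ 1#) - n ⊗ 1#         ≈.≈⟨ +-congʳ (+-congˡ (+-comm _ _)) ⟩
    1# + (m ⊗ 1# - 1#) - n ⊗ 1#           ≈.≈⟨ +-congʳ (+-assoc _ _ _) ⟨
    1# + m ⊗ 1# - 1# - n ⊗ 1#             ≈.≈⟨ +-assoc _ _ _ ⟩
    1# + m ⊗ 1# + (- 1# - n ⊗ 1#)         ≈.≈⟨ +-congˡ (-‿+-comm _ _) ⟩
    1# + m ⊗ 1# - (1# + n ⊗ 1#)           ≈.∎

  ι-+ : ∀ x y → ι (x ℤ.+ y) ≈ ι x + ι y
  ι-+ (+ m)    (+ n)    = ×-homo-+ 1# m n
  ι-+ (+ m)    -[1+ n ] = ι-⊖ m (suc n)
  ι-+ -[1+ m ] (+ n)    = trans (ι-⊖ n (suc m)) (+-comm _ _)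
  ι-+ -[1+ m ] -[1+ n ] = ≈.begin
    - (suc (suc (m ℕ.+ n)) ⊗ 1#)          ≈.≡⟨ ≡.cong (λ k → - (suc k ⊗ 1#)) (≡.sym (ℕ.+-suc m n)) ⟩
    - ((suc m ℕ.+ suc n) ⊗ 1#)            ≈.≈⟨ -‿cong (×-homo-+ 1# (suc m) (suc n)) ⟩
    - (suc m ⊗ 1# + suc n ⊗ 1#)           ≈.≈⟨ -‿+-comm _ _ ⟨
    - (suc m ⊗ 1#) - suc n ⊗ 1#           ≈.∎

  ι-neg : ∀ x → ι (ℤ.- x) ≈ - ι x
  ι-neg +0       = sym -0#≈0#
  ι-neg +[1+ n ] = refl
  ι-neg -[1+ n ] = sym (-‿involutive _)

  ι-*-pos : ∀ m n → ι (+ m ℤ.* + n) ≈ ι (+ m) * ι (+ n)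
  ι-*-pos m n = trans (reflexive (≡.cong ι (≡.sym (ℤ.pos-* m n)))) (×1-homo-* m n)

  ι-* : ∀ x y → ι (x ℤ.* y) ≈ ι x * ι y
  ι-* (+ m) (+ n) = ι-*-pos m n
  ι-* (+ m) -[1+ n ] = ≈.begin
    ι (+ m ℤ.* -[1+ n ])         ≈.≡⟨ ≡.cong ι (ℤ.neg-distribʳ-* (+ m) (+ suc n)) ⟨
    ι (ℤ.- (+ m ℤ.* + suc n))    ≈.≈⟨ ι-neg (+ m ℤ.* + suc n) ⟩
    - ι (+ m ℤ.* + suc n)        ≈.≈⟨ -‿cong (ι-*-pos m (suc n)) ⟩
    - (ι (+ m) * ι (+ suc n))    ≈.≈⟨ -‿distribʳ-* _ _ ⟩
    ι (+ m) * ι -[1+ n ]         ≈.∎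
  ι-* -[1+ m ] y = ≈.begin
    ι (-[1+ m ] ℤ.* y)           ≈.≡⟨ ≡.cong ι (ℤ.neg-distribˡ-* (+ suc m) y) ⟨
    ι (ℤ.- (+ suc m ℤ.* y))      ≈.≈⟨ ι-neg (+ suc m ℤ.* y) ⟩
    - ι (+ suc m ℤ.* y)          ≈.≈⟨ -‿cong (ι-*′ y) ⟩
    - (ι (+ suc m) * ι y)        ≈.≈⟨ -‿distribˡ-* _ _ ⟩
    ι -[1+ m ] * ι y             ≈.∎
    where
    ι-*′ : ∀ y → ι (+ suc m ℤ.* y) ≈ ι (+ suc m) * ι y
    ι-*′ (+ n)    = ι-*-pos (suc m) n
    ι-*′ -[1+ n ] = ι-* (+ suc m) -[1+ n ]

  ι-morphism : ℤ.+-*-rawRing -Raw-AlmostCommutative⟶ fromCommutativeRing commutativeRing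
  ι-morphism = record
    { ⟦_⟧ = ι ; +-homo = ι-+ ; *-homo = ι-* ; -‿homo = ι-neg
    ; 0-homo = refl ; 1-homo = +-identityʳ 1# }

  ι-≟ : ∀ x y → Maybe (ι x ≈ ι y)
  ι-≟ x y with x ℤ.≟ y
  ... | yes ≡.refl = just refl
  ... | no _       = nothing

  open Algebra.Solver.Ring ℤ.+-*-rawRing (fromCommutativeRing commutativeRing) ι-morphism ι-≟ public
    using (solve; _:=_; _:+_; _:*_; _:-_; :-_; con)

  <⇒≤ : ∀ {x y} → x < y → x ≤ y
  <⇒≤ x<y y<x = <-irrefl refl (<-trans x<y y<x)

  ≤-reflexive : ∀ {x y} → x ≈ y → x ≤ y
  ≤-reflexive x≈y y<x = <-irrefl (sym x≈y) y<x

  <-≤-trans : ∀ {x y z} → x < y → y ≤ z → x < z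
  <-≤-trans {x} {y} {z} x<y y≤z with compare y z
  ... | tri< y<z _ _ = <-trans x<y y<z
  ... | tri≈ _ y≈z _ = proj₁ <-resp y≈z x<y
  ... | tri> _ _ z<y = contradiction z<y y≤z

  ≤-<-trans : ∀ {x y z} → x ≤ y → y < z → x < z
  ≤-<-trans {x} {y} {z} x≤y y<z with compare x y
  ... | tri< x<y _ _ = <-trans x<y y<z
  ... | tri≈ _ x≈y _ = proj₂ <-resp (sym x≈y) y<z
  ... | tri> _ _ y<x = contradiction y<x x≤y

  ≤-trans : ∀ {x y z} → x ≤ y → y ≤ z → x ≤ z
  ≤-trans x≤y y≤z z<x = y≤z (<-≤-trans z<x x≤y)

  ≤-isPreorder : IsPreorder _≈_ _≤_
  ≤-isPreorder = record { isEquivalence = isEquivalence ; reflexive = ≤-reflexive ; trans = ≤-trans }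

  open import Relation.Binary.Reasoning.Base.Triple ≤-isPreorder
    (λ x<y y<x → <-irrefl refl (<-trans x<y y<x)) <-trans <-resp <⇒≤ <-≤-trans ≤-<-trans public

  ≤∧≉⇒< : ∀ {x y} → x ≤ y → ¬ x ≈ y → x < y
  ≤∧≉⇒< {x} {y} x≤y x≉y with compare x y
  ... | tri< x<y _ _ = x<y
  ... | tri≈ _ x≈y _ = contradiction x≈y x≉y
  ... | tri> _ _ y<x = contradiction y<x x≤y

  ≤-antisym : ∀ {x y} → x ≤ y → y ≤ x → x ≈ y
  ≤-antisym {x} {y} x≤y y≤x with compare x y
  ... | tri< x<y _ _ = contradiction x<y y≤x
  ... | tri≈ _ x≈y _ = x≈y
  ... | tri> _ _ y<x = contradiction y<x x≤y

  +-monoˡ-≤ : ∀ z {x y} → x ≤ y → x + z ≤ y + z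
  +-monoˡ-≤ z {x} {y} x≤y y+z<x+z = x≤y (begin-strict
    y              ≈⟨ solve 2 (λ y z → y := y :+ z :- z) refl y z ⟩
    y + z - z      <⟨ +-monoˡ-< (- z) y+z<x+z ⟩
    x + z - z      ≈⟨ solve 2 (λ x z → x :+ z :- z := x) refl x z ⟩
    x              ∎)

  +-mono-≤ : ∀ {x y u v} → x ≤ y → u ≤ v → x + u ≤ y + v
  +-mono-≤ {x} {y} {u} {v} x≤y u≤v = begin
    x + u    ≤⟨ +-monoˡ-≤ u x≤y ⟩
    y + u    ≈⟨ +-comm y u ⟩
    u + y    ≤⟨ +-monoˡ-≤ y u≤v ⟩
    v + y    ≈⟨ +-comm v y ⟩
    y + v    ∎

  +-mono-<-≤ : ∀ {x y u v} → x < y → u ≤ v → x + u < y + v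
  +-mono-<-≤ {x} {y} {u} {v} x<y u≤v = begin-strict
    x + u    <⟨ +-monoˡ-< u x<y ⟩
    y + u    ≈⟨ +-comm y u ⟩
    u + y    ≤⟨ +-monoˡ-≤ y u≤v ⟩
    v + y    ≈⟨ +-comm v y ⟩
    y + v    ∎

  +-nonneg : ∀ {x y} → 0# ≤ x → 0# ≤ y → 0# ≤ x + y
  +-nonneg p q = ≤-trans (≤-reflexive (sym (+-identityʳ 0#))) (+-mono-≤ p q)

  +-pos-nonneg : ∀ {x y} → 0# < x → 0# ≤ y → 0# < x + y
  +-pos-nonneg p q = ≤-<-trans (≤-reflexive (sym (+-identityʳ 0#))) (+-mono-<-≤ p q)

  -- Inequalities between x and y are proved by exhibiting y − x as an expression of known sign.
  ≤-diff : ∀ {x y d} → 0# ≤ d → d ≈ y - x → x ≤ y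
  ≤-diff {x} {y} {d} 0≤d eq = begin
    x            ≈⟨ +-identityˡ x ⟨
    0# + x       ≤⟨ +-monoˡ-≤ x 0≤d ⟩
    d + x        ≈⟨ +-congʳ eq ⟩
    y - x + x    ≈⟨ solve 2 (λ x y → y :- x :+ x := y) refl x y ⟩
    y            ∎

  <-diff : ∀ {x y d} → 0# < d → d ≈ y - x → x < y
  <-diff {x} {y} {d} 0<d eq = begin-strict
    x            ≈⟨ +-identityˡ x ⟨
    0# + x       <⟨ +-monoˡ-< x 0<d ⟩
    d + x        ≈⟨ +-congʳ eq ⟩
    y - x + x    ≈⟨ solve 2 (λ x y → y :- x :+ x := y) refl x y ⟩
    y            ∎

  diff-nonneg : ∀ {x y} → x ≤ y → 0# ≤ y - x
  diff-nonneg {x} {y} x≤y = ≤-trans (≤-reflexive (sym (-‿inverseʳ x))) (+-monoˡ-≤ (- x) x≤y)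

  diff-pos : ∀ {x y} → x < y → 0# < y - x
  diff-pos {x} {y} x<y = ≤-<-trans (≤-reflexive (sym (-‿inverseʳ x))) (+-monoˡ-< (- x) x<y)

  nonneg-cases : ∀ {x} → 0# ≤ x → 0# < x ⊎ x ≈ 0#
  nonneg-cases {x} 0≤x with compare 0# x
  ... | tri< 0<x _ _ = inj₁ 0<x
  ... | tri≈ _ 0≈x _ = inj₂ (sym 0≈x)
  ... | tri> _ _ x<0 = contradiction x<0 0≤x

  *-nonneg : ∀ {x y} → 0# ≤ x → 0# ≤ y → 0# ≤ x * y
  *-nonneg {x} {y} p q with nonneg-cases p | nonneg-cases q
  ... | inj₁ 0<x | inj₁ 0<y = <⇒≤ (*-pos 0<x 0<y)
  ... | inj₂ x≈0 | _        = ≤-reflexive (sym (trans (*-congʳ x≈0) (zeroˡ y)))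
  ... | inj₁ _   | inj₂ y≈0 = ≤-reflexive (sym (trans (*-congˡ y≈0) (zeroʳ x)))

  neg-pos : ∀ {x} → x < 0# → 0# < - x
  neg-pos {x} x<0 = <-diff (diff-pos x<0) (solve 1 (λ x → con +0 :- x := :- x :- con +0) refl x)

  square-nonneg : ∀ x → 0# ≤ x * x
  square-nonneg x with compare 0# x
  ... | tri< 0<x _ _ = <⇒≤ (*-pos 0<x 0<x)
  ... | tri≈ _ 0≈x _ = *-nonneg (≤-reflexive 0≈x) (≤-reflexive 0≈x)
  ... | tri> _ _ x<0 = ≤-trans (<⇒≤ (*-pos (neg-pos x<0) (neg-pos x<0)))
                               (≤-reflexive (solve 1 (λ x → (:- x) :* (:- x) := x :* x) refl x))

  *-cancelˡ-≈0 : ∀ {x y} → ¬ x ≈ 0# → x * y ≈ 0# → y ≈ 0#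
  *-cancelˡ-≈0 {x} {y} x≉0 xy≈0 with z , xz≈1 ← inverse x x≉0 = ≈.begin
    y             ≈.≈⟨ *-identityˡ y ⟨
    1# * y        ≈.≈⟨ *-congʳ xz≈1 ⟨
    x * z * y     ≈.≈⟨ solve 3 (λ x y z → x :* z :* y := z :* (x :* y)) refl x y z ⟩
    z * (x * y)   ≈.≈⟨ *-congˡ xy≈0 ⟩
    z * 0#        ≈.≈⟨ zeroʳ z ⟩
    0#            ≈.∎

  square≈0 : ∀ {x} → x * x ≈ 0# → x ≈ 0#
  square≈0 {x} xx≈0 with x ≟ 0#
  ... | yes x≈0 = x≈0
  ... | no  x≉0 = *-cancelˡ-≈0 x≉0 xx≈0

  pos⇒≉0 : ∀ {x} → 0# < x → ¬ x ≈ 0#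
  pos⇒≉0 0<x x≈0 = <-irrefl (sym x≈0) 0<x

  *-cancelˡ-nonneg : ∀ {x y} → 0# < x → 0# ≤ x * y → 0# ≤ y
  *-cancelˡ-nonneg {x} {y} 0<x 0≤xy y<0 = 0≤xy (<-diff (*-pos 0<x (neg-pos y<0))
    (solve 2 (λ x y → x :* (:- y) := con +0 :- x :* y) refl x y))

  pos-inverse : ∀ {x} → 0# < x → ∃[ y ] (x * y ≈ 1# × 0# < y)
  pos-inverse {x} 0<x with y , xy≈1 ← inverse x (pos⇒≉0 0<x) = y , xy≈1 , ≤∧≉⇒<
    (*-cancelˡ-nonneg 0<x (<⇒≤ (<-≤-trans 0<1 (≤-reflexive (sym xy≈1)))))
    (λ 0≈y → <-irrefl (trans (sym (zeroʳ x)) (trans (*-congˡ 0≈y) xy≈1)) 0<1)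

  double-nonneg : ∀ {x} → 0# ≤ x + x → 0# ≤ x
  double-nonneg {x} 0≤x+x x<0 = 0≤x+x (<-≤-trans (+-mono-<-≤ x<0 (<⇒≤ x<0)) (≤-reflexive (+-identityʳ 0#)))

  ι-pos : ∀ n → 0# < ι +[1+ n ]
  ι-pos zero    = <-≤-trans 0<1 (≤-reflexive (sym (+-identityʳ 1#)))
  ι-pos (suc n) = +-pos-nonneg 0<1 (<⇒≤ (ι-pos n))

  *-monoʳ-≤ : ∀ {x y z} → 0# ≤ z → x ≤ y → x * z ≤ y * z
  *-monoʳ-≤ {x} {y} {z} 0≤z x≤y = ≤-diff (*-nonneg (diff-nonneg x≤y) 0≤z)
    (solve 3 (λ x y z → (y :- x) :* z := y :* z :- x :* z) refl x y z)

  *-cancelʳ-≤ : ∀ {x y z} → 0# < z → x * z ≤ y * z → x ≤ y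
  *-cancelʳ-≤ {x} {y} {z} 0<z xz≤yz y<x = xz≤yz (<-diff (*-pos (diff-pos y<x) 0<z)
    (solve 3 (λ x y z → (x :- y) :* z := x :* z :- y :* z) refl x y z))

  neg-one : ∀ x → - 1# * x ≈ - x
  neg-one x = trans (sym (-‿distribˡ-* 1# x)) (-‿cong (*-identityˡ x))

  divide-≤ : ∀ {K κ q s} → 0# < κ → K * κ ≈ 1# → 0# ≤ K * q - s → κ * s ≤ q
  divide-≤ {K} {κ} {q} {s} 0<κ Kκ≈1 0≤Kq-s = ≤-diff (*-nonneg (<⇒≤ 0<κ) 0≤Kq-s)
    (trans (solve 4 (λ κ K q s → κ :* (K :* q :- s) := (K :* κ) :* q :- κ :* s) refl κ K q s)
           (+-congʳ (trans (*-congʳ Kκ≈1) (*-identityˡ q))))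

-- Linear algebra: inner products, underdetermined systems, orthogonal families.

module Vectors (ℝ : RealNumbers) where
  open RealNumbers ℝ
  open OrderedField ℝ
  open Spectra ℝ
  open Vector using (_∷_; tail)
  open import Algebra.Properties.Semiring.Sum semiring public
    using (sum-cong-≋; ∑-distrib-+; ∑-comm; *-distribˡ-sum; *-distribʳ-sum; sum-remove; sum-replicate-zero)
  open import Algebra.Properties.CommutativeMonoid.Sum +-commutativeMonoid public using (sum)

  sum-zero : (f : Vector Carrier n) → f ≋ 0ᵥ → sum f ≈ 0#
  sum-zero {n} f f≋0 = trans (sum-cong-≋ f≋0) (sum-replicate-zero n)

  sum-single : (f : Vector Carrier n) (i : Fin n) → (∀ j → ¬ i ≡ j → f j ≈ 0#) → sum f ≈ f i
  sum-single {suc n} f i f≈0 = begin-equality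
    sum f                            ≈⟨ sum-remove {i = i} f ⟩
    f i + sum (f ∘ punchIn i)        ≈⟨ +-congˡ (sum-zero (f ∘ punchIn i) λ j → f≈0 _ (Fin.punchInᵢ≢i i j ∘ ≡.sym)) ⟩
    f i + 0#                         ≈⟨ +-identityʳ _ ⟩
    f i                              ∎

  sum-neg : (f : Vector Carrier n) → sum (λ i → - f i) ≈ - sum f
  sum-neg {zero}  f = sym -0#≈0#
  sum-neg {suc n} f = trans (+-congˡ (sum-neg (f ∘ suc))) (-‿+-comm _ _)

  sum-mono : {f g : Vector Carrier n} → (∀ i → f i ≤ g i) → sum f ≤ sum g
  sum-mono {zero}  f≤g = ≤-reflexive refl
  sum-mono {suc n} f≤g = +-mono-≤ (f≤g zero) (sum-mono (f≤g ∘ suc))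

  sum-nonneg : (f : Vector Carrier n) → (∀ i → 0# ≤ f i) → 0# ≤ sum f
  sum-nonneg {n} f 0≤f = ≤-trans (≤-reflexive (sym (sum-replicate-zero n))) (sum-mono 0≤f)

  term≤sum : (f : Vector Carrier n) → (∀ i → 0# ≤ f i) → ∀ i → f i ≤ sum f
  term≤sum {suc n} f 0≤f i = begin
    f i                           ≈⟨ +-identityʳ _ ⟨
    f i + 0#                      ≤⟨ +-mono-≤ (≤-reflexive refl) (sum-nonneg (f ∘ punchIn i) (0≤f ∘ punchIn i)) ⟩
    f i + sum (f ∘ punchIn i)     ≈⟨ sum-remove {i = i} f ⟨
    sum f                         ∎

  infix 8 ⟨_,_⟩ ‖_‖²
  ⟨_,_⟩ : Vector Carrier n → Vector Carrier n → Carrier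
  ⟨ x , y ⟩ = sum λ i → x i * y i

  ‖_‖² : Vector Carrier n → Carrier
  ‖ x ‖² = ⟨ x , x ⟩

  infixl 6 _+ᵥ_
  _+ᵥ_ : Vector Carrier n → Vector Carrier n → Vector Carrier n
  (x +ᵥ y) i = x i + y i

  infixr 7 _⊛_
  -- The rectangular version of `_*ᵥ_`; on square matrices the two agree definitionally.
  _⊛_ : (Fin m → Fin n → Carrier) → Vector Carrier n → Vector Carrier m
  (A ⊛ x) i = ⟨ A i , x ⟩

  _ᵀ : (Fin m → Fin n → Carrier) → Fin n → Fin m → Carrier
  (A ᵀ) j i = A i j

  dot-cong : {x x′ y y′ : Vector Carrier n} → x ≋ x′ → y ≋ y′ → ⟨ x , y ⟩ ≈ ⟨ x′ , y′ ⟩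
  dot-cong p q = sum-cong-≋ λ i → *-cong (p i) (q i)

  dot-comm : (x y : Vector Carrier n) → ⟨ x , y ⟩ ≈ ⟨ y , x ⟩
  dot-comm x y = sum-cong-≋ λ i → *-comm (x i) (y i)

  dot-+ʳ : (x y z : Vector Carrier n) → ⟨ x , y +ᵥ z ⟩ ≈ ⟨ x , y ⟩ + ⟨ x , z ⟩
  dot-+ʳ x y z = trans (sum-cong-≋ λ i → distribˡ (x i) (y i) (z i)) (∑-distrib-+ (λ i → x i * y i) (λ i → x i * z i))

  dot-·ʳ : ∀ c (x y : Vector Carrier n) → ⟨ x , c ·ᵥ y ⟩ ≈ c * ⟨ x , y ⟩
  dot-·ʳ c x y = trans (sum-cong-≋ λ i → solve 3 (λ c x y → x :* (c :* y) := c :* (x :* y)) refl c (x i) (y i))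
                       (sym (*-distribˡ-sum c (λ i → x i * y i)))

  dot-+ˡ : (x y z : Vector Carrier n) → ⟨ x +ᵥ y , z ⟩ ≈ ⟨ x , z ⟩ + ⟨ y , z ⟩
  dot-+ˡ x y z = trans (dot-comm (x +ᵥ y) z) (trans (dot-+ʳ z x y) (+-cong (dot-comm z x) (dot-comm z y)))

  dot-·ˡ : ∀ c (x y : Vector Carrier n) → ⟨ c ·ᵥ x , y ⟩ ≈ c * ⟨ x , y ⟩
  dot-·ˡ c x y = trans (dot-comm (c ·ᵥ x) y) (trans (dot-·ʳ c y x) (*-congˡ (dot-comm y x)))

  dot-0ʳ : (x : Vector Carrier n) → ⟨ x , 0ᵥ ⟩ ≈ 0#
  dot-0ʳ x = sum-zero (λ i → x i * 0#) (λ i → zeroʳ (x i))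

  dot-combination : (x : Vector Carrier n) (c : Vector Carrier d) (b : Vector (Vector Carrier n) d) →
                    ⟨ x , combination c b ⟩ ≈ sum (λ j → c j * ⟨ x , b j ⟩)
  dot-combination x c b = begin-equality
    (sum λ i → x i * sum λ j → c j * b j i)        ≈⟨ sum-cong-≋ (λ i → *-distribˡ-sum (x i) (λ j → c j * b j i)) ⟩
    (sum λ i → sum λ j → x i * (c j * b j i))      ≈⟨ ∑-comm (λ i j → x i * (c j * b j i)) ⟩
    (sum λ j → sum λ i → x i * (c j * b j i))      ≈⟨ sum-cong-≋ (λ j → dot-·ʳ (c j) x (b j)) ⟩
    (sum λ j → c j * ⟨ x , b j ⟩)                  ∎

  adjoint : (A : Fin m → Fin n → Carrier) (x : Vector Carrier m) (y : Vector Carrier n) →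
            ⟨ x , A ⊛ y ⟩ ≈ ⟨ A ᵀ ⊛ x , y ⟩
  adjoint A x y = begin-equality
    (sum λ i → x i * sum λ j → A i j * y j)        ≈⟨ sum-cong-≋ (λ i → *-distribˡ-sum (x i) (λ j → A i j * y j)) ⟩
    (sum λ i → sum λ j → x i * (A i j * y j))      ≈⟨ ∑-comm (λ i j → x i * (A i j * y j)) ⟩
    (sum λ j → sum λ i → x i * (A i j * y j))      ≈⟨ sum-cong-≋ (λ j → sum-cong-≋ λ i →
      solve 3 (λ x a y → x :* (a :* y) := (a :* x) :* y) refl (x i) (A i j) (y j)) ⟩
    (sum λ j → sum λ i → (A i j * x i) * y j)      ≈⟨ sum-cong-≋ (λ j → *-distribʳ-sum (y j) (λ i → A i j * x i)) ⟨
    (sum λ j → (sum λ i → A i j * x i) * y j)      ∎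

  square≤‖‖² : (x : Vector Carrier n) → ∀ i → x i * x i ≤ ‖ x ‖²
  square≤‖‖² x = term≤sum (λ i → x i * x i) (λ i → square-nonneg (x i))

  ‖‖²-nonneg : (x : Vector Carrier n) → 0# ≤ ‖ x ‖²
  ‖‖²-nonneg x = sum-nonneg (λ i → x i * x i) (λ i → square-nonneg (x i))

  ‖‖²≈0⇒≋0 : (x : Vector Carrier n) → ‖ x ‖² ≈ 0# → x ≋ 0ᵥ
  ‖‖²≈0⇒≋0 x x²≈0 i = square≈0 (≤-antisym (≤-trans (square≤‖‖² x i) (≤-reflexive x²≈0)) (square-nonneg (x i)))

  ‖‖²-pos : (x : Vector Carrier n) → ∀ i → ¬ x i ≈ 0# → 0# < ‖ x ‖²
  ‖‖²-pos x i xᵢ≉0 = ≤∧≉⇒< (‖‖²-nonneg x) (λ 0≈x² → xᵢ≉0 (‖‖²≈0⇒≋0 x (sym 0≈x²) i))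

  -- Decidability of the order makes this a genuine case split. Throughout, x ≠ 0 is expressed as
  -- `0# < ‖ x ‖²`.
  ‖‖²-cases : (x : Vector Carrier n) → 0# < ‖ x ‖² ⊎ x ≋ 0ᵥ
  ‖‖²-cases x with nonneg-cases (‖‖²-nonneg x)
  ... | inj₁ 0<x² = inj₁ 0<x²
  ... | inj₂ x²≈0 = inj₂ (‖‖²≈0⇒≋0 x x²≈0)

  δ : Fin n → Fin n → Carrier
  δ i j with i Fin.≟ j
  ... | yes _ = 1#
  ... | no  _ = 0#

  δ-refl : (i : Fin n) → δ i i ≈ 1#
  δ-refl i with i Fin.≟ i
  ... | yes _  = refl
  ... | no i≢i = contradiction ≡.refl i≢i

  δ-≢ : (i j : Fin n) → ¬ i ≡ j → δ i j ≈ 0#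
  δ-≢ i j i≢j with i Fin.≟ j
  ... | yes i≡j = contradiction i≡j i≢j
  ... | no _    = refl

  δ-sym : (i j : Fin n) → δ i j ≈ δ j i
  δ-sym i j with i Fin.≟ j
  ... | yes ≡.refl = sym (δ-refl i)
  ... | no i≢j     = sym (δ-≢ j i (i≢j ∘ ≡.sym))

  dot-δ : (x : Vector Carrier n) → ∀ i → ⟨ δ i , x ⟩ ≈ x i
  dot-δ x i = begin-equality
    ⟨ δ i , x ⟩      ≈⟨ sum-single (λ j → δ i j * x j) i (λ j i≢j → trans (*-congʳ (δ-≢ i j i≢j)) (zeroˡ (x j))) ⟩
    δ i i * x i      ≈⟨ *-congʳ (δ-refl i) ⟩
    1# * x i         ≈⟨ *-identityˡ (x i) ⟩
    x i              ∎

  ‖δ‖²-pos : (i : Fin n) → 0# < ‖ δ i ‖²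
  ‖δ‖²-pos i = ‖‖²-pos (δ i) i (λ δ≈0 → <-irrefl (trans (sym δ≈0) (δ-refl i)) 0<1)

  -- Gaussian elimination: a nonzero entry of the first column serves as pivot.
  underdetermined : r ℕ.< d → (h : Fin r → Vector Carrier d) →
                    ∃[ c ] (0# < ‖ c ‖² × h ⊛ c ≋ 0ᵥ)
  underdetermined {zero}  {suc d} _ h = δ zero , ‖δ‖²-pos {suc d} zero , λ ()
  underdetermined {suc r} {suc d} (ℕ.s≤s r<d) h with Fin.any? (λ j → ¬? (h j zero ≟ 0#))
  ... | no no-pivot = δ zero , ‖δ‖²-pos {suc d} zero , λ j →
    trans (dot-comm (h j) (δ zero)) (trans (dot-δ (h j) zero) (column≈0 j))
    where
    column≈0 : ∀ j → h j zero ≈ 0#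
    column≈0 j with h j zero ≟ 0#
    ... | yes eq = eq
    ... | no neq = contradiction (j , neq) no-pivot
  ... | yes (p , hp≉0) with inverse (h p zero) hp≉0
  ... | π , pivot*π≈1 = from-reduced (underdetermined r<d reduced)
    where
    reduced : Fin r → Vector Carrier d
    reduced i = tail (h (punchIn p i)) +ᵥ (- (h (punchIn p i) zero * π)) ·ᵥ tail (h p)

    from-reduced : ∃[ c ] (0# < ‖ c ‖² × reduced ⊛ c ≋ 0ᵥ) → ∃[ c ] (0# < ‖ c ‖² × h ⊛ c ≋ 0ᵥ)
    from-reduced (c , 0<c² , reduced-c≈0) = full , 0<full² , full-solves
      where
      t : Carrier
      t = ⟨ tail (h p) , c ⟩

      -- The first coordinate is the one that the pivot equation forces.
      full : Vector Carrier (suc d)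
      full = - (π * t) ∷ c

      0<full² : 0# < ‖ full ‖²
      0<full² = ≤-<-trans (square-nonneg _) (begin-strict
        - (π * t) * - (π * t)            ≈⟨ +-identityʳ _ ⟨
        - (π * t) * - (π * t) + 0#       ≈⟨ +-comm _ _ ⟩
        0# + - (π * t) * - (π * t)       <⟨ +-monoˡ-< _ 0<c² ⟩
        ‖ c ‖² + - (π * t) * - (π * t)   ≈⟨ +-comm _ _ ⟩
        ‖ full ‖²                        ∎)

      full-solves : h ⊛ full ≋ 0ᵥ
      full-solves j with p Fin.≟ j
      ... | yes ≡.refl = begin-equality
        h p zero * - (π * t) + t          ≈⟨ solve 3 (λ a b t → a :* (:- (b :* t)) :+ t := t :- (a :* b) :* t) refl (h p zero) π t ⟩
        t - h p zero * π * t              ≈⟨ +-congˡ (-‿cong (*-congʳ pivot*π≈1)) ⟩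
        t - 1# * t                        ≈⟨ +-congˡ (-‿cong (*-identityˡ t)) ⟩
        t - t                             ≈⟨ -‿inverseʳ t ⟩
        0#                                ∎
      ... | no p≢j = ≡.subst (λ j → ⟨ h j , full ⟩ ≈ 0#) (Fin.punchIn-punchOut p≢j) (begin-equality
        a * - (π * t) + ⟨ tail (h j′) , c ⟩             ≈⟨ solve 4 (λ a b t s → a :* (:- (b :* t)) :+ s := s :+ (:- (a :* b)) :* t) refl a π t ⟨ tail (h j′) , c ⟩ ⟩
        ⟨ tail (h j′) , c ⟩ + - (a * π) * t             ≈⟨ +-congˡ (dot-·ˡ (- (a * π)) (tail (h p)) c) ⟨
        ⟨ tail (h j′) , c ⟩ + ⟨ - (a * π) ·ᵥ tail (h p) , c ⟩
                                                       ≈⟨ dot-+ˡ (tail (h j′)) (- (a * π) ·ᵥ tail (h p)) c ⟨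
        ⟨ reduced (punchOut p≢j) , c ⟩                 ≈⟨ reduced-c≈0 (punchOut p≢j) ⟩
        0#                                             ∎)
        where
        j′ : Fin (suc r)
        j′ = punchIn p (punchOut p≢j)
        a : Carrier
        a = h j′ zero

  -- The vectors are not normalized, which avoids square roots; inverses `ν` of the squared norms
  -- take their place in expansions.
  Orthogonal : Vector (Vector Carrier m) n → Set
  Orthogonal u = (∀ i → 0# < ‖ u i ‖²) × (∀ i j → ¬ i ≡ j → ⟨ u i , u j ⟩ ≈ 0#)

  dot-orthogonal : (u : Vector (Vector Carrier m) n) → Orthogonal u → ∀ c i →
                   ⟨ u i , combination c u ⟩ ≈ c i * ‖ u i ‖²
  dot-orthogonal u (_ , ⊥) c i = trans (dot-combination (u i) c u)
    (sum-single (λ j → c j * ⟨ u i , u j ⟩) i λ j i≢j → trans (*-congˡ (⊥ i j i≢j)) (zeroʳ (c j)))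

  orthogonal-independent : (u : Vector (Vector Carrier m) n) → Orthogonal u → ∀ c → combination c u ≋ 0ᵥ → c ≋ 0ᵥ
  orthogonal-independent u ⊥@(pos , _) c cu≋0 i = *-cancelˡ-≈0 (pos⇒≉0 (pos i)) (begin-equality
    ‖ u i ‖² * c i                ≈⟨ *-comm _ _ ⟩
    c i * ‖ u i ‖²                ≈⟨ dot-orthogonal u ⊥ c i ⟨
    ⟨ u i , combination c u ⟩     ≈⟨ dot-cong (λ _ → refl) cu≋0 ⟩
    ⟨ u i , 0ᵥ ⟩                  ≈⟨ dot-0ʳ (u i) ⟩
    0#                            ∎)

  -- With more than m vectors, the m coordinate equations for a vanishing combination would have a
  -- nonzero solution, against independence.
  orthogonal⇒≤ : (u : Vector (Vector Carrier m) n) → Orthogonal u → n ℕ.≤ m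
  orthogonal⇒≤ u ⊥ = ℕ.≮⇒≥ λ m<n → independent-absurd (underdetermined m<n (u ᵀ))
    where
    independent-absurd : ¬ (∃[ c ] (0# < ‖ c ‖² × u ᵀ ⊛ c ≋ 0ᵥ))
    independent-absurd (c , 0<c² , uc≋0) = <-irrefl (sym (sum-zero (λ i → c i * c i) λ i →
      trans (*-congʳ (c≋0 i)) (zeroˡ (c i)))) 0<c²
      where
      c≋0 : c ≋ 0ᵥ
      c≋0 = orthogonal-independent u ⊥ c λ a → trans (sum-cong-≋ λ j → *-comm (c j) (u j a)) (uc≋0 a)

  orthogonal-∷ : (u : Vector (Vector Carrier m) n) (v : Vector Carrier m) → Orthogonal u →
                 0# < ‖ v ‖² → (∀ i → ⟨ u i , v ⟩ ≈ 0#) → Orthogonal (v ∷ u)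
  orthogonal-∷ u v (pos , ⊥) 0<v² u⊥v = pos′ , ⊥′
    where
    pos′ : ∀ i → 0# < ‖ (v ∷ u) i ‖²
    pos′ zero    = 0<v²
    pos′ (suc i) = pos i
    ⊥′ : ∀ i j → ¬ i ≡ j → ⟨ (v ∷ u) i , (v ∷ u) j ⟩ ≈ 0#
    ⊥′ zero    zero    i≢j = contradiction ≡.refl i≢j
    ⊥′ zero    (suc j) _   = trans (dot-comm v (u j)) (u⊥v j)
    ⊥′ (suc i) zero    _   = u⊥v i
    ⊥′ (suc i) (suc j) i≢j = ⊥ i j (i≢j ∘ ≡.cong suc)

  -- A nonzero residual of x would extend u to n + 1 orthogonal vectors.
  orthogonal-expansion : (u : Vector (Vector Carrier n) n) → Orthogonal u →
    (ν : Vector Carrier n) → (∀ i → ‖ u i ‖² * ν i ≈ 1#) →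
    ∀ x → x ≋ combination (λ i → ν i * ⟨ u i , x ⟩) u
  orthogonal-expansion {n} u ⊥ ν ν-inv x = expansion (‖‖²-cases residual)
    where
    c : Vector Carrier n
    c i = ν i * ⟨ u i , x ⟩

    residual : Vector Carrier n
    residual = x +ᵥ (- 1#) ·ᵥ combination c u

    u⊥residual : ∀ i → ⟨ u i , residual ⟩ ≈ 0#
    u⊥residual i = begin-equality
      ⟨ u i , residual ⟩                                     ≈⟨ dot-+ʳ (u i) x ((- 1#) ·ᵥ combination c u) ⟩
      ⟨ u i , x ⟩ + ⟨ u i , (- 1#) ·ᵥ combination c u ⟩      ≈⟨ +-congˡ (dot-·ʳ (- 1#) (u i) (combination c u)) ⟩
      ⟨ u i , x ⟩ + - 1# * ⟨ u i , combination c u ⟩         ≈⟨ +-congˡ (*-congˡ (dot-orthogonal u ⊥ c i)) ⟩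
      ⟨ u i , x ⟩ + - 1# * (ν i * ⟨ u i , x ⟩ * ‖ u i ‖²)    ≈⟨ solve 4 (λ o w v t → t :+ (:- o) :* (v :* t :* w) := t :- o :* (w :* v) :* t) refl 1# ‖ u i ‖² (ν i) ⟨ u i , x ⟩ ⟩
      ⟨ u i , x ⟩ - 1# * (‖ u i ‖² * ν i) * ⟨ u i , x ⟩      ≈⟨ +-congˡ (-‿cong (*-congʳ (trans (*-identityˡ _) (ν-inv i)))) ⟩
      ⟨ u i , x ⟩ - 1# * ⟨ u i , x ⟩                         ≈⟨ +-congˡ (-‿cong (*-identityˡ _)) ⟩
      ⟨ u i , x ⟩ - ⟨ u i , x ⟩                              ≈⟨ -‿inverseʳ _ ⟩
      0#                                                     ∎

    expansion : 0# < ‖ residual ‖² ⊎ residual ≋ 0ᵥ → x ≋ combination c u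
    expansion (inj₁ 0<r²) = contradiction (orthogonal⇒≤ (residual ∷ u) (orthogonal-∷ u residual ⊥ 0<r² u⊥residual)) ℕ.1+n≰n
    expansion (inj₂ r≋0) i = begin-equality
      x i                                          ≈⟨ solve 3 (λ o x y → x := (x :+ (:- o) :* y) :+ o :* y) refl 1# (x i) (combination c u i) ⟩
      residual i + 1# * combination c u i          ≈⟨ +-cong (r≋0 i) (*-identityˡ _) ⟩
      0# + combination c u i                       ≈⟨ +-identityˡ _ ⟩
      combination c u i                            ∎

-- The spectral theorem for real symmetric matrices.

module SpectralTheorem (ℝ : RealNumbers) where
  open RealNumbers ℝ
  open OrderedField ℝ
  open Spectra ℝ
  open Vectors ℝ
  open Vector using (_∷_; tail)

  IsSymmetric : Matrix m → Set
  IsSymmetric M = ∀ i j → M i j ≈ M j i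

  self-adjoint : {M : Matrix m} → IsSymmetric M → ∀ x y → ⟨ x , M ⊛ y ⟩ ≈ ⟨ M ⊛ x , y ⟩
  self-adjoint {M = M} M-sym x y = trans (adjoint M x y)
    (dot-cong (λ j → dot-cong {y = x} (λ i → M-sym i j) (λ _ → refl)) (λ _ → refl))

  -- Each term of the double sum is bounded on its own, by the entry constant `1# + M i j * M i j`.
  -- The extra summand `1#` makes K positive even for the empty matrix, so that K can be inverted.
  form-bounded : (M : Matrix m) → ∃[ K ] (0# < K × (∀ v → ⟨ v , M ⊛ v ⟩ ≤ K * ‖ v ‖²))
  form-bounded M = 1# + ∑c , +-pos-nonneg 0<1 0≤∑c , bound
    where
    c : Matrix _
    c i j = 1# + M i j * M i j
    0≤c : ∀ i j → 0# ≤ c i j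
    0≤c i j = +-nonneg (<⇒≤ 0<1) (square-nonneg (M i j))
    ∑c : Carrier
    ∑c = sum λ i → sum λ j → c i j
    0≤∑c : 0# ≤ ∑c
    0≤∑c = sum-nonneg (λ i → sum (c i)) (λ i → sum-nonneg (c i) (0≤c i))

    -- Twice the difference of the two sides is (a - rb)² + (s - a²) + r²(s - b²) + (1 + r²)s.
    entry-bound : ∀ {a b r s} → a * a ≤ s → b * b ≤ s → 0# ≤ s → a * (r * b) ≤ (1# + r * r) * s
    entry-bound {a} {b} {r} {s} a²≤s b²≤s 0≤s = ≤-diff
      (double-nonneg (≤-trans
        (+-nonneg (+-nonneg (+-nonneg (square-nonneg (a - r * b)) (diff-nonneg a²≤s))
                            (*-nonneg (square-nonneg r) (diff-nonneg b²≤s)))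
                  (*-nonneg (+-nonneg (<⇒≤ 0<1) (square-nonneg r)) 0≤s))
        (≤-reflexive (trans
          (+-congʳ (+-congʳ (+-congˡ (+-congʳ (sym (*-identityˡ s))))))
          (solve 5 (λ o a b r s →
            (a :- r :* b) :* (a :- r :* b) :+ (o :* s :- a :* a) :+ r :* r :* (s :- b :* b) :+ (o :+ r :* r) :* s
            := ((o :+ r :* r) :* s :- a :* (r :* b)) :+ ((o :+ r :* r) :* s :- a :* (r :* b))) refl 1# a b r s)))))
      refl

    bound : ∀ v → ⟨ v , M ⊛ v ⟩ ≤ (1# + ∑c) * ‖ v ‖²
    bound v = begin
      (sum λ i → v i * sum λ j → M i j * v j)      ≈⟨ sum-cong-≋ (λ i → *-distribˡ-sum (v i) (λ j → M i j * v j)) ⟩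
      (sum λ i → sum λ j → v i * (M i j * v j))    ≤⟨ sum-mono (λ i → sum-mono λ j →
                                                        entry-bound (square≤‖‖² v i) (square≤‖‖² v j) (‖‖²-nonneg v)) ⟩
      (sum λ i → sum λ j → c i j * ‖ v ‖²)         ≈⟨ sum-cong-≋ (λ i → *-distribʳ-sum ‖ v ‖² (c i)) ⟨
      (sum λ i → sum (c i) * ‖ v ‖²)               ≈⟨ *-distribʳ-sum ‖ v ‖² (λ i → sum (c i)) ⟨
      ∑c * ‖ v ‖²                                  ≤⟨ ≤-diff (‖‖²-nonneg v)
        (trans (sym (*-identityˡ _)) (solve 3 (λ o c s → o :* s := (o :+ c) :* s :- c :* s) refl 1# ∑c ‖ v ‖²)) ⟩
      (1# + ∑c) * ‖ v ‖²                           ∎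

  -- Serves to collect solutions of N x = δ i for all i into an inverse of N, unless one of the
  -- systems reveals that N is singular.
  choose : {A B : Set} {P : Fin n → B → Set} → (∀ i → A ⊎ (∃[ x ] P i x)) →
           A ⊎ (∃ λ (R : Fin n → B) → ∀ i → P i (R i))
  choose {zero}  _ = inj₂ ((λ ()) , λ ())
  choose {suc n} {P = P} f with f zero | choose {P = P ∘ suc} (f ∘ suc)
  ... | inj₁ a       | _            = inj₁ a
  ... | inj₂ _       | inj₁ a       = inj₁ a
  ... | inj₂ (x , p) | inj₂ (R , q) = inj₂ (x ∷ R , λ { zero → p ; (suc i) → q i })

  Singular : Matrix m → Set
  Singular N = ∃[ v ] (0# < ‖ v ‖² × N ⊛ v ≋ 0ᵥ)

  -- The m equations c₀ δ i + N c = 0 in m + 1 unknowns have a nonzero solution. If c₀ = 0, then c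
  -- is a kernel vector; otherwise -c / c₀ solves the system.
  singular-or-solvable : (N : Matrix m) → ∀ i → Singular N ⊎ (∃[ x ] N ⊛ x ≋ δ i)
  singular-or-solvable N i with c , 0<c² , solves ← underdetermined ℕ.≤-refl (λ j → δ i j ∷ N j) with c zero ≟ 0#
  ... | yes c₀≈0 = inj₁ (tail c , <-≤-trans 0<c² (≤-reflexive (trans (+-congʳ (trans (*-congʳ c₀≈0) (zeroˡ _))) (+-identityˡ _))) ,
    λ j → trans (sym (+-identityˡ _)) (trans (+-congʳ (sym (trans (*-congˡ c₀≈0) (zeroʳ (δ i j))))) (solves j)))
  ... | no c₀≉0 with π , c₀π≈1 ← inverse (c zero) c₀≉0 = inj₂ ((- π) ·ᵥ tail c , λ j → begin-equality
    ⟨ N j , (- π) ·ᵥ tail c ⟩                        ≈⟨ dot-·ʳ (- π) (N j) (tail c) ⟩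
    - π * ⟨ N j , tail c ⟩                           ≈⟨ solve 4 (λ π d c s → (:- π) :* s := (c :* π) :* d :- π :* (d :* c :+ s)) refl π (δ i j) (c zero) ⟨ N j , tail c ⟩ ⟩
    c zero * π * δ i j - π * (δ i j * c zero + ⟨ N j , tail c ⟩)
                                                     ≈⟨ +-cong (*-congʳ c₀π≈1) (-‿cong (*-congˡ (solves j))) ⟩
    1# * δ i j - π * 0#                              ≈⟨ +-cong (*-identityˡ _) (-‿cong (zeroʳ π)) ⟩
    δ i j - 0#                                       ≈⟨ trans (+-congˡ -0#≈0#) (+-identityʳ _) ⟩
    δ i j                                            ∎)

  ⊛-linear : (A : Fin m → Fin n → Carrier) → ∀ a x b y → A ⊛ (a ·ᵥ x +ᵥ b ·ᵥ y) ≋ a ·ᵥ (A ⊛ x) +ᵥ b ·ᵥ (A ⊛ y)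
  ⊛-linear A a x b y i = trans (dot-+ʳ (A i) (a ·ᵥ x) (b ·ᵥ y)) (+-cong (dot-·ʳ a (A i) x) (dot-·ʳ b (A i) y))

  dot-linearˡ : ∀ a (x : Vector Carrier n) b y z → ⟨ a ·ᵥ x +ᵥ b ·ᵥ y , z ⟩ ≈ a * ⟨ x , z ⟩ + b * ⟨ y , z ⟩
  dot-linearˡ a x b y z = trans (dot-+ˡ (a ·ᵥ x) (b ·ᵥ y) z) (+-cong (dot-·ˡ a x z) (dot-·ˡ b y z))

  dot-linearʳ : ∀ a (x : Vector Carrier n) b y z → ⟨ z , a ·ᵥ x +ᵥ b ·ᵥ y ⟩ ≈ a * ⟨ z , x ⟩ + b * ⟨ z , y ⟩
  dot-linearʳ a x b y z = trans (dot-+ʳ z (a ·ᵥ x) (b ·ᵥ y)) (+-cong (dot-·ʳ a z x) (dot-·ʳ b z y))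

  form-expand : {N : Matrix m} → IsSymmetric N → ∀ a v b w →
                ⟨ a ·ᵥ v +ᵥ b ·ᵥ w , N ⊛ (a ·ᵥ v +ᵥ b ·ᵥ w) ⟩ ≈
                a * (a * ⟨ v , N ⊛ v ⟩ + b * ⟨ v , N ⊛ w ⟩) + b * (a * ⟨ v , N ⊛ w ⟩ + b * ⟨ w , N ⊛ w ⟩)
  form-expand {N = N} N-sym a v b w = begin-equality
    ⟨ z , N ⊛ z ⟩                                    ≈⟨ dot-linearˡ a v b w (N ⊛ z) ⟩
    a * ⟨ v , N ⊛ z ⟩ + b * ⟨ w , N ⊛ z ⟩            ≈⟨ +-cong (*-congˡ (part v)) (*-congˡ (trans (part w) (+-congʳ (*-congˡ exchange)))) ⟩
    a * (a * ⟨ v , N ⊛ v ⟩ + b * ⟨ v , N ⊛ w ⟩) + b * (a * ⟨ v , N ⊛ w ⟩ + b * ⟨ w , N ⊛ w ⟩) ∎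
    where
    z : Vector Carrier _
    z = a ·ᵥ v +ᵥ b ·ᵥ w
    part : ∀ x → ⟨ x , N ⊛ z ⟩ ≈ a * ⟨ x , N ⊛ v ⟩ + b * ⟨ x , N ⊛ w ⟩
    part x = trans (dot-cong {x = x} (λ _ → refl) (⊛-linear N a v b w)) (dot-linearʳ a (N ⊛ v) b (N ⊛ w) x)
    exchange : ⟨ w , N ⊛ v ⟩ ≈ ⟨ v , N ⊛ w ⟩
    exchange = trans (self-adjoint N-sym w v) (dot-comm (N ⊛ w) v)

  -- For w = N⁻¹v and K bounding the form of N⁻¹, positivity of the form of N at Kv − w says K⟨v , Nv⟩ ≥ ‖v‖².
  coercive : {N : Matrix m} → IsSymmetric N → (∀ v → 0# ≤ ⟨ v , N ⊛ v ⟩) →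
             (R : Matrix m) → (∀ i → N ⊛ R i ≋ δ i) →
             ∃[ κ ] (0# < κ × (∀ v → κ * ‖ v ‖² ≤ ⟨ v , N ⊛ v ⟩))
  coercive {m} {N} N-sym N-psd R NR≋δ = κ , 0<κ , λ v → divide-≤ 0<κ Kκ≈1 (0≤Kq-s v)
    where
    K-of : ∃[ K ] (0# < K × (∀ v → ⟨ v , R ᵀ ⊛ v ⟩ ≤ K * ‖ v ‖²))
    K-of = form-bounded (R ᵀ)
    K : Carrier
    K = proj₁ K-of
    0<K : 0# < K
    0<K = proj₁ (proj₂ K-of)

    κ-of : ∃[ κ ] (K * κ ≈ 1# × 0# < κ)
    κ-of = pos-inverse 0<K
    κ : Carrier
    κ = proj₁ κ-of
    Kκ≈1 : K * κ ≈ 1#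
    Kκ≈1 = proj₁ (proj₂ κ-of)
    0<κ : 0# < κ
    0<κ = proj₂ (proj₂ κ-of)

    module _ (v : Vector Carrier m) where
      -- The rows of `R` are the columns of the inverse of N, hence the transpose.
      w : Vector Carrier m
      w = R ᵀ ⊛ v
      q s t : Carrier
      q = ⟨ v , N ⊛ v ⟩
      s = ‖ v ‖²
      t = ⟨ v , w ⟩

      Nw≋v : N ⊛ w ≋ v
      Nw≋v a = begin-equality
        ⟨ N a , w ⟩                          ≈⟨ dot-cong {x = N a} (λ _ → refl) (λ b → sum-cong-≋ λ i → *-comm (R i b) (v i)) ⟩
        ⟨ N a , combination v R ⟩            ≈⟨ dot-combination (N a) v R ⟩
        (sum λ i → v i * ⟨ N a , R i ⟩)      ≈⟨ sum-cong-≋ (λ i → trans (*-comm (v i) _) (*-congʳ (trans (NR≋δ i a) (δ-sym i a)))) ⟩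
        ⟨ δ a , v ⟩                          ≈⟨ dot-δ v a ⟩
        v a                                  ∎

      vNw : ⟨ v , N ⊛ w ⟩ ≈ s
      vNw = dot-cong {x = v} (λ _ → refl) Nw≋v

      wNw : ⟨ w , N ⊛ w ⟩ ≈ t
      wNw = trans (dot-cong {x = w} (λ _ → refl) Nw≋v) (dot-comm w v)

      z : Vector Carrier m
      z = K ·ᵥ v +ᵥ (- 1#) ·ᵥ w

      -- The form at z is K²q - 2Ks + t. Adding Ks - t, nonnegative by the choice of K, removes the
      -- unknown t.
      expand : ⟨ z , N ⊛ z ⟩ + (K * s - t) ≈ K * (K * q - s)
      expand = begin-equality
        ⟨ z , N ⊛ z ⟩ + (K * s - t)
          ≈⟨ +-congʳ (form-expand N-sym K v (- 1#) w) ⟩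
        K * (K * q + - 1# * ⟨ v , N ⊛ w ⟩) + - 1# * (K * ⟨ v , N ⊛ w ⟩ + - 1# * ⟨ w , N ⊛ w ⟩) + (K * s - t)
          ≈⟨ +-congʳ (+-cong (*-congˡ (+-congˡ (trans (neg-one _) (-‿cong vNw))))
                             (trans (neg-one _) (-‿cong (+-cong (*-congˡ vNw) (trans (neg-one _) (-‿cong wNw)))))) ⟩
        K * (K * q - s) - (K * s - t) + (K * s - t)
          ≈⟨ solve 2 (λ a b → a :- b :+ b := a) refl (K * (K * q - s)) (K * s - t) ⟩
        K * (K * q - s) ∎

      0≤Kq-s : 0# ≤ K * q - s
      0≤Kq-s = *-cancelˡ-nonneg 0<K (≤-trans (+-nonneg (N-psd z) (diff-nonneg (proj₂ (proj₂ K-of) v))) (≤-reflexive expand))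

  -- The Rayleigh quotients together with everything below them. The supremum is the same, and no
  -- division occurs in the definition.
  Rayleigh : Matrix m → Carrier → Set
  Rayleigh M μ = ∃[ v ] (0# < ‖ v ‖² × μ * ‖ v ‖² ≤ ⟨ v , M ⊛ v ⟩)

  rayleigh-quotient : (M : Matrix m) (v : Vector Carrier m) → 0# < ‖ v ‖² → ∃[ μ ] μ * ‖ v ‖² ≈ ⟨ v , M ⊛ v ⟩
  rayleigh-quotient M v 0<v² with π , v²π≈1 ← inverse ‖ v ‖² (pos⇒≉0 0<v²) = ⟨ v , M ⊛ v ⟩ * π , (begin-equality
    ⟨ v , M ⊛ v ⟩ * π * ‖ v ‖²       ≈⟨ solve 3 (λ q π s → q :* π :* s := (s :* π) :* q) refl ⟨ v , M ⊛ v ⟩ π ‖ v ‖² ⟩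
    ‖ v ‖² * π * ⟨ v , M ⊛ v ⟩       ≈⟨ trans (*-congʳ v²π≈1) (*-identityˡ _) ⟩
    ⟨ v , M ⊛ v ⟩                    ∎)

  rayleigh≤ : (M : Matrix m) → ∀ {K} → (∀ v → ⟨ v , M ⊛ v ⟩ ≤ K * ‖ v ‖²) → UpperBound (Rayleigh M) K
  rayleigh≤ M M≤K μ (v , 0<v² , μ≤) = *-cancelʳ-≤ 0<v² (≤-trans μ≤ (M≤K v))

  form≤rayleigh-bound : (M : Matrix m) → ∀ {s} → UpperBound (Rayleigh M) s → ∀ v → ⟨ v , M ⊛ v ⟩ ≤ s * ‖ v ‖²
  form≤rayleigh-bound M {s} s-upper v with ‖‖²-cases v
  ... | inj₁ 0<v² with μ , μv²≈q ← rayleigh-quotient M v 0<v² =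
    ≤-trans (≤-reflexive (sym μv²≈q)) (*-monoʳ-≤ (‖‖²-nonneg v) (s-upper μ (v , 0<v² , ≤-reflexive μv²≈q)))
  ... | inj₂ v≋0 = ≤-reflexive (trans (sum-zero (λ i → v i * (M ⊛ v) i) (λ i → trans (*-congʳ (v≋0 i)) (zeroˡ _)))
    (sym (trans (*-congˡ (sum-zero (λ i → v i * v i) (λ i → trans (*-congʳ (v≋0 i)) (zeroˡ _)))) (zeroʳ s))))

  -- For the supremum s of the Rayleigh quotients, s I − M is positive semidefinite,
  -- and if it were invertible, hence coercive, then s could be lowered.
  module _ {M : Matrix m} (M-sym : IsSymmetric M) {s : Carrier}
           (s-upper : UpperBound (Rayleigh M) s) (s-least : ∀ u → UpperBound (Rayleigh M) u → s ≤ u) where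
    private
      N : Matrix m
      N i = s ·ᵥ δ i +ᵥ (- 1#) ·ᵥ M i

      Nv≋ : ∀ v → N ⊛ v ≋ s ·ᵥ v +ᵥ (- 1#) ·ᵥ (M ⊛ v)
      Nv≋ v i = trans (dot-linearˡ s (δ i) (- 1#) (M i) v) (+-congʳ (*-congˡ (dot-δ v i)))

      N-sym : IsSymmetric N
      N-sym i j = +-cong (*-congˡ (δ-sym i j)) (*-congˡ (M-sym i j))

      N-form : ∀ v → ⟨ v , N ⊛ v ⟩ ≈ s * ‖ v ‖² - ⟨ v , M ⊛ v ⟩
      N-form v = trans (dot-cong {x = v} (λ _ → refl) (Nv≋ v)) (trans (dot-linearʳ s v (- 1#) (M ⊛ v) v) (+-congˡ (neg-one _)))

      N-psd : ∀ v → 0# ≤ ⟨ v , N ⊛ v ⟩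
      N-psd v = ≤-trans (diff-nonneg (form≤rayleigh-bound M s-upper v)) (≤-reflexive (sym (N-form v)))

      not-coercive : ∀ {κ} → 0# < κ → (∀ v → κ * ‖ v ‖² ≤ ⟨ v , N ⊛ v ⟩) → s ≤ s - κ
      not-coercive {κ} 0<κ κ≤N = s-least (s - κ) (rayleigh≤ M λ v →
        ≤-diff (diff-nonneg (κ≤N v)) (trans (+-congʳ (N-form v)) (regroup ⟨ v , M ⊛ v ⟩ ‖ v ‖²)))
        where
        regroup : ∀ q w → s * w - q - κ * w ≈ (s - κ) * w - q
        regroup = solve 4 (λ s κ q w → s :* w :- q :- κ :* w := (s :- κ) :* w :- q) refl s κ

      kernel⇒eigenvector : ∀ v → N ⊛ v ≋ 0ᵥ → M ⊛ v ≋ s ·ᵥ v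
      kernel⇒eigenvector v Nv≋0 i = begin-equality
        (M ⊛ v) i                                          ≈⟨ cancel ((M ⊛ v) i) (s * v i) ⟩
        s * v i - (s * v i - (M ⊛ v) i)                    ≈⟨ +-congˡ (-‿cong (+-congˡ (neg-one _))) ⟨
        s * v i - (s * v i + - 1# * (M ⊛ v) i)             ≈⟨ +-congˡ (-‿cong (trans (sym (Nv≋ v i)) (Nv≋0 i))) ⟩
        s * v i - 0#                                       ≈⟨ trans (+-congˡ -0#≈0#) (+-identityʳ _) ⟩
        s * v i                                            ∎
        where
        cancel : ∀ a b → a ≈ b - (b - a)
        cancel = solve 2 (λ a b → a := b :- (b :- a)) refl

      from-cases : Singular N ⊎ (∃ λ (R : Matrix m) → ∀ i → N ⊛ R i ≋ δ i) →
                   ∃[ v ] (0# < ‖ v ‖² × M ⊛ v ≋ s ·ᵥ v)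
      from-cases (inj₁ (v , 0<v² , Nv≋0)) = v , 0<v² , kernel⇒eigenvector v Nv≋0
      from-cases (inj₂ (R , NR≋δ)) = absurd (coercive N-sym N-psd R NR≋δ)
        where
        absurd : ∃[ κ ] (0# < κ × (∀ v → κ * ‖ v ‖² ≤ ⟨ v , N ⊛ v ⟩)) → _
        absurd (κ , 0<κ , κ≤N) = contradiction (<-diff 0<κ (solve 2 (λ s κ → κ := s :- (s :- κ)) refl s κ)) (not-coercive 0<κ κ≤N)

    sup-eigenvector : ∃[ v ] (0# < ‖ v ‖² × M ⊛ v ≋ s ·ᵥ v)
    sup-eigenvector = from-cases (choose {P = λ i x → N ⊛ x ≋ δ i} (singular-or-solvable N))

  -- The index guarantees that the space is nonzero, so that there is a Rayleigh quotient at all.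
  top-eigenvector : Fin m → (M : Matrix m) → IsSymmetric M →
    ∃[ s ] ((∃[ v ] (0# < ‖ v ‖² × M ⊛ v ≋ s ·ᵥ v)) × (∀ w → ⟨ w , M ⊛ w ⟩ ≤ s * ‖ w ‖²))
  top-eigenvector {m} i M M-sym = from-sup (supremum (Rayleigh M) satisfiable bounded)
    where
    0<e² : 0# < ‖ δ i ‖²
    0<e² = ‖δ‖²-pos i
    satisfiable : ∃[ μ ] Rayleigh M μ
    satisfiable = proj₁ (rayleigh-quotient M (δ i) 0<e²) , δ i , 0<e² , ≤-reflexive (proj₂ (rayleigh-quotient M (δ i) 0<e²))
    bounded : ∃[ K ] UpperBound (Rayleigh M) K
    bounded = proj₁ (form-bounded M) , rayleigh≤ M (proj₂ (proj₂ (form-bounded M)))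
    from-sup : ∃[ s ] (UpperBound (Rayleigh M) s × (∀ u → UpperBound (Rayleigh M) u → s ≤ u)) → _
    from-sup (s , s-upper , s-least) = s , sup-eigenvector M-sym s-upper s-least , form≤rayleigh-bound M s-upper

  record Eigensystem (M : Matrix m) (r : ℕ) : Set where
    field
      vectors    : Vector (Vector Carrier m) r
      values     : Vector Carrier r
      orthogonal : Orthogonal vectors
      eigen      : ∀ i → M ⊛ vectors i ≋ values i ·ᵥ vectors i

  -- Deflation: the known eigenvectors are given an eigenvalue −L below the Rayleigh quotients of M,
  -- so that a top eigenvector of the modified matrix M′ is orthogonal to them.
  module _ {M : Matrix m} (M-sym : IsSymmetric M) (r<m : r ℕ.< m) (system : Eigensystem M r) where
    private
      open Eigensystem system renaming (vectors to u; values to Λ)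

      ν-of : ∀ i → ∃[ y ] (‖ u i ‖² * y ≈ 1# × 0# < y)
      ν-of i = pos-inverse (proj₁ orthogonal i)

      ν : Vector Carrier r
      ν i = proj₁ (ν-of i)

      -M : Matrix m
      -M i = (- 1#) ·ᵥ M i

      -M-bounded : ∃[ K ] (0# < K × (∀ v → ⟨ v , -M ⊛ v ⟩ ≤ K * ‖ v ‖²))
      -M-bounded = form-bounded -M

      -- K bounds the form of -M, so every Rayleigh quotient of M is at least -K and -L lies
      -- strictly below them all.
      K L : Carrier
      K = proj₁ -M-bounded
      L = K + 1#

      -- Adding the rank one matrix `c i` uᵢuᵢᵀ changes the eigenvalue of uᵢ by `c i` times its
      -- squared norm, that is from Λᵢ to -L.
      c : Vector Carrier r
      c i = - ((Λ i + L) * ν i)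

      M′ : Matrix m
      M′ a = M a +ᵥ combination (λ i → c i * u i a) u

      M′-sym : IsSymmetric M′
      M′-sym a b = +-cong (M-sym a b) (sum-cong-≋ λ i →
        solve 3 (λ c x y → c :* x :* y := c :* y :* x) refl (c i) (u i a) (u i b))

      M′-expand : ∀ x a → (M′ ⊛ x) a ≈ (M ⊛ x) a + sum (λ i → c i * u i a * ⟨ x , u i ⟩)
      M′-expand x a = trans (dot-+ˡ (M a) (combination (λ i → c i * u i a) u) x)
        (+-congˡ (trans (dot-comm (combination (λ i → c i * u i a) u) x) (dot-combination x (λ i → c i * u i a) u)))

      M′≋M : ∀ x → (∀ i → ⟨ u i , x ⟩ ≈ 0#) → M′ ⊛ x ≋ M ⊛ x
      M′≋M x u⊥x a = trans (M′-expand x a) (trans (+-congˡ (sum-zero (λ i → c i * u i a * ⟨ x , u i ⟩)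
        λ i → trans (*-congˡ (trans (dot-comm x (u i)) (u⊥x i))) (zeroʳ _))) (+-identityʳ _))

      M′u≋-Lu : ∀ j → M′ ⊛ u j ≋ (- L) ·ᵥ u j
      M′u≋-Lu j a = begin-equality
        (M′ ⊛ u j) a                                                 ≈⟨ M′-expand (u j) a ⟩
        (M ⊛ u j) a + sum (λ i → c i * u i a * ⟨ u j , u i ⟩)        ≈⟨ +-cong (eigen j a) (sum-single (λ i → c i * u i a * ⟨ u j , u i ⟩) j
                                                                         λ i j≢i → trans (*-congˡ (proj₂ orthogonal j i j≢i)) (zeroʳ _)) ⟩
        Λ j * u j a + c j * u j a * ‖ u j ‖²                         ≈⟨ regroup (Λ j) L (ν j) (u j a) ‖ u j ‖² ⟩
        Λ j * u j a - (Λ j + L) * u j a * (‖ u j ‖² * ν j)           ≈⟨ +-congˡ (-‿cong (trans (*-congˡ (proj₁ (proj₂ (ν-of j)))) (*-identityʳ _))) ⟩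
        Λ j * u j a - (Λ j + L) * u j a                              ≈⟨ cancel (Λ j) L (u j a) ⟩
        - L * u j a                                                  ∎
        where
        regroup : ∀ Λ L ν x w → Λ * x + - ((Λ + L) * ν) * x * w ≈ Λ * x - (Λ + L) * x * (w * ν)
        regroup = solve 5 (λ Λ L ν x w → Λ :* x :+ (:- ((Λ :+ L) :* ν)) :* x :* w := Λ :* x :- (Λ :+ L) :* x :* (w :* ν)) refl
        cancel : ∀ Λ L x → Λ * x - (Λ + L) * x ≈ - L * x
        cancel = solve 3 (λ Λ L x → Λ :* x :- (Λ :+ L) :* x := (:- L) :* x) refl

      module _ {s v} (0<v² : 0# < ‖ v ‖²) (M′v≋sv : M′ ⊛ v ≋ s ·ᵥ v) (M′≤s : ∀ w → ⟨ w , M′ ⊛ w ⟩ ≤ s * ‖ w ‖²) where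
        -- Such a w exists because r < m. On it M′ agrees with M, so s is at least a Rayleigh
        -- quotient of M and hence at least -K.
        0≤s+K : ∃[ w ] (0# < ‖ w ‖² × u ⊛ w ≋ 0ᵥ) → 0# ≤ s + K
        0≤s+K (w , 0<w² , u⊥w) = *-cancelˡ-nonneg 0<w² (≤-trans
          (+-nonneg (diff-nonneg (M′≤s w)) (diff-nonneg (proj₂ (proj₂ -M-bounded) w)))
          (≤-reflexive (trans
            (+-cong (+-congˡ (-‿cong (dot-cong {x = w} (λ _ → refl) (M′≋M w u⊥w))))
                    (+-congˡ (-‿cong (trans (dot-cong {x = w} (λ _ → refl) (λ i → dot-·ˡ (- 1#) (M i) w)) (trans (dot-·ʳ (- 1#) w (M ⊛ w)) (neg-one _))))))
            (regroup s K ⟨ w , M ⊛ w ⟩ ‖ w ‖²))))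
          where
          regroup : ∀ s K q w → (s * w - q) + (K * w - - q) ≈ w * (s + K)
          regroup = solve 4 (λ s K q w → (s :* w :- q) :+ (K :* w :- (:- q)) := w :* (s :+ K)) refl

        0<s+L : 0# < s + L
        0<s+L = begin-strict
          0#             <⟨ 0<1 ⟩
          1#             ≈⟨ +-identityˡ 1# ⟨
          0# + 1#        ≤⟨ +-monoˡ-≤ 1# (0≤s+K (underdetermined r<m u)) ⟩
          s + K + 1#     ≈⟨ +-assoc s K 1# ⟩
          s + L          ∎

        -- Both are eigenvectors of the symmetric M′, for the distinct eigenvalues -L and s.
        u⊥v : ∀ j → ⟨ u j , v ⟩ ≈ 0#
        u⊥v j = *-cancelˡ-≈0 (pos⇒≉0 0<s+L) (begin-equality
          (s + L) * ⟨ u j , v ⟩                          ≈⟨ regroup s L ⟨ u j , v ⟩ ⟩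
          s * ⟨ u j , v ⟩ - - L * ⟨ u j , v ⟩            ≈⟨ +-cong (dot-·ʳ s (u j) v) (-‿cong (dot-·ˡ (- L) (u j) v)) ⟨
          ⟨ u j , s ·ᵥ v ⟩ - ⟨ (- L) ·ᵥ u j , v ⟩        ≈⟨ +-cong (dot-cong {x = u j} (λ _ → refl) M′v≋sv) (-‿cong (dot-cong {y = v} (M′u≋-Lu j) (λ _ → refl))) ⟨
          ⟨ u j , M′ ⊛ v ⟩ - ⟨ M′ ⊛ u j , v ⟩            ≈⟨ +-congʳ (self-adjoint M′-sym (u j) v) ⟩
          ⟨ M′ ⊛ u j , v ⟩ - ⟨ M′ ⊛ u j , v ⟩            ≈⟨ -‿inverseʳ _ ⟩
          0#                                             ∎)
          where
          regroup : ∀ s L t → (s + L) * t ≈ s * t - - L * t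
          regroup = solve 3 (λ s L t → (s :+ L) :* t := s :* t :- (:- L) :* t) refl

        extension : Eigensystem M (suc r)
        extension = record
          { vectors    = v ∷ u
          ; values     = s ∷ Λ
          ; orthogonal = orthogonal-∷ u v orthogonal 0<v² u⊥v
          ; eigen      = λ { zero a → trans (sym (M′≋M v u⊥v a)) (M′v≋sv a) ; (suc i) → eigen i }
          }

      extend : ∃[ s ] ((∃[ v ] (0# < ‖ v ‖² × M′ ⊛ v ≋ s ·ᵥ v)) × (∀ w → ⟨ w , M′ ⊛ w ⟩ ≤ s * ‖ w ‖²)) → Eigensystem M (suc r)
      extend (s , (v , 0<v² , M′v≋sv) , M′≤s) = extension 0<v² M′v≋sv M′≤s

    eigensystem-suc : Eigensystem M (suc r)
    eigensystem-suc = extend (top-eigenvector (Fin.fromℕ< r<m) M′ M′-sym)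

  eigensystem : {M : Matrix m} → IsSymmetric M → Eigensystem M m
  eigensystem {m} {M} M-sym = build m ℕ.≤-refl
    where
    build : ∀ r → r ℕ.≤ m → Eigensystem M r
    build zero    _   = record { vectors = λ () ; values = λ () ; orthogonal = (λ ()) , (λ ()) ; eigen = λ () }
    build (suc r) r<m = eigensystem-suc M-sym r<m (build r (ℕ.<⇒≤ r<m))

-- Counting and enumerating the eigenvalues with a given property.

module Selection {A : Set} {P : Pred A 0ℓ} (P? : Decidable P) where
  count : (Fin n → A) → ℕ
  count Λ = length (filter P? (tabulate Λ))

  -- `IsSpectrum` and `HasInertia` count by lengths of filtered lists. This enumerates the counted
  -- positions, so that families of vectors of exactly that length can be formed.
  select : (Λ : Fin n → A) → Fin (count Λ) → Fin n
  select {suc n} Λ j with P? (Λ zero)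
  select {suc n} Λ zero    | yes _ = zero
  select {suc n} Λ (suc j) | yes _ = suc (select (Λ ∘ suc) j)
  select {suc n} Λ j       | no _  = suc (select (Λ ∘ suc) j)

  select-sound : (Λ : Fin n → A) → ∀ j → P (Λ (select Λ j))
  select-sound {suc n} Λ j with P? (Λ zero)
  select-sound {suc n} Λ zero    | yes p = p
  select-sound {suc n} Λ (suc j) | yes _ = select-sound (Λ ∘ suc) j
  select-sound {suc n} Λ j       | no _  = select-sound (Λ ∘ suc) j

  select-injective : (Λ : Fin n → A) → ∀ j k → select Λ j ≡ select Λ k → j ≡ k
  select-injective {suc n} Λ j k eq with P? (Λ zero)
  select-injective {suc n} Λ zero    zero    eq | yes _ = ≡.refl
  select-injective {suc n} Λ (suc j) (suc k) eq | yes _ = ≡.cong suc (select-injective (Λ ∘ suc) j k (Fin.suc-injective eq))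
  select-injective {suc n} Λ j       k       eq | no _  = select-injective (Λ ∘ suc) j k (Fin.suc-injective eq)

  select-complete : (Λ : Fin n → A) → ∀ i → P (Λ i) → ∃[ j ] select Λ j ≡ i
  select-complete {suc n} Λ i p with P? (Λ zero)
  select-complete {suc n} Λ zero    p | yes _ = zero , ≡.refl
  select-complete {suc n} Λ (suc i) p | yes _ with j , eq ← select-complete (Λ ∘ suc) i p = suc j , ≡.cong suc eq
  select-complete {suc n} Λ zero    p | no ¬p = contradiction p ¬p
  select-complete {suc n} Λ (suc i) p | no _  with j , eq ← select-complete (Λ ∘ suc) i p = j , ≡.cong suc eq

open Selection

length-filter-disjoint : {A : Set} {P Q : Pred A 0ℓ} (P? : Decidable P) (Q? : Decidable Q) →
  (∀ {x} → P x → ¬ Q x) → ∀ xs → length (filter P? xs) ℕ.+ length (filter Q? xs) ℕ.≤ length xs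
length-filter-disjoint P? Q? disjoint List.[] = ℕ.z≤n
length-filter-disjoint P? Q? disjoint (x List.∷ xs) with P? x | Q? x | length-filter-disjoint P? Q? disjoint xs
... | yes p | yes q | _  = contradiction q (disjoint p)
... | yes _ | no _  | ih = ℕ.s≤s ih
... | no _  | yes _ | ih = ℕ.≤-trans (ℕ.≤-reflexive (ℕ.+-suc _ _)) (ℕ.s≤s ih)
... | no _  | no _  | ih = ℕ.m≤n⇒m≤1+n ih

-- Inertia of a symmetric matrix from definite subspaces.

module InertiaBounds (ℝ : RealNumbers) where
  open RealNumbers ℝ
  open OrderedField ℝ
  open Spectra ℝ
  open Vectors ℝ
  open SpectralTheorem ℝ

  sum-select : {A : Set} {P : Pred A 0ℓ} (P? : Decidable P) (Λ : Fin n → A) (f : Vector Carrier n) →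
               (∀ i → ¬ P (Λ i) → f i ≈ 0#) → sum f ≈ sum (f ∘ select P? Λ)
  sum-select {zero}  P? Λ f f≈0 = refl
  sum-select {suc n} P? Λ f f≈0 with P? (Λ zero)
  ... | yes _ = +-congˡ (sum-select P? (Λ ∘ suc) (f ∘ suc) (f≈0 ∘ suc))
  ... | no ¬p = trans (+-congʳ (f≈0 zero ¬p)) (trans (+-identityˡ _) (sum-select P? (Λ ∘ suc) (f ∘ suc) (f≈0 ∘ suc)))

  module _ {M : Matrix m} (M-sym : IsSymmetric M) (system : Eigensystem M m) where
    open Eigensystem system renaming (vectors to u; values to Λ)
    private
      ν-of : ∀ i → ∃[ y ] (‖ u i ‖² * y ≈ 1# × 0# < y)
      ν-of i = pos-inverse (proj₁ orthogonal i)

      expansion : ∀ x → x ≋ combination (λ i → proj₁ (ν-of i) * ⟨ u i , x ⟩) u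
      expansion = orthogonal-expansion u orthogonal (λ i → proj₁ (ν-of i)) (λ i → proj₁ (proj₂ (ν-of i)))

    -- The eigenvalue divided by the squared norm of its eigenvector: the coefficient in the
    -- diagonal form of the quadratic form, with the sign of the eigenvalue.
    weight : Vector Carrier m
    weight i = proj₁ (ν-of i) * Λ i

    weight-nonpos : ∀ i → Λ i ≤ 0# → weight i ≤ 0#
    weight-nonpos i Λ≤0 = ≤-trans (≤-reflexive (*-comm _ _)) (≤-trans
      (*-monoʳ-≤ (<⇒≤ (proj₂ (proj₂ (ν-of i)))) Λ≤0) (≤-reflexive (zeroˡ _)))

    weight-nonneg : ∀ i → 0# ≤ Λ i → 0# ≤ weight i
    weight-nonneg i 0≤Λ = *-nonneg (<⇒≤ (proj₂ (proj₂ (ν-of i)))) 0≤Λ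

    spectral-form : ∀ x → ⟨ x , M ⊛ x ⟩ ≈ sum (λ i → weight i * (⟨ u i , x ⟩ * ⟨ u i , x ⟩))
    spectral-form x = begin-equality
      ⟨ x , M ⊛ x ⟩                                         ≈⟨ dot-comm x (M ⊛ x) ⟩
      ⟨ M ⊛ x , x ⟩                                         ≈⟨ dot-cong {x = M ⊛ x} (λ _ → refl) (expansion x) ⟩
      ⟨ M ⊛ x , combination c u ⟩                           ≈⟨ dot-combination (M ⊛ x) c u ⟩
      sum (λ i → c i * ⟨ M ⊛ x , u i ⟩)                     ≈⟨ sum-cong-≋ (λ i → trans (*-congˡ (eigen-coordinate i))
                                                                 (regroup (proj₁ (ν-of i)) ⟨ u i , x ⟩ (Λ i))) ⟩
      sum (λ i → weight i * (⟨ u i , x ⟩ * ⟨ u i , x ⟩))    ∎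
      where
      c : Vector Carrier m
      c i = proj₁ (ν-of i) * ⟨ u i , x ⟩
      eigen-coordinate : ∀ i → ⟨ M ⊛ x , u i ⟩ ≈ Λ i * ⟨ u i , x ⟩
      eigen-coordinate i = begin-equality
        ⟨ M ⊛ x , u i ⟩       ≈⟨ self-adjoint M-sym x (u i) ⟨
        ⟨ x , M ⊛ u i ⟩       ≈⟨ dot-cong {x = x} (λ _ → refl) (eigen i) ⟩
        ⟨ x , Λ i ·ᵥ u i ⟩    ≈⟨ dot-·ʳ (Λ i) x (u i) ⟩
        Λ i * ⟨ x , u i ⟩     ≈⟨ *-congˡ (dot-comm x (u i)) ⟩
        Λ i * ⟨ u i , x ⟩     ∎
      regroup : ∀ ν t Λ → ν * t * (Λ * t) ≈ ν * Λ * (t * t)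
      regroup = solve 3 (λ ν t Λ → ν :* t :* (Λ :* t) := ν :* Λ :* (t :* t)) refl

    -- The members of the orthogonal eigenbasis with eigenvalue μ span the whole eigenspace of μ: by
    -- self-adjointness a vector of it is orthogonal to all the other members, so their terms drop
    -- out of its expansion.
    eigensystem⇒spectrum : IsSpectrum M (tabulate Λ)
    eigensystem⇒spectrum μ = b , record
      { member      = λ j a → trans (eigen (sel j) a) (*-congʳ (sym (select-sound (μ ≟_) Λ j)))
      ; independent = orthogonal-independent b
          ( (λ j → proj₁ orthogonal (sel j))
          , (λ j k j≢k → proj₂ orthogonal (sel j) (sel k) (j≢k ∘ select-injective (μ ≟_) Λ j k)))
      ; spanning    = λ v v∈E → (λ j → coefficient v (sel j)) , λ a → trans (expansion v a)
          (sum-select (μ ≟_) Λ (λ i → coefficient v i * u i a) λ i μ≉Λ →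
            trans (*-congʳ (trans (*-congˡ (other-eigenspace v v∈E i μ≉Λ)) (zeroʳ _))) (zeroˡ _))
      }
      where
      sel : Fin (count (μ ≟_) Λ) → Fin m
      sel = select (μ ≟_) Λ
      b : Vector (Vector Carrier m) (count (μ ≟_) Λ)
      b = u ∘ sel
      coefficient : Vector Carrier m → Vector Carrier m
      coefficient v i = proj₁ (ν-of i) * ⟨ u i , v ⟩
      other-eigenspace : ∀ v → Eigenspace M μ v → ∀ i → ¬ μ ≈ Λ i → ⟨ u i , v ⟩ ≈ 0#
      other-eigenspace v v∈E i μ≉Λ = *-cancelˡ-≈0 (λ μ-Λ≈0 → μ≉Λ (≈-of-diff μ-Λ≈0)) (begin-equality
        (μ - Λ i) * ⟨ u i , v ⟩                    ≈⟨ regroup μ (Λ i) ⟨ u i , v ⟩ ⟩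
        μ * ⟨ u i , v ⟩ - Λ i * ⟨ u i , v ⟩        ≈⟨ +-cong (dot-·ʳ μ (u i) v) (-‿cong (dot-·ˡ (Λ i) (u i) v)) ⟨
        ⟨ u i , μ ·ᵥ v ⟩ - ⟨ Λ i ·ᵥ u i , v ⟩      ≈⟨ +-cong (dot-cong {x = u i} (λ _ → refl) v∈E) (-‿cong (dot-cong {y = v} (eigen i) (λ _ → refl))) ⟨
        ⟨ u i , M ⊛ v ⟩ - ⟨ M ⊛ u i , v ⟩          ≈⟨ +-congʳ (self-adjoint M-sym (u i) v) ⟩
        ⟨ M ⊛ u i , v ⟩ - ⟨ M ⊛ u i , v ⟩          ≈⟨ -‿inverseʳ _ ⟩
        0#                                         ∎)
        where
        regroup : ∀ μ Λ t → (μ - Λ) * t ≈ μ * t - Λ * t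
        regroup = solve 3 (λ μ Λ t → (μ :- Λ) :* t := μ :* t :- Λ :* t) refl
        ≈-of-diff : ∀ {x y} → x - y ≈ 0# → x ≈ y
        ≈-of-diff {x} {y} x-y≈0 = trans (solve 2 (λ x y → x := (x :- y) :+ y) refl x y) (trans (+-congʳ x-y≈0) (+-identityˡ y))

  -- Sylvester's argument: otherwise more unknowns than equations would leave a c ≠ 0 with h c = 0
  -- all of whose coordinates along the selected vectors vanish.
  count-bound : {R : Pred Carrier 0ℓ} (R? : Decidable R) (Λ w : Vector Carrier n) (u : Vector (Vector Carrier m) n) →
    (∀ i → ¬ R (Λ i) → w i ≤ 0#) →
    (T : Fin m → Fin d → Carrier) (h : Fin r → Vector Carrier d) →
    (∀ c → 0# < ‖ c ‖² → h ⊛ c ≋ 0ᵥ → 0# < sum (λ i → w i * (⟨ u i , T ⊛ c ⟩ * ⟨ u i , T ⊛ c ⟩))) →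
    d ℕ.≤ r ℕ.+ count R? Λ
  count-bound {n} {m} {d} {r} R? Λ w u w≤0 T h positive = ℕ.≮⇒≥ λ few → absurd (underdetermined few (h ++ g))
    where
    g : Fin (count R? Λ) → Vector Carrier d
    g j = T ᵀ ⊛ u (select R? Λ j)

    absurd : ¬ (∃[ c ] (0# < ‖ c ‖² × (h ++ g) ⊛ c ≋ 0ᵥ))
    absurd (c , 0<c² , solves) = ≤-trans (sum-mono nonpos) (≤-reflexive (sum-zero {n} (λ _ → 0#) (λ _ → refl)))
      (positive c 0<c² λ j → trans (reflexive (≡.cong (λ v → ⟨ v , c ⟩) (≡.sym (lookup-++ˡ h g j)))) (solves (j ↑ˡ _)))
      where
      coordinate : ∀ j → ⟨ u (select R? Λ j) , T ⊛ c ⟩ ≈ 0#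
      coordinate j = trans (adjoint T (u (select R? Λ j)) c)
        (trans (reflexive (≡.cong (λ v → ⟨ v , c ⟩) (≡.sym (lookup-++ʳ h g j)))) (solves (r ↑ʳ j)))

      nonpos : ∀ i → w i * (⟨ u i , T ⊛ c ⟩ * ⟨ u i , T ⊛ c ⟩) ≤ 0#
      nonpos i with R? (Λ i)
      ... | no ¬R = ≤-trans (*-monoʳ-≤ (square-nonneg ⟨ u i , T ⊛ c ⟩) (w≤0 i ¬R)) (≤-reflexive (zeroˡ _))
      ... | yes R with j , ≡.refl ← select-complete R? Λ i R =
        ≤-reflexive (trans (*-congˡ (trans (*-congʳ (coordinate j)) (zeroˡ _))) (zeroʳ _))

  adjacency-symmetric : (H : Graph m) → IsSymmetric (adjacencyMatrix H)
  adjacency-symmetric H i j with Graph._~?_ H i j | Graph._~?_ H j i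
  ... | yes _  | yes _  = refl
  ... | yes ij | no ¬ji = contradiction (Graph.~-sym H ij) ¬ji
  ... | no ¬ij | yes ji = contradiction (Graph.~-sym H ji) ¬ij
  ... | no _   | no _   = refl

  -- Only the lower bounds p ≤ P and q ≤ N are proved by dimension; P + N ≤ m = p + q makes them
  -- equalities. Injectivity of `T` on the kernel of `g` need not be assumed, since positivity of
  -- the form there implies it.
  inertia-from-subspaces : (H : Graph m) → let A = adjacencyMatrix H in
    (T : Fin m → Fin d → Carrier) (g : Fin r → Vector Carrier d) →
    (∀ c → 0# < ‖ c ‖² → g ⊛ c ≋ 0ᵥ → 0# < ⟨ T ⊛ c , A ⊛ T ⊛ c ⟩) →
    (f : Fin p → Vector Carrier m) →
    (∀ x → 0# < ‖ x ‖² → f ⊛ x ≋ 0ᵥ → ⟨ x , A ⊛ x ⟩ < 0#) →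
    d ≡ r ℕ.+ p → ∀ q → p ℕ.+ q ≡ m → HasInertia H p q
  inertia-from-subspaces {m} {d} {r} {p} H T g positive f negative d≡r+p q p+q≡m =
    tabulate Λ , eigensystem⇒spectrum A-sym system , P≡p , N≡q
    where
    A : Matrix m
    A = adjacencyMatrix H
    A-sym : IsSymmetric A
    A-sym = adjacency-symmetric H
    system : Eigensystem A m
    system = eigensystem A-sym
    open Eigensystem system renaming (vectors to u; values to Λ)

    P N : ℕ
    P = count (0# <?_) Λ
    N = count (_<? 0#) Λ

    form : ∀ x → ⟨ x , A ⊛ x ⟩ ≈ sum (λ i → weight A-sym system i * (⟨ u i , x ⟩ * ⟨ u i , x ⟩))
    form = spectral-form A-sym system

    p≤P : p ℕ.≤ P
    p≤P = ℕ.+-cancelˡ-≤ r p P (≡.subst (ℕ._≤ r ℕ.+ P) d≡r+p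
      (count-bound (0# <?_) Λ (weight A-sym system) u (weight-nonpos A-sym system) T g
        λ c 0<c² gc≋0 → <-≤-trans (positive c 0<c² gc≋0) (≤-reflexive (form (T ⊛ c)))))

    negated : ∀ x → sum (λ i → - weight A-sym system i * (⟨ u i , x ⟩ * ⟨ u i , x ⟩)) ≈ - ⟨ x , A ⊛ x ⟩
    negated x = trans (sum-cong-≋ (λ i → sym (-‿distribˡ-* (weight A-sym system i) _)))
      (trans (sum-neg (λ i → weight A-sym system i * (⟨ u i , x ⟩ * ⟨ u i , x ⟩))) (-‿cong (sym (form x))))

    -- The same count for -A: the weights change sign, and `T` is the identity matrix `δ`.
    q≤N : q ℕ.≤ N
    q≤N = ℕ.+-cancelˡ-≤ p q N (≡.subst (ℕ._≤ p ℕ.+ N) (≡.sym p+q≡m)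
      (count-bound (_<? 0#) Λ (λ i → - weight A-sym system i) u
        (λ i 0≤Λ → ≤-diff (weight-nonneg A-sym system i 0≤Λ) (solve 1 (λ w → w := con +0 :- (:- w)) refl (weight A-sym system i)))
        δ f λ x 0<x² fx≋0 → <-≤-trans (neg-pos (negative x 0<x² fx≋0))
          (≤-reflexive (sym (trans (sum-cong-≋ λ i → *-congˡ (*-cong (δ-dot i x) (δ-dot i x))) (negated x))))))
      where
      δ-dot : ∀ i x → ⟨ u i , δ ⊛ x ⟩ ≈ ⟨ u i , x ⟩
      δ-dot i x = dot-cong {x = u i} (λ _ → refl) (dot-δ x)

    P+N≤m : P ℕ.+ N ℕ.≤ m
    P+N≤m = ≡.subst (P ℕ.+ N ℕ.≤_) (length-tabulate Λ)
      (length-filter-disjoint (0# <?_) (_<? 0#) <⇒≤ (tabulate Λ))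

    P≡p : P ≡ p
    P≡p = ℕ.≤-antisym (ℕ.+-cancelʳ-≤ q P p (ℕ.≤-trans (ℕ.+-monoʳ-≤ P q≤N) (ℕ.≤-trans P+N≤m (ℕ.≤-reflexive (≡.sym p+q≡m))))) p≤P

    N≡q : N ≡ q
    N≡q = ℕ.≤-antisym (ℕ.+-cancelˡ-≤ p N q (ℕ.≤-trans (ℕ.+-monoˡ-≤ N p≤P) (ℕ.≤-trans P+N≤m (ℕ.≤-reflexive (≡.sym p+q≡m))))) q≤N

-- Joining copies of a graph at their roots.

module RootedProduct (H : Graph n) (root : Fin n) (S : Graph k) where
  private
    module H = Graph H
    module S = Graph S

  -- The rooted product of Godsil and McKay: `(i , j)` is vertex `i` of the `j`-th copy of `H`, and
  -- the roots of the copies span a copy of `S`.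
  Adjacent : Fin n × Fin k → Fin n × Fin k → Set
  Adjacent (i , j) (i′ , j′) = (j ≡ j′ × i H.~ i′) ⊎ ((i ≡ root × i′ ≡ root) × j S.~ j′)

  adjacent? : ∀ a b → Dec (Adjacent a b)
  adjacent? (i , j) (i′ , j′) = (j Fin.≟ j′ ×-dec i H.~? i′) ⊎-dec ((i Fin.≟ root ×-dec i′ Fin.≟ root) ×-dec j S.~? j′)

  rootedProduct : Graph (n ℕ.* k)
  rootedProduct = record
    { _~_   = λ a b → Adjacent (remQuot k a) (remQuot k b)
    ; _~?_  = λ a b → adjacent? (remQuot k a) (remQuot k b)
    ; ~-sym = λ { (inj₁ (p , q)) → inj₁ (≡.sym p , H.~-sym q) ; (inj₂ ((p , q) , r)) → inj₂ ((q , p) , S.~-sym r) }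
    ; ~-irr = λ { a (inj₁ (_ , q)) → H.~-irr _ q ; a (inj₂ (_ , r)) → S.~-irr _ r }
    }

-- Sums over edges, in any commutative monoid: the reals for quadratic forms, ℕ for counting.

module FiniteSums (M : CommutativeMonoid 0ℓ 0ℓ) where
  open CommutativeMonoid M
  open import Data.List using ([]; _∷_)
  open import Algebra.Properties.CommutativeMonoid.Sum M
  open import Relation.Binary.Reasoning.Setoid setoid

  infixr 8 [_]_
  -- The Iverson bracket, with `ε` as the value where the condition fails.
  [_]_ : {P : Set} → Dec P → Carrier → Carrier
  [ P? ] x = if does P? then x else ε

  private variable A B : Set

  sum-lookup-filter : {P : Pred A 0ℓ} (P? : Decidable P) (f : A → Carrier) → ∀ xs →
    sum (f ∘ lookup (filter P? xs)) ≈ sum (λ a → [ P? (lookup xs a) ] f (lookup xs a))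
  sum-lookup-filter P? f []       = refl
  sum-lookup-filter P? f (x ∷ xs) with does (P? x)
  ... | true  = ∙-congˡ (sum-lookup-filter P? f xs)
  ... | false = trans (sum-lookup-filter P? f xs) (sym (identityˡ _))

  sum-lookup-++ : (f : A → Carrier) → ∀ xs ys →
    sum (f ∘ lookup (xs List.++ ys)) ≈ sum (f ∘ lookup xs) ∙ sum (f ∘ lookup ys)
  sum-lookup-++ f []       ys = sym (identityˡ _)
  sum-lookup-++ f (x ∷ xs) ys = trans (∙-congˡ (sum-lookup-++ f xs ys)) (sym (assoc _ _ _))

  sum-lookup-map : (f : B → Carrier) (g : A → B) → ∀ xs → sum (f ∘ lookup (map g xs)) ≈ sum (f ∘ g ∘ lookup xs)
  sum-lookup-map f g []       = refl
  sum-lookup-map f g (x ∷ xs) = ∙-congˡ (sum-lookup-map f g xs)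

  sum-lookup-tabulate : (f : A → Carrier) (g : Fin n → A) → sum (f ∘ lookup (tabulate g)) ≈ sum (f ∘ g)
  sum-lookup-tabulate {n = zero}  f g = refl
  sum-lookup-tabulate {n = suc n} f g = ∙-congˡ (sum-lookup-tabulate f (g ∘ suc))

  sum-lookup-product : (f : A × B → Carrier) → ∀ xs ys →
    sum (f ∘ lookup (cartesianProduct xs ys)) ≈ sum (λ a → sum (λ b → f (lookup xs a , lookup ys b)))
  sum-lookup-product f []       ys = refl
  sum-lookup-product f (x ∷ xs) ys = trans (sum-lookup-++ f (map (x ,_) ys) (cartesianProduct xs ys))
    (∙-cong (sum-lookup-map f (x ,_) ys) (sum-lookup-product f xs ys))

  sum-ε : (f : Vector Carrier n) → (∀ i → f i ≈ ε) → sum f ≈ ε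
  sum-ε {n} f f≈ε = trans (sum-cong-≋ f≈ε) (sum-replicate-zero n)

  []-cong : {P : Set} (P? : Dec P) {x y : Carrier} → x ≈ y → [ P? ] x ≈ [ P? ] y
  []-cong (yes _) x≈y = x≈y
  []-cong (no _)  _   = refl

  []-sum : {P : Set} (P? : Dec P) (f : Vector Carrier n) → [ P? ] sum f ≈ sum (λ i → [ P? ] f i)
  []-sum (yes _) f = refl
  []-sum {n} (no _) f = sym (sum-ε {n} (λ _ → ε) (λ _ → refl))

  sum-[≟] : (f : Vector Carrier n) → ∀ i → sum (λ j → [ j Fin.≟ i ] f j) ≈ f i
  sum-[≟] {suc n} f i = begin
    sum (λ j → [ j Fin.≟ i ] f j)
      ≈⟨ sum-remove {i = i} (λ j → [ j Fin.≟ i ] f j) ⟩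
    [ i Fin.≟ i ] f i ∙ sum (λ j → [ punchIn i j Fin.≟ i ] f (punchIn i j))
      ≈⟨ ∙-cong here (sum-ε (λ j → [ punchIn i j Fin.≟ i ] f (punchIn i j)) elsewhere) ⟩
    f i ∙ ε
      ≈⟨ identityʳ _ ⟩
    f i ∎
    where
    here : [ i Fin.≟ i ] f i ≈ f i
    here with i Fin.≟ i
    ... | yes _  = refl
    ... | no i≢i = contradiction ≡.refl i≢i
    elsewhere : ∀ j → [ punchIn i j Fin.≟ i ] f (punchIn i j) ≈ ε
    elsewhere j with punchIn i j Fin.≟ i
    ... | yes eq = contradiction eq (Fin.punchInᵢ≢i i j)
    ... | no _   = refl

  []-× : {P Q : Set} (P? : Dec P) (Q? : Dec Q) → ∀ {x} → [ P? ×-dec Q? ] x ≈ [ P? ] [ Q? ] x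
  []-× (yes _) (yes _) = refl
  []-× (yes _) (no _)  = refl
  []-× (no _)  _       = refl

  []-⊎ : {P Q : Set} (P? : Dec P) (Q? : Dec Q) → (P → ¬ Q) → ∀ {x} → [ P? ⊎-dec Q? ] x ≈ [ P? ] x ∙ [ Q? ] x
  []-⊎ (yes p) (yes q) disjoint = contradiction q (disjoint p)
  []-⊎ (yes _) (no _)  _        = sym (identityʳ _)
  []-⊎ (no _)  (yes _) _        = sym (identityˡ _)
  []-⊎ (no _)  (no _)  _        = sym (identityˡ _)

  module _ (G : Graph n) where
    open Graph G

    -- The edge list holds each edge once, with u < v; a second copy of the sum supplies the
    -- reversed pairs. With φ = 1 this is the handshake lemma, with φ = (y u + y v)² it is the form
    -- of the signless Laplacian.
    handshake : (φ : Fin n → Fin n → Carrier) → (∀ u v → φ u v ≈ φ v u) →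
      let ∑edges = sum (uncurry φ ∘ lookup (edges G)) in
      ∑edges ∙ ∑edges ≈ sum (λ u → sum (λ v → [ u ~? v ] φ u v))
    handshake φ φ-sym = begin
      sum (uncurry φ ∘ lookup (edges G)) ∙ sum (uncurry φ ∘ lookup (edges G))
        ≈⟨ ∙-cong ordered-pairs (trans ordered-pairs (∑-comm edge)) ⟩
      sum (λ u → sum (edge u)) ∙ sum (λ u → sum (λ v → edge v u))
        ≈⟨ ∑-distrib-+ (λ u → sum (edge u)) (λ u → sum (λ v → edge v u)) ⟨
      sum (λ u → sum (edge u) ∙ sum (λ v → edge v u))
        ≈⟨ sum-cong-≋ (λ u → ∑-distrib-+ (edge u) (λ v → edge v u)) ⟨
      sum (λ u → sum (λ v → edge u v ∙ edge v u))
        ≈⟨ sum-cong-≋ (λ u → sum-cong-≋ (λ v → both-orders u v)) ⟩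
      sum (λ u → sum (λ v → [ u ~? v ] φ u v)) ∎
      where
      edge : Fin n → Fin n → Carrier
      edge u v = [ isEdge? G (u , v) ] φ u v

      ordered-pairs : sum (uncurry φ ∘ lookup (edges G)) ≈ sum (λ u → sum (edge u))
      ordered-pairs = begin
        sum (uncurry φ ∘ lookup (edges G))
          ≈⟨ sum-lookup-filter (isEdge? G) (uncurry φ) (cartesianProduct (allFin n) (allFin n)) ⟩
        sum (uncurry edge ∘ lookup (cartesianProduct (allFin n) (allFin n)))
          ≈⟨ sum-lookup-product (uncurry edge) (allFin n) (allFin n) ⟩
        sum (λ a → sum (λ b → edge (lookup (allFin n) a) (lookup (allFin n) b)))
          ≈⟨ sum-lookup-tabulate (λ u → sum (λ b → edge u (lookup (allFin n) b))) id ⟩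
        sum (λ u → sum (λ b → edge u (lookup (allFin n) b)))
          ≈⟨ sum-cong-≋ (λ u → sum-lookup-tabulate (edge u) id) ⟩
        sum (λ u → sum (edge u)) ∎

      both-orders′ : ∀ {u v} (u<v? : Dec (u Fin.< v)) (v<u? : Dec (v Fin.< u)) (uv? : Dec (u ~ v)) (vu? : Dec (v ~ u)) →
        [ u<v? ×-dec uv? ] φ u v ∙ [ v<u? ×-dec vu? ] φ v u ≈ [ uv? ] φ u v
      both-orders′ (yes u<v) (yes v<u) _ _            = contradiction v<u (Fin.<-asym u<v)
      both-orders′ (yes _) (no _) (yes _)  _          = identityʳ _
      both-orders′ (yes _) (no _) (no _)   _          = identityʳ _
      both-orders′ (no _)  (yes _) (yes _)  (yes _)   = trans (identityˡ _) (φ-sym _ _)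
      both-orders′ (no _)  (yes _) (no _)   (no _)    = identityˡ _
      both-orders′ (no _)  (yes _) (yes uv) (no ¬vu)  = contradiction (~-sym uv) ¬vu
      both-orders′ (no _)  (yes _) (no ¬uv) (yes vu)  = contradiction (~-sym vu) ¬uv
      both-orders′ (no _)  (no _)  (no _)   _         = identityˡ _
      both-orders′ {u} {v} (no u≮v) (no v≮u) (yes uv) _ with Fin.<-cmp u v
      ... | tri< u<v _ _    = contradiction u<v u≮v
      ... | tri≈ _ ≡.refl _ = contradiction uv (~-irr u)
      ... | tri> _ _ v<u    = contradiction v<u v≮u

      both-orders : ∀ u v → edge u v ∙ edge v u ≈ [ u ~? v ] φ u v
      both-orders u v = both-orders′ (u Fin.<? v) (v Fin.<? u) (u ~? v) (v ~? u)

  sum-splitAt : ∀ m (f : Vector Carrier (m ℕ.+ n)) → sum f ≈ sum (λ i → f (i ↑ˡ n)) ∙ sum (λ j → f (m ↑ʳ j))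
  sum-splitAt zero    f = sym (identityˡ _)
  sum-splitAt (suc m) f = trans (∙-congˡ (sum-splitAt m (f ∘ suc))) (sym (assoc _ _ _))

  sum-combine : ∀ m (f : Vector Carrier (m ℕ.* n)) → sum f ≈ sum (λ (i : Fin m) → sum (λ j → f (combine i j)))
  sum-combine zero    f = refl
  sum-combine {n} (suc m) f = trans (sum-splitAt n f) (∙-congˡ (sum-combine m (λ i → f (n ↑ʳ i))))

  module _ (H : Graph n) (root : Fin n) (S : Graph k) where
    open RootedProduct H root S
    private
      module H = Graph H
      module S = Graph S
      module G = Graph rootedProduct

    -- The two kinds of adjacency exclude each other, since `S` has no loops. So the bracket of
    -- their disjunction is a sum of two brackets, and the equalities in them collapse the fourfold
    -- sum.
    sum-rootedProduct : (φ : Fin (n ℕ.* k) → Fin (n ℕ.* k) → Carrier) →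
      sum (λ a → sum (λ b → [ a G.~? b ] φ a b)) ≈
      sum (λ j → sum (λ i → sum (λ i′ → [ i H.~? i′ ] φ (combine i j) (combine i′ j)))) ∙
      sum (λ j → sum (λ j′ → [ j S.~? j′ ] φ (combine root j) (combine root j′)))
    sum-rootedProduct φ = begin
      sum (λ a → sum (λ b → [ a G.~? b ] φ a b))
        ≈⟨ sum-combine {k} n (λ a → sum (λ b → [ a G.~? b ] φ a b)) ⟩
      sum (λ (i : Fin n) → sum (λ (j : Fin k) → sum (λ b → [ combine i j G.~? b ] φ (combine i j) b)))
        ≈⟨ sum-cong-≋ {n} (λ i → sum-cong-≋ {k} λ j → sum-combine {k} n (λ b → [ combine i j G.~? b ] φ (combine i j) b)) ⟩
      sum (λ (i : Fin n) → sum (λ (j : Fin k) → sum (λ (i′ : Fin n) → sum (λ (j′ : Fin k) → [ combine i j G.~? combine i′ j′ ] ψ i j i′ j′))))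
        ≈⟨ sum-cong-≋ (λ i → sum-cong-≋ λ j → sum-cong-≋ λ i′ → sum-cong-≋ λ j′ → split i j i′ j′) ⟩
      sum (λ i → sum (λ j → sum (λ i′ → sum (λ j′ → copies i j i′ j′ ∙ links i j i′ j′))))
        ≈⟨ sum-cong-≋ (λ i → sum-cong-≋ λ j → trans (sum-cong-≋ λ i′ → ∑-distrib-+ (copies i j i′) (links i j i′))
             (∑-distrib-+ (λ i′ → sum (copies i j i′)) (λ i′ → sum (links i j i′)))) ⟩
      sum (λ i → sum (λ j → sum (λ i′ → sum (copies i j i′)) ∙ sum (λ i′ → sum (links i j i′))))
        ≈⟨ trans (sum-cong-≋ λ i → ∑-distrib-+ (λ j → sum (λ i′ → sum (copies i j i′))) (λ j → sum (λ i′ → sum (links i j i′))))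
             (∑-distrib-+ (λ i → sum (λ j → sum (λ i′ → sum (copies i j i′)))) (λ i → sum (λ j → sum (λ i′ → sum (links i j i′))))) ⟩
      sum (λ i → sum (λ j → sum (λ i′ → sum (copies i j i′)))) ∙ sum (λ i → sum (λ j → sum (λ i′ → sum (links i j i′))))
        ≈⟨ ∙-cong sum-copies sum-links ⟩
      sum (λ j → sum (λ i → sum (λ i′ → [ i H.~? i′ ] ψ i j i′ j))) ∙ sum (λ j → sum (λ j′ → [ j S.~? j′ ] ψ root j root j′)) ∎
      where
      ψ copies links : Fin n → Fin k → Fin n → Fin k → Carrier
      ψ i j i′ j′ = φ (combine i j) (combine i′ j′)
      copies i j i′ j′ = [ j′ Fin.≟ j ] [ i H.~? i′ ] ψ i j i′ j′
      links i j i′ j′ = [ i Fin.≟ root ] [ i′ Fin.≟ root ] [ j S.~? j′ ] ψ i j i′ j′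

      flip-≟ : ∀ (j j′ : Fin k) {x} → [ j Fin.≟ j′ ] x ≈ [ j′ Fin.≟ j ] x
      flip-≟ j j′ with j Fin.≟ j′ | j′ Fin.≟ j
      ... | yes _  | yes _   = refl
      ... | no _   | no _    = refl
      ... | yes eq | no neq  = contradiction (≡.sym eq) neq
      ... | no neq | yes eq  = contradiction (≡.sym eq) neq

      split : ∀ i j i′ j′ → [ combine i j G.~? combine i′ j′ ] ψ i j i′ j′ ≈ copies i j i′ j′ ∙ links i j i′ j′
      split i j i′ j′ = trans
        (reflexive (≡.cong₂ (λ a b → [ adjacent? a b ] ψ i j i′ j′) (Fin.remQuot-combine i j) (Fin.remQuot-combine i′ j′)))
        (trans ([]-⊎ (j Fin.≟ j′ ×-dec i H.~? i′) ((i Fin.≟ root ×-dec i′ Fin.≟ root) ×-dec j S.~? j′)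
          λ { (≡.refl , _) (_ , jj) → S.~-irr j jj })
        (∙-cong (trans ([]-× (j Fin.≟ j′) (i H.~? i′)) (flip-≟ j j′))
                (trans ([]-× (i Fin.≟ root ×-dec i′ Fin.≟ root) (j S.~? j′)) ([]-× (i Fin.≟ root) (i′ Fin.≟ root)))))

      sum-copies : sum (λ i → sum (λ j → sum (λ i′ → sum (copies i j i′)))) ≈
                   sum (λ j → sum (λ i → sum (λ i′ → [ i H.~? i′ ] ψ i j i′ j)))
      sum-copies = trans
        (sum-cong-≋ λ i → sum-cong-≋ λ j → sum-cong-≋ λ i′ → sum-[≟] (λ j′ → [ i H.~? i′ ] ψ i j i′ j′) j)
        (∑-comm (λ i j → sum (λ i′ → [ i H.~? i′ ] ψ i j i′ j)))

      sum-links : sum (λ i → sum (λ j → sum (λ i′ → sum (links i j i′)))) ≈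
                  sum (λ j → sum (λ j′ → [ j S.~? j′ ] ψ root j root j′))
      sum-links = begin
        sum (λ i → sum (λ j → sum (λ i′ → sum (links i j i′))))
          ≈⟨ sum-cong-≋ (λ i → sum-cong-≋ λ j → trans
               (sum-cong-≋ λ i′ → trans (sym ([]-sum (i Fin.≟ root) (inner i j i′))) ([]-cong (i Fin.≟ root) (sym ([]-sum (i′ Fin.≟ root) (core i j i′)))))
               (trans (sym ([]-sum (i Fin.≟ root) (λ i′ → [ i′ Fin.≟ root ] sum (core i j i′))))
                      ([]-cong (i Fin.≟ root) (sum-[≟] (λ i′ → sum (core i j i′)) root)))) ⟩
        sum (λ i → sum (λ j → [ i Fin.≟ root ] sum (core i j root)))
          ≈⟨ sum-cong-≋ (λ i → sym ([]-sum (i Fin.≟ root) (λ j → sum (core i j root)))) ⟩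
        sum (λ i → [ i Fin.≟ root ] sum (λ j → sum (core i j root)))
          ≈⟨ sum-[≟] (λ i → sum (λ j → sum (core i j root))) root ⟩
        sum (λ j → sum (core root j root)) ∎
        where
        core inner : Fin n → Fin k → Fin n → Fin k → Carrier
        core i j i′ j′ = [ j S.~? j′ ] ψ i j i′ j′
        inner i j i′ j′ = [ i′ Fin.≟ root ] core i j i′ j′

unique⇒lookup-injective : {A : Set} {xs : List A} → Unique xs → ∀ i j → lookup xs i ≡ lookup xs j → i ≡ j
unique⇒lookup-injective (x∉xs AllPairs.∷ u) zero    zero    eq = ≡.refl
unique⇒lookup-injective (x∉xs AllPairs.∷ u) zero    (suc j) eq = contradiction eq (All.lookup x∉xs (∈-lookup j))
unique⇒lookup-injective (x∉xs AllPairs.∷ u) (suc i) zero    eq = contradiction (≡.sym eq) (All.lookup x∉xs (∈-lookup i))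
unique⇒lookup-injective (x∉xs AllPairs.∷ u) (suc i) (suc j) eq = ≡.cong suc (unique⇒lookup-injective u i j eq)

-- The adjacency form of the line graph and the signless Laplacian.

module LineGraphForm (ℝ : RealNumbers) {n : ℕ} (G : Graph n) where
  open RealNumbers ℝ
  open OrderedField ℝ
  open Spectra ℝ
  open Vectors ℝ
  open SpectralTheorem ℝ
  open FiniteSums +-commutativeMonoid using ([_]_; handshake)
  open Graph G

  private
    ∣E∣ : ℕ
    ∣E∣ = length (edges G)

    edge : Fin ∣E∣ → Fin n × Fin n
    edge = lookup (edges G)

    edge-ordered : ∀ a → proj₁ (edge a) Fin.< proj₂ (edge a)
    edge-ordered a = proj₁ (All.lookup (All.all-filter (isEdge? G) (cartesianProduct (allFin n) (allFin n))) (∈-lookup a))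

    edge-injective : ∀ a b → edge a ≡ edge b → a ≡ b
    edge-injective = unique⇒lookup-injective
      (Unique.filter⁺ (isEdge? G) (Unique.cartesianProduct⁺ (Unique.allFin⁺ n) (Unique.allFin⁺ n)))

    A : Matrix ∣E∣
    A = adjacencyMatrix (lineGraph G)

    endpoints : Fin n × Fin n → Vector Carrier n
    endpoints (u , v) = δ u +ᵥ δ v

  Bᵀ : Fin ∣E∣ → Fin n → Carrier
  Bᵀ a = endpoints (edge a)

  B : Fin n → Fin ∣E∣ → Carrier
  B = Bᵀ ᵀ

  private
    Bᵀ⊛ : ∀ y a → (Bᵀ ⊛ y) a ≈ y (proj₁ (edge a)) + y (proj₂ (edge a))
    Bᵀ⊛ y a = trans (dot-+ˡ (δ (proj₁ (edge a))) (δ (proj₂ (edge a))) y) (+-cong (dot-δ y _) (dot-δ y _))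

    -- The number of common endpoints of two edges, which is an entry of BᵀB.
    common : Fin n × Fin n → Fin n × Fin n → Carrier
    common (u , v) (x , y) = (δ x u + δ y u) + (δ x v + δ y v)

    one-of-four : ∀ {a b c d} → a ≈ 1# → b ≈ 0# → c ≈ 0# → d ≈ 0# → (a + b) + (c + d) ≈ 1#
    one-of-four p q r s = trans (+-cong (+-cong p q) (+-cong r s))
      (trans (+-cong (+-identityʳ 1#) (+-identityʳ 0#)) (+-identityʳ 1#))

    -- One of the four coincidences holds and it excludes the others: the opposite one by
    -- distinctness of the edges, or by the orderings u < v and x < y when the shared vertex is the
    -- larger end of one edge and the smaller end of the other.
    common-share : ∀ {u v x y} → u Fin.< v → x Fin.< y → ¬ (u , v) ≡ (x , y) →
                   ShareEndpoint (u , v) (x , y) → common (u , v) (x , y) ≈ 1#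
    common-share {u} {v} {_} {y} u<v x<y e≢f (_ , inj₁ ≡.refl , inj₁ ≡.refl) =
      one-of-four (δ-refl u) (δ-≢ y u (Fin.<⇒≢ x<y ∘ ≡.sym)) (δ-≢ u v (Fin.<⇒≢ u<v)) (δ-≢ y v λ { ≡.refl → e≢f ≡.refl })
    common-share {u} {v} {x} u<v x<y e≢f (_ , inj₁ ≡.refl , inj₂ ≡.refl) =
      trans (+-congʳ (+-comm _ _))
        (one-of-four (δ-refl u) (δ-≢ x u (Fin.<⇒≢ x<y)) (δ-≢ x v (Fin.<⇒≢ (Fin.<-trans x<y u<v))) (δ-≢ u v (Fin.<⇒≢ u<v)))
    common-share {u} {v} {_} {y} u<v x<y e≢f (_ , inj₂ ≡.refl , inj₁ ≡.refl) =
      trans (+-comm _ _)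
        (one-of-four (δ-refl v) (δ-≢ y v (Fin.<⇒≢ x<y ∘ ≡.sym)) (δ-≢ v u (Fin.<⇒≢ u<v ∘ ≡.sym)) (δ-≢ y u (Fin.<⇒≢ (Fin.<-trans u<v x<y) ∘ ≡.sym)))
    common-share {u} {v} {x} u<v x<y e≢f (_ , inj₂ ≡.refl , inj₂ ≡.refl) =
      trans (+-comm _ _) (trans (+-cong (+-comm _ _) (+-comm _ _))
        (one-of-four (δ-refl v) (δ-≢ x v (Fin.<⇒≢ x<y)) (δ-≢ v u (Fin.<⇒≢ u<v ∘ ≡.sym)) (δ-≢ x u λ { ≡.refl → e≢f ≡.refl })))

    common-disjoint : ∀ {u v x y} → ¬ ShareEndpoint (u , v) (x , y) → common (u , v) (x , y) ≈ 0#
    common-disjoint {u} {v} {x} {y} ¬share = trans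
      (+-cong (+-cong (δ-≢ x u λ { ≡.refl → ¬share (_ , inj₁ ≡.refl , inj₁ ≡.refl) })
                      (δ-≢ y u λ { ≡.refl → ¬share (_ , inj₁ ≡.refl , inj₂ ≡.refl) }))
              (+-cong (δ-≢ x v λ { ≡.refl → ¬share (_ , inj₂ ≡.refl , inj₁ ≡.refl) })
                      (δ-≢ y v λ { ≡.refl → ¬share (_ , inj₂ ≡.refl , inj₂ ≡.refl) })))
      (trans (+-cong (+-identityʳ 0#) (+-identityʳ 0#)) (+-identityʳ 0#))

    common-self : ∀ {u v} → u Fin.< v → common (u , v) (u , v) ≈ 1# + 1#
    common-self {u} {v} u<v = +-cong
      (trans (+-cong (δ-refl u) (δ-≢ v u (Fin.<⇒≢ u<v ∘ ≡.sym))) (+-identityʳ 1#))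
      (trans (+-cong (δ-≢ u v (Fin.<⇒≢ u<v)) (δ-refl v)) (+-identityˡ 1#))

    adjacency+2δ : ∀ a b → A a b + (δ a b + δ a b) ≈ common (edge a) (edge b)
    adjacency+2δ a b with a Fin.≟ b | shareEndpoint? (edge a) (edge b)
    ... | yes ≡.refl | _          = trans (+-identityˡ _) (sym (common-self (edge-ordered a)))
    ... | no a≢b     | yes share  = trans (trans (+-congˡ (+-identityʳ 0#)) (+-identityʳ 1#))
      (sym (common-share (edge-ordered a) (edge-ordered b) (a≢b ∘ edge-injective a b) share))
    ... | no a≢b     | no ¬share  = trans (trans (+-congˡ (+-identityʳ 0#)) (+-identityʳ 0#))
      (sym (common-disjoint ¬share))

    gram : ∀ a b → A a b + (δ a b + δ a b) ≈ ⟨ Bᵀ a , Bᵀ b ⟩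
    gram a b = trans (adjacency+2δ a b) (sym
      (trans (dot-+ˡ (δ (proj₁ (edge a))) (δ (proj₂ (edge a))) (Bᵀ b)) (+-cong (dot-δ (Bᵀ b) _) (dot-δ (Bᵀ b) _))))

  line-form : ∀ x → ⟨ x , A ⊛ x ⟩ + (‖ x ‖² + ‖ x ‖²) ≈ ‖ B ⊛ x ‖²
  line-form x = begin-equality
    ⟨ x , A ⊛ x ⟩ + (‖ x ‖² + ‖ x ‖²)              ≈⟨ +-congˡ (dot-+ʳ x x x) ⟨
    ⟨ x , A ⊛ x ⟩ + ⟨ x , x +ᵥ x ⟩                 ≈⟨ dot-+ʳ x (A ⊛ x) (x +ᵥ x) ⟨
    ⟨ x , A ⊛ x +ᵥ (x +ᵥ x) ⟩                      ≈⟨ dot-cong {x = x} (λ _ → refl) row ⟩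
    ⟨ x , Bᵀ ⊛ (B ⊛ x) ⟩                           ≈⟨ adjoint Bᵀ x (B ⊛ x) ⟩
    ‖ B ⊛ x ‖²                                     ∎
    where
    row : A ⊛ x +ᵥ (x +ᵥ x) ≋ Bᵀ ⊛ (B ⊛ x)
    row a = begin-equality
      ⟨ A a , x ⟩ + (x a + x a)                        ≈⟨ +-congˡ (+-cong (dot-δ x a) (dot-δ x a)) ⟨
      ⟨ A a , x ⟩ + (⟨ δ a , x ⟩ + ⟨ δ a , x ⟩)        ≈⟨ +-congˡ (dot-+ˡ (δ a) (δ a) x) ⟨
      ⟨ A a , x ⟩ + ⟨ δ a +ᵥ δ a , x ⟩                 ≈⟨ dot-+ˡ (A a) (δ a +ᵥ δ a) x ⟨
      ⟨ A a +ᵥ (δ a +ᵥ δ a) , x ⟩                      ≈⟨ sum-cong-≋ (λ b → trans (*-comm _ (x b)) (*-congˡ (gram a b))) ⟩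
      sum (λ b → x b * ⟨ Bᵀ a , Bᵀ b ⟩)                ≈⟨ dot-combination (Bᵀ a) x Bᵀ ⟨
      ⟨ Bᵀ a , combination x Bᵀ ⟩                      ≈⟨ dot-cong {x = Bᵀ a} (λ _ → refl) (λ v → sum-cong-≋ λ b → *-comm (x b) (Bᵀ b v)) ⟩
      ⟨ Bᵀ a , B ⊛ x ⟩                                 ∎

  -- Twice the form of the signless Laplacian of G.
  Ψ : Vector Carrier n → Carrier
  Ψ y = sum λ u → sum λ v → [ u ~? v ] ((y u + y v) * (y u + y v))

  private
    two -one : Carrier
    two  = ι (+ 2)
    -one = ι -[1+ 0 ]

  double-norm : ∀ y → ‖ Bᵀ ⊛ y ‖² + ‖ Bᵀ ⊛ y ‖² ≈ Ψ y
  double-norm y = trans (+-cong expand expand)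
    (handshake G (λ u v → (y u + y v) * (y u + y v)) (λ u v → *-cong (+-comm _ _) (+-comm _ _)))
    where
    expand : ‖ Bᵀ ⊛ y ‖² ≈ sum (uncurry (λ u v → (y u + y v) * (y u + y v)) ∘ edge)
    expand = sum-cong-≋ λ a → *-cong (Bᵀ⊛ y a) (Bᵀ⊛ y a)

  private
    norm-expand : ∀ a b (x y : Vector Carrier k) →
      ‖ a ·ᵥ x +ᵥ b ·ᵥ y ‖² ≈ a * (a * ‖ x ‖² + b * ⟨ x , y ⟩) + b * (a * ⟨ x , y ⟩ + b * ‖ y ‖²)
    norm-expand a b x y = trans (dot-linearˡ a x b y (a ·ᵥ x +ᵥ b ·ᵥ y)) (+-cong
      (*-congˡ (dot-linearʳ a x b y x))
      (*-congˡ (trans (dot-linearʳ a x b y y) (+-congʳ (*-congˡ (dot-comm y x))))))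

    double-pos : ∀ {x} → 0# < x + x → 0# < x
    double-pos {x} 0<x+x = ≤∧≉⇒< (double-nonneg (<⇒≤ 0<x+x))
      λ 0≈x → <-irrefl (trans (sym (+-identityʳ 0#)) (+-cong 0≈x 0≈x)) 0<x+x

    -- From 0 ≤ ‖Bx − 2y‖², where x = Bᵀy.
    positive-arith : ∀ {q X Y E W} → q + (X + X) ≈ W → X + X ≈ E → ι (+ 4) * Y < E →
      0# ≤ -one * (-one * W + two * X) + two * (-one * X + two * Y) → 0# < q
    positive-arith {q} {X} {Y} {E} {W} qW XE 4Y<E 0≤ = <-≤-trans (+-pos-nonneg (diff-pos 4Y<E) 0≤) (≤-reflexive (begin-equality
      E - ι (+ 4) * Y + (-one * (-one * W + two * X) + two * (-one * X + two * Y))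
        ≈⟨ +-cong (+-congʳ (sym XE)) (+-congʳ (*-congˡ (+-congʳ (*-congˡ (sym qW))))) ⟩
      X + X - ι (+ 4) * Y + (-one * (-one * (q + (X + X)) + two * X) + two * (-one * X + two * Y))
        ≈⟨ solve 3 (λ q X Y → X :+ X :- con (+ 4) :* Y :+ (con -[1+ 0 ] :* (con -[1+ 0 ] :* (q :+ (X :+ X)) :+ con (+ 2) :* X) :+ con (+ 2) :* (con -[1+ 0 ] :* X :+ con (+ 2) :* Y)) := q) refl q X Y ⟩
      q ∎))

    -- From 0 ≤ ‖2x − Bᵀy‖², where y = Bx.
    negative-arith : ∀ {q X Y E Z} → q + (X + X) ≈ Y → Z + Z ≈ E → E < ι (+ 4) * Y →
      0# ≤ two * (two * X + -one * Y) + -one * (two * Y + -one * Z) → q < 0#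
    negative-arith {q} {X} {Y} {E} {Z} qY ZE E<4Y 0≤ = <-diff
      (double-pos (double-pos (<-≤-trans (+-pos-nonneg (diff-pos E<4Y) (+-nonneg 0≤ 0≤)) (≤-reflexive (begin-equality
        ι (+ 4) * Y - E + (gap Y + gap Y)
          ≈⟨ +-cong (+-cong (*-congˡ (sym qY)) (-‿cong (sym ZE))) (+-cong gap-cong gap-cong) ⟩
        ι (+ 4) * (q + (X + X)) - (Z + Z) + (gap (q + (X + X)) + gap (q + (X + X)))
          ≈⟨ solve 3 (λ q X Z →
               let Y = q :+ (X :+ X)
                   d = con (+ 2) :* (con (+ 2) :* X :+ con -[1+ 0 ] :* Y) :+ con -[1+ 0 ] :* (con (+ 2) :* Y :+ con -[1+ 0 ] :* Z)
               in con (+ 4) :* Y :- (Z :+ Z) :+ (d :+ d) := ((:- q) :+ (:- q)) :+ ((:- q) :+ (:- q))) refl q X Z ⟩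
        (- q + - q) + (- q + - q) ∎)))))
      (sym (+-identityˡ (- q)))
      where
      gap : Carrier → Carrier
      gap Y = two * (two * X + -one * Y) + -one * (two * Y + -one * Z)
      gap-cong : gap Y ≈ gap (q + (X + X))
      gap-cong = +-cong (*-congˡ (+-congˡ (*-congˡ (sym qY)))) (*-congˡ (+-congʳ (*-congˡ (sym qY))))

  -- As `Ψ` is twice the form of Q, the hypothesis says that Q - 2I is positive at y.
  line-positive : ∀ y → ι (+ 4) * ‖ y ‖² < Ψ y → 0# < ⟨ Bᵀ ⊛ y , A ⊛ Bᵀ ⊛ y ⟩
  line-positive y 4y²<Ψ = positive-arith (line-form x) (double-norm y) 4y²<Ψ
    (≤-trans (‖‖²-nonneg (-one ·ᵥ (B ⊛ x) +ᵥ two ·ᵥ y)) (≤-reflexive (trans (norm-expand -one two (B ⊛ x) y)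
      (+-cong (*-congˡ (+-congˡ (*-congˡ dot))) (*-congˡ (+-congʳ (*-congˡ dot)))))))
    where
    x : Vector Carrier ∣E∣
    x = Bᵀ ⊛ y
    dot : ⟨ B ⊛ x , y ⟩ ≈ ‖ x ‖²
    dot = trans (dot-comm (B ⊛ x) y) (trans (adjoint B y x) refl)

  -- Negativity of Q - 2I at Bx is available only for Bx ≠ 0. If Bx = 0, the form at x is -2‖x‖²:
  -- this is the eigenvalue -2 of line graphs.
  line-negative : ∀ x → 0# < ‖ x ‖² → (0# < ‖ B ⊛ x ‖² → Ψ (B ⊛ x) < ι (+ 4) * ‖ B ⊛ x ‖²) → ⟨ x , A ⊛ x ⟩ < 0#
  line-negative x 0<x² Ψ< with ‖‖²-cases (B ⊛ x)
  ... | inj₁ 0<y² = negative-arith (line-form x) (double-norm (B ⊛ x)) (Ψ< 0<y²)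
    (≤-trans (‖‖²-nonneg (two ·ᵥ x +ᵥ -one ·ᵥ (Bᵀ ⊛ (B ⊛ x)))) (≤-reflexive (trans (norm-expand two -one x (Bᵀ ⊛ (B ⊛ x)))
      (+-cong (*-congˡ (+-congˡ (*-congˡ dot))) (*-congˡ (+-congʳ (*-congˡ dot)))))))
    where
    dot : ⟨ x , Bᵀ ⊛ (B ⊛ x) ⟩ ≈ ‖ B ⊛ x ‖²
    dot = adjoint Bᵀ x (B ⊛ x)
  ... | inj₂ y≋0 = <-diff (+-pos-nonneg 0<x² (<⇒≤ 0<x²)) (begin-equality
    ‖ x ‖² + ‖ x ‖²                                             ≈⟨ shift ⟨ x , A ⊛ x ⟩ (‖ x ‖² + ‖ x ‖²) ⟩
    ⟨ x , A ⊛ x ⟩ + (‖ x ‖² + ‖ x ‖²) - ⟨ x , A ⊛ x ⟩           ≈⟨ +-congʳ (trans (line-form x) (sum-zero (λ v → (B ⊛ x) v * (B ⊛ x) v) λ v → trans (*-congʳ (y≋0 v)) (zeroˡ _))) ⟩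
    0# - ⟨ x , A ⊛ x ⟩                                          ∎)
    where
    shift : ∀ q w → w ≈ q + w - q
    shift = solve 2 (λ q w → w := q :+ w :- q) refl

-- The gadget on 14 vertices and its diagonalization over the integers.

module Gadget where
  open Vector using ([]; _∷_)

  Form : ℕ → Set
  Form n = Fin n → ℤ

  unit : Fin n → Form n
  unit i j = if does (i Fin.≟ j) then + 1 else + 0

  agree? : (f g : Fin n → Fin n → ℤ) → Dec (∀ i j → f i j ≡ g i j)
  agree? f g = Fin.all? λ i → Fin.all? λ j → f i j ℤ.≟ g i j

  infixl 6 _⊕_ _⊖_
  infixr 7 _⊙_
  _⊕_ _⊖_ : Form n → Form n → Form n
  (f ⊕ g) i = f i ℤ.+ g i
  (f ⊖ g) i = f i ℤ.- g i

  _⊙_ : ℤ → Form n → Form n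
  (c ⊙ f) i = c ℤ.* f i

  module _ (G : Graph n) where
    open Graph G

    adjacencyℤ : Fin n → Fin n → ℤ
    adjacencyℤ u v = if does (u ~? v) then + 1 else + 0

    degree : Fin n → ℤ
    degree u = ℤΣ.sum (adjacencyℤ u)

    -- 2(Q − 2I) for the signless Laplacian Q of G.
    shiftedLaplacian : Fin n → Fin n → ℤ
    shiftedLaplacian u v = (+ 2 ℤ.* degree u ℤ.- + 4) ℤ.* unit u v ℤ.+ + 2 ℤ.* adjacencyℤ u v

  -- Beside the 13 edges of the path, the chords 0-4, 5-8 and 9-13 close the cycles 0 to 4, 5 to 8
  -- and 9 to 13. The path edges 4-5 and 8-9 join the cycles.
  arcs : List (Fin 14 × Fin 14)
  arcs = List.tabulate {n = 13} (λ i → inject₁ i , suc i) List.++ (# 0 , # 4) List.∷ (# 5 , # 8) List.∷ (# 9 , # 13) List.∷ List.[]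

  arc? : ∀ e → Dec (e ∈ arcs)
  arc? e = _∈?_ (≡-dec Fin._≟_ Fin._≟_) e arcs

  -- Two 5-cycles joined by edges to two adjacent vertices of a 4-cycle, numbered along a Hamiltonian path.
  gadget : Graph 14
  gadget = record
    { _~_   = λ u v → (u , v) ∈ arcs ⊎ (v , u) ∈ arcs
    ; _~?_  = λ u v → arc? (u , v) ⊎-dec arc? (v , u)
    ; ~-sym = swap
    ; ~-irr = from-yes (Fin.all? λ v → ¬? (arc? (v , v) ⊎-dec arc? (v , v)))
    }

  gadget-path : ∀ (i : Fin 13) → Graph._~_ gadget (inject₁ i) (suc i)
  gadget-path = from-yes (Fin.all? λ i → Graph._~?_ gadget (inject₁ i) (suc i))

  private
    x : ∀ m {m<14} → Form 14
    x m {m<14} = unit (#_ m {m<n = m<14})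

    -- A vertex of degree 2 has diagonal entry 0 in Q - 2I, so hyperbolic planes split off. The edge
    -- products of the 4-cycle form the single product (z₆ + z₈)(z₇ + z₅). Those of a 5-cycle are
    -- two products plus the square of one vertex: z₉² for the last cycle, z₀² for the first. This
    -- is how the coordinate of the root 0 survives as a square of its own.
    hyperbolic : Vector (Form 14 × Form 14) 5
    hyperbolic = (x 10 ⊕ x 12 , x 11 ⊕ x 9) ∷ (x 12 ⊕ x 9 , x 13 ⊖ x 9) ∷ (x 6 ⊕ x 8 , x 7 ⊕ x 5)
               ∷ (x 1 ⊕ x 3 , x 2 ⊕ x 0) ∷ (x 3 ⊕ x 0 , x 4 ⊖ x 0) ∷ []

  -- With z the coordinates, eliminating along the Hamiltonian path from its last vertex gives
  --   6 zᵀ(Q − 2I)z = 12 Σ aᵢbᵢ + 2(3z₉ + z₈)² + 4z₈² + 6(z₅ + z₄)² + 12z₀²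
  -- for the five pairs (aᵢ , bᵢ) of hyperbolic, and 4ab = (a + b)² − (a − b)².
  positiveForms : Vector (Form 14) 9
  positiveForms = Vector.map (uncurry _⊕_) hyperbolic ++ (+ 3 ⊙ x 9 ⊕ x 8) ∷ x 8 ∷ x 5 ⊕ x 4 ∷ x 0 ∷ []

  negativeForms : Vector (Form 14) 5
  negativeForms = Vector.map (uncurry _⊖_) hyperbolic

  positiveWeights : Vector ℕ 9
  positiveWeights = 2 ∷ 2 ∷ 2 ∷ 2 ∷ 2 ∷ 1 ∷ 3 ∷ 5 ∷ 11 ∷ []

  negativeWeights : Vector ℕ 5
  negativeWeights _ = 2

  -- The weights are suc (w k), so that they are positive.
  squares : ∀ {r} → Vector ℕ r → Vector (Form n) r → Fin n → Fin n → ℤ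
  squares w F i j = ℤΣ.sum λ k → +[1+ w k ] ℤ.* (F k i ℤ.* F k j)

  -- The factor 3 clears the pivot 3z₉² that occurs when the square of 3z₉ + z₈ is completed.
  diagonalization : ∀ i j → + 3 ℤ.* shiftedLaplacian gadget i j ≡
    squares positiveWeights positiveForms i j ℤ.- squares negativeWeights negativeForms i j
  diagonalization = toWitness {a? = agree? _ _} _

  -- Six times the coordinates, in terms of the values of the forms.
  coordinates : Vector (Form 14) 14
  coordinates = y₀ ∷ y₁ ∷ y₂ ∷ y₃ ∷ y₄ ∷ y₅ ∷ y₆ ∷ y₇ ∷ y₈ ∷ y₉ ∷ y₁₀ ∷ y₁₁ ∷ y₁₂ ∷ y₁₃ ∷ []
    where
    -- The forms of the m-th pair are aₘ + bₘ and aₘ - bₘ, so 6aₘ and 6bₘ are three times their sum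
    -- and difference.
    a b : ∀ m {m<9 : _} {m<5 : _} → Form 14
    a m {m<9} {m<5} = + 3 ⊙ (unit (#_ m {m<n = m<9}) ⊕ unit (9 Fin.↑ʳ #_ m {m<n = m<5}))
    b m {m<9} {m<5} = + 3 ⊙ (unit (#_ m {m<n = m<9}) ⊖ unit (9 Fin.↑ʳ #_ m {m<n = m<5}))
    y₀ y₁ y₂ y₃ y₄ y₅ y₆ y₇ y₈ y₉ y₁₀ y₁₁ y₁₂ y₁₃ : Form 14
    y₀  = + 6 ⊙ x 8
    y₈  = + 6 ⊙ x 6
    y₉  = + 2 ⊙ (x 5 ⊖ x 6)
    y₃  = a 4 ⊖ y₀
    y₄  = b 4 ⊕ y₀
    y₅  = + 6 ⊙ x 7 ⊖ y₄
    y₇  = b 2 ⊖ y₅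
    y₆  = a 2 ⊖ y₈
    y₂  = b 3 ⊖ y₀
    y₁  = a 3 ⊖ y₃
    y₁₂ = a 1 ⊖ y₉
    y₁₃ = b 1 ⊕ y₉
    y₁₁ = b 0 ⊖ y₉
    y₁₀ = a 0 ⊖ y₁₂

  -- A left inverse up to the factor 6, so the fourteen forms vanish together only at 0. This is
  -- what makes semidefinite forms definite.
  coordinates-correct : ∀ i j → ℤΣ.sum (λ k → coordinates i k ℤ.* (positiveForms ++ negativeForms) k j) ≡ + 6 ℤ.* unit i j
  coordinates-correct = toWitness {a? = agree? _ _} _

open Gadget

-- Definiteness over the reals from integer identities.

module IntegerForms (ℝ : RealNumbers) where
  open RealNumbers ℝ
  open OrderedField ℝ
  open Spectra ℝ
  open Vectors ℝ
  open SpectralTheorem ℝ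
  open FiniteSums +-commutativeMonoid using ([_]_)

  ι-sum : (f : Vector ℤ n) → ι (ℤΣ.sum f) ≈ sum (ι ∘ f)
  ι-sum {zero}  f = refl
  ι-sum {suc n} f = trans (ι-+ (f zero) _) (+-congˡ (ι-sum (f ∘ suc)))

  ι-unit : (i j : Fin n) → ι (unit i j) ≈ δ i j
  ι-unit i j with i Fin.≟ j
  ... | yes _ = +-identityʳ 1#
  ... | no _  = refl

  ⟪_⟫ : Form n → Vector Carrier n
  ⟪ f ⟫ = ι ∘ f

  quadratic : (Fin n → Fin n → ℤ) → Vector Carrier n → Carrier
  quadratic M z = sum λ i → sum λ j → ι (M i j) * (z i * z j)

  sumOfSquares : Vector ℕ r → Vector (Form n) r → Vector Carrier n → Carrier
  sumOfSquares w F z = sum λ k → ι +[1+ w k ] * (⟨ ⟪ F k ⟫ , z ⟩ * ⟨ ⟪ F k ⟫ , z ⟩)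

  sumOfSquares≈quadratic : (w : Vector ℕ r) (F : Vector (Form n) r) → ∀ z →
                           sumOfSquares w F z ≈ quadratic (squares w F) z
  sumOfSquares≈quadratic w F z = begin-equality
    sum (λ k → ι +[1+ w k ] * (t k * t k))
      ≈⟨ sum-cong-≋ term ⟩
    sum (λ k → sum λ i → sum λ j → c k i j * (z i * z j))
      ≈⟨ ∑-comm (λ k i → sum λ j → c k i j * (z i * z j)) ⟩
    sum (λ i → sum λ k → sum λ j → c k i j * (z i * z j))
      ≈⟨ sum-cong-≋ (λ i → ∑-comm (λ k j → c k i j * (z i * z j))) ⟩
    sum (λ i → sum λ j → sum λ k → c k i j * (z i * z j))
      ≈⟨ sum-cong-≋ (λ i → sum-cong-≋ λ j → sym (trans
           (*-congʳ (ι-sum (λ k → +[1+ w k ] ℤ.* (F k i ℤ.* F k j)))) (*-distribʳ-sum (z i * z j) (λ k → c k i j)))) ⟩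
    quadratic (squares w F) z ∎
    where
    t : Vector Carrier _
    t k = ⟨ ⟪ F k ⟫ , z ⟩
    c : ∀ k i j → Carrier
    c k i j = ι (+[1+ w k ] ℤ.* (F k i ℤ.* F k j))

    entry : ∀ w f g x y → ι w * (ι f * x * (ι g * y)) ≈ ι (w ℤ.* (f ℤ.* g)) * (x * y)
    entry w f g x y = trans (regroup (ι w) (ι f) x (ι g) y) (*-congʳ (sym (trans (ι-* w (f ℤ.* g)) (*-congˡ (ι-* f g)))))
      where
      regroup : ∀ w f x g y → w * (f * x * (g * y)) ≈ w * (f * g) * (x * y)
      regroup = solve 5 (λ w f x g y → w :* (f :* x :* (g :* y)) := w :* (f :* g) :* (x :* y)) refl

    term : ∀ k → ι +[1+ w k ] * (t k * t k) ≈ sum λ i → sum λ j → c k i j * (z i * z j)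
    term k = begin-equality
      ι +[1+ w k ] * (t k * t k)
        ≈⟨ *-congˡ (*-distribʳ-sum (t k) (λ i → ι (F k i) * z i)) ⟩
      ι +[1+ w k ] * sum (λ i → ι (F k i) * z i * t k)
        ≈⟨ *-distribˡ-sum (ι +[1+ w k ]) (λ i → ι (F k i) * z i * t k) ⟩
      sum (λ i → ι +[1+ w k ] * (ι (F k i) * z i * t k))
        ≈⟨ sum-cong-≋ (λ i → trans (*-congˡ (*-distribˡ-sum (ι (F k i) * z i) (λ j → ι (F k j) * z j)))
             (*-distribˡ-sum (ι +[1+ w k ]) (λ j → ι (F k i) * z i * (ι (F k j) * z j)))) ⟩
      sum (λ i → sum λ j → ι +[1+ w k ] * (ι (F k i) * z i * (ι (F k j) * z j)))
        ≈⟨ sum-cong-≋ (λ i → sum-cong-≋ λ j → entry +[1+ w k ] (F k i) (F k j) (z i) (z j)) ⟩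
      sum (λ i → sum λ j → c k i j * (z i * z j)) ∎

  sumOfSquares-nonneg : (w : Vector ℕ r) (F : Vector (Form n) r) → ∀ z → 0# ≤ sumOfSquares w F z
  sumOfSquares-nonneg w F z = sum-nonneg (λ k → ι +[1+ w k ] * (⟨ ⟪ F k ⟫ , z ⟩ * ⟨ ⟪ F k ⟫ , z ⟩)) λ k → *-nonneg (<⇒≤ (ι-pos (w k))) (square-nonneg ⟨ ⟪ F k ⟫ , z ⟩)

  sumOfSquares-definite : (w : Vector ℕ r) (F : Vector (Form n) r) → ∀ z →
                          sumOfSquares w F z ≈ 0# → ∀ k → ⟨ ⟪ F k ⟫ , z ⟩ ≈ 0#
  sumOfSquares-definite w F z ∑≈0 k = square≈0 (*-cancelˡ-≈0 (pos⇒≉0 (ι-pos (w k))) (≤-antisym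
    (≤-trans (term≤sum (λ k → ι +[1+ w k ] * (⟨ ⟪ F k ⟫ , z ⟩ * ⟨ ⟪ F k ⟫ , z ⟩)) (λ k → *-nonneg (<⇒≤ (ι-pos (w k))) (square-nonneg ⟨ ⟪ F k ⟫ , z ⟩)) k) (≤-reflexive ∑≈0))
    (*-nonneg (<⇒≤ (ι-pos (w k))) (square-nonneg ⟨ ⟪ F k ⟫ , z ⟩))))

  sumOfSquares-zero : (w : Vector ℕ r) (F : Vector (Form n) r) → ∀ z →
                      (∀ k → ⟨ ⟪ F k ⟫ , z ⟩ ≈ 0#) → sumOfSquares w F z ≈ 0#
  sumOfSquares-zero w F z Fz≈0 = sum-zero (λ k → ι +[1+ w k ] * (⟨ ⟪ F k ⟫ , z ⟩ * ⟨ ⟪ F k ⟫ , z ⟩)) λ k → trans (*-congˡ (trans (*-congʳ (Fz≈0 k)) (zeroˡ _))) (zeroʳ _)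

  module _ (G : Graph n) where
    open Graph G
    open LineGraphForm ℝ G using (Ψ)

    -- When (z u + z v)² is expanded over ordered pairs, the two squares have the same sum `P` by
    -- symmetry of adjacency. Together they give the diagonal entries 2 · degree.
    Ψ≈quadratic : ∀ z → Ψ z - ι (+ 4) * ‖ z ‖² ≈ quadratic (shiftedLaplacian G) z
    Ψ≈quadratic z = begin-equality
      Ψ z - ι (+ 4) * ‖ z ‖²                          ≈⟨ +-congʳ (trans (sum-cong-≋ λ u → sum-cong-≋ λ v → expand u v) distribute) ⟩
      P + (P′ + C) - ι (+ 4) * ‖ z ‖²                 ≈⟨ +-congʳ (+-congˡ (+-congʳ P′≈P)) ⟩
      P + (P + C) - ι (+ 4) * ‖ z ‖²                  ≈⟨ collect ⟨
      quadratic (shiftedLaplacian G) z                ∎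
      where
      A : Fin n → Fin n → Carrier
      A u v = ι (adjacencyℤ G u v)
      P P′ C : Carrier
      P  = sum λ u → sum λ v → A u v * (z u * z u)
      P′ = sum λ u → sum λ v → A u v * (z v * z v)
      C  = sum λ u → sum λ v → ι (+ 2) * A u v * (z u * z v)

      A-sym : ∀ u v → A u v ≈ A v u
      A-sym u v with u ~? v | v ~? u
      ... | yes _  | yes _  = refl
      ... | no _   | no _   = refl
      ... | yes uv | no ¬vu = contradiction (~-sym uv) ¬vu
      ... | no ¬uv | yes vu = contradiction (~-sym vu) ¬uv

      expand : ∀ u v → [ u ~? v ] ((z u + z v) * (z u + z v)) ≈
               A u v * (z u * z u) + (A u v * (z v * z v) + ι (+ 2) * A u v * (z u * z v))
      expand u v with u ~? v
      ... | yes _ = solve 2 (λ x y → (x :+ y) :* (x :+ y) := con (+ 1) :* (x :* x) :+ (con (+ 1) :* (y :* y) :+ con (+ 2) :* con (+ 1) :* (x :* y))) refl (z u) (z v)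
      ... | no _  = solve 2 (λ x y → con +0 := con +0 :* (x :* x) :+ (con +0 :* (y :* y) :+ con (+ 2) :* con +0 :* (x :* y))) refl (z u) (z v)

      ∑∑-+ : (f g : Fin n → Fin n → Carrier) →
             sum (λ u → sum λ v → f u v + g u v) ≈ sum (λ u → sum (f u)) + sum (λ u → sum (g u))
      ∑∑-+ f g = trans (sum-cong-≋ λ u → ∑-distrib-+ (f u) (g u)) (∑-distrib-+ (λ u → sum (f u)) (λ u → sum (g u)))

      distribute : sum (λ u → sum λ v → A u v * (z u * z u) + (A u v * (z v * z v) + ι (+ 2) * A u v * (z u * z v))) ≈ P + (P′ + C)
      distribute = trans (∑∑-+ (λ u v → A u v * (z u * z u)) (λ u v → A u v * (z v * z v) + ι (+ 2) * A u v * (z u * z v)))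
        (+-congˡ (∑∑-+ (λ u v → A u v * (z v * z v)) (λ u v → ι (+ 2) * A u v * (z u * z v))))

      P′≈P : P′ ≈ P
      P′≈P = trans (∑-comm (λ u v → A u v * (z v * z v))) (sum-cong-≋ λ v → sum-cong-≋ λ u → *-congʳ (A-sym u v))

      D : Vector Carrier n
      D u = ι (+ 2 ℤ.* degree G u ℤ.- + 4)

      D-expand : ∀ u → D u ≈ ι (+ 2) * sum (A u) - ι (+ 4)
      D-expand u = trans (ι-+ (+ 2 ℤ.* degree G u) (ℤ.- + 4))
        (+-congʳ (trans (ι-* (+ 2) (degree G u)) (*-congˡ (ι-sum (adjacencyℤ G u)))))

      entry : ∀ u v → ι (shiftedLaplacian G u v) * (z u * z v) ≈ D u * z u * (δ u v * z v) + ι (+ 2) * A u v * (z u * z v)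
      entry u v = trans
        (*-congʳ (trans (ι-+ ((+ 2 ℤ.* degree G u ℤ.- + 4) ℤ.* unit u v) (+ 2 ℤ.* adjacencyℤ G u v))
          (+-cong (trans (ι-* (+ 2 ℤ.* degree G u ℤ.- + 4) (unit u v)) (*-congˡ (ι-unit u v))) (ι-* (+ 2) (adjacencyℤ G u v)))))
        (regroup (D u) (δ u v) (ι (+ 2) * A u v) (z u) (z v))
        where
        regroup : ∀ d e c x y → (d * e + c) * (x * y) ≈ d * x * (e * y) + c * (x * y)
        regroup = solve 5 (λ d e c x y → (d :* e :+ c) :* (x :* y) := d :* x :* (e :* y) :+ c :* (x :* y)) refl

      diagonal : ∀ u → sum (λ v → D u * z u * (δ u v * z v)) ≈ (sum (λ v → A u v * (z u * z u)) + sum (λ v → A u v * (z u * z u))) + - (ι (+ 4) * (z u * z u))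
      diagonal u = begin-equality
        sum (λ v → D u * z u * (δ u v * z v))                          ≈⟨ *-distribˡ-sum (D u * z u) (λ v → δ u v * z v) ⟨
        D u * z u * ⟨ δ u , z ⟩                                        ≈⟨ *-cong (*-congʳ (D-expand u)) (dot-δ z u) ⟩
        (ι (+ 2) * sum (A u) - ι (+ 4)) * z u * z u                    ≈⟨ regroup (sum (A u)) (z u) ⟩
        (sum (A u) * (z u * z u) + sum (A u) * (z u * z u)) + - (ι (+ 4) * (z u * z u))
                                                                       ≈⟨ +-congʳ (+-cong (*-distribʳ-sum (z u * z u) (A u)) (*-distribʳ-sum (z u * z u) (A u))) ⟩
        _                                                              ∎
        where
        regroup : ∀ s x → (ι (+ 2) * s - ι (+ 4)) * x * x ≈ (s * (x * x) + s * (x * x)) + - (ι (+ 4) * (x * x))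
        regroup = solve 2 (λ s x → (con (+ 2) :* s :- con (+ 4)) :* x :* x := (s :* (x :* x) :+ s :* (x :* x)) :+ (:- (con (+ 4) :* (x :* x)))) refl

      collect : quadratic (shiftedLaplacian G) z ≈ P + (P + C) - ι (+ 4) * ‖ z ‖²
      collect = begin-equality
        quadratic (shiftedLaplacian G) z
          ≈⟨ sum-cong-≋ (λ u → sum-cong-≋ λ v → entry u v) ⟩
        sum (λ u → sum λ v → D u * z u * (δ u v * z v) + ι (+ 2) * A u v * (z u * z v))
          ≈⟨ ∑∑-+ (λ u v → D u * z u * (δ u v * z v)) (λ u v → ι (+ 2) * A u v * (z u * z v)) ⟩
        sum (λ u → sum λ v → D u * z u * (δ u v * z v)) + C
          ≈⟨ +-congʳ (sum-cong-≋ diagonal) ⟩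
        sum (λ u → (row u + row u) + - (ι (+ 4) * (z u * z u))) + C
          ≈⟨ +-congʳ (trans (∑-distrib-+ (λ u → row u + row u) (λ u → - (ι (+ 4) * (z u * z u))))
               (+-cong (∑-distrib-+ row row) (trans (sum-neg (λ u → ι (+ 4) * (z u * z u))) (-‿cong (sym (*-distribˡ-sum (ι (+ 4)) (λ u → z u * z u))))))) ⟩
        (P + P) + - (ι (+ 4) * ‖ z ‖²) + C
          ≈⟨ regroup P C (ι (+ 4) * ‖ z ‖²) ⟩
        P + (P + C) - ι (+ 4) * ‖ z ‖² ∎
        where
        row : Vector Carrier n
        row u = sum λ v → A u v * (z u * z u)
        regroup : ∀ P C w → (P + P) + - w + C ≈ P + (P + C) - w
        regroup = solve 3 (λ P C w → (P :+ P) :+ (:- w) :+ C := P :+ (P :+ C) :- w) refl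

  *-cancelˡ-pos : ∀ {x y} → 0# < x → 0# < x * y → 0# < y
  *-cancelˡ-pos {x} 0<x 0<xy = ≤∧≉⇒< (*-cancelˡ-nonneg 0<x (<⇒≤ 0<xy))
    λ 0≈y → <-irrefl (sym (trans (*-congˡ (sym 0≈y)) (zeroʳ x))) 0<xy

  module Diagonalized {G : Graph n} {r s : ℕ}
    {w⁺ : Vector ℕ r} {F⁺ : Vector (Form n) r} {w⁻ : Vector ℕ s} {F⁻ : Vector (Form n) s} {c e : ℕ}
    (diagonal : ∀ i j → +[1+ c ] ℤ.* shiftedLaplacian G i j ≡ squares w⁺ F⁺ i j ℤ.- squares w⁻ F⁻ i j)
    {C : Fin n → Form (r ℕ.+ s)}
    (C-correct : ∀ i j → ℤΣ.sum (λ k → C i k ℤ.* (F⁺ ++ F⁻) k j) ≡ +[1+ e ] ℤ.* unit i j) where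

    open LineGraphForm ℝ G using (Ψ)

    difference : ∀ z → ι +[1+ c ] * (Ψ z - ι (+ 4) * ‖ z ‖²) ≈ sumOfSquares w⁺ F⁺ z - sumOfSquares w⁻ F⁻ z
    difference z = begin-equality
      ι +[1+ c ] * (Ψ z - ι (+ 4) * ‖ z ‖²)
        ≈⟨ *-congˡ (Ψ≈quadratic G z) ⟩
      ι +[1+ c ] * quadratic M z
        ≈⟨ trans (*-distribˡ-sum (ι +[1+ c ]) (λ i → sum λ j → ι (M i j) * (z i * z j)))
             (sum-cong-≋ λ i → *-distribˡ-sum (ι +[1+ c ]) (λ j → ι (M i j) * (z i * z j))) ⟩
      sum (λ i → sum λ j → ι +[1+ c ] * (ι (M i j) * (z i * z j)))
        ≈⟨ sum-cong-≋ (λ i → sum-cong-≋ λ j → entry i j) ⟩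
      sum (λ i → sum λ j → ι (S⁺ i j) * (z i * z j) + - (ι (S⁻ i j) * (z i * z j)))
        ≈⟨ trans (sum-cong-≋ λ i → trans (∑-distrib-+ (λ j → ι (S⁺ i j) * (z i * z j)) (λ j → - (ι (S⁻ i j) * (z i * z j))))
                                         (+-congˡ (sum-neg (λ j → ι (S⁻ i j) * (z i * z j)))))
             (trans (∑-distrib-+ (λ i → sum λ j → ι (S⁺ i j) * (z i * z j)) (λ i → - (sum λ j → ι (S⁻ i j) * (z i * z j))))
                    (+-congˡ (sum-neg (λ i → sum λ j → ι (S⁻ i j) * (z i * z j))))) ⟩
      quadratic S⁺ z - quadratic S⁻ z
        ≈⟨ +-cong (sumOfSquares≈quadratic w⁺ F⁺ z) (-‿cong (sumOfSquares≈quadratic w⁻ F⁻ z)) ⟨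
      sumOfSquares w⁺ F⁺ z - sumOfSquares w⁻ F⁻ z ∎
      where
      M S⁺ S⁻ : Fin n → Fin n → ℤ
      M  = shiftedLaplacian G
      S⁺ = squares w⁺ F⁺
      S⁻ = squares w⁻ F⁻
      entry : ∀ i j → ι +[1+ c ] * (ι (M i j) * (z i * z j)) ≈ ι (S⁺ i j) * (z i * z j) + - (ι (S⁻ i j) * (z i * z j))
      entry i j = begin-equality
        ι +[1+ c ] * (ι (M i j) * (z i * z j))                      ≈⟨ *-assoc _ _ _ ⟨
        ι +[1+ c ] * ι (M i j) * (z i * z j)                        ≈⟨ *-congʳ (ι-* +[1+ c ] (M i j)) ⟨
        ι (+[1+ c ] ℤ.* M i j) * (z i * z j)                        ≈⟨ *-congʳ (reflexive (≡.cong ι (diagonal i j))) ⟩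
        ι (S⁺ i j ℤ.- S⁻ i j) * (z i * z j)                         ≈⟨ *-congʳ (trans (ι-+ (S⁺ i j) (ℤ.- S⁻ i j)) (+-congˡ (ι-neg (S⁻ i j)))) ⟩
        (ι (S⁺ i j) - ι (S⁻ i j)) * (z i * z j)                     ≈⟨ trans (distribʳ _ _ _) (+-congˡ (sym (-‿distribˡ-* _ _))) ⟩
        ι (S⁺ i j) * (z i * z j) + - (ι (S⁻ i j) * (z i * z j))     ∎

    injective : ∀ z → (∀ k → ⟨ ⟪ F⁺ k ⟫ , z ⟩ ≈ 0#) → (∀ k → ⟨ ⟪ F⁻ k ⟫ , z ⟩ ≈ 0#) → z ≋ 0ᵥ
    injective z F⁺z≈0 F⁻z≈0 i = *-cancelˡ-≈0 (pos⇒≉0 (ι-pos e)) (begin-equality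
      ι +[1+ e ] * z i
        ≈⟨ *-congˡ (dot-δ z i) ⟨
      ι +[1+ e ] * ⟨ δ i , z ⟩
        ≈⟨ dot-·ˡ (ι +[1+ e ]) (δ i) z ⟨
      ⟨ ι +[1+ e ] ·ᵥ δ i , z ⟩
        ≈⟨ dot-cong {y = z} scaled-unit (λ _ → refl) ⟩
      ⟨ combination ⟪ C i ⟫ (⟪_⟫ ∘ F) , z ⟩
        ≈⟨ dot-comm (combination ⟪ C i ⟫ (⟪_⟫ ∘ F)) z ⟩
      ⟨ z , combination ⟪ C i ⟫ (⟪_⟫ ∘ F) ⟩
        ≈⟨ dot-combination z ⟪ C i ⟫ (⟪_⟫ ∘ F) ⟩
      sum (λ k → ι (C i k) * ⟨ z , ⟪ F k ⟫ ⟩)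
        ≈⟨ sum-zero (λ k → ι (C i k) * ⟨ z , ⟪ F k ⟫ ⟩) (λ k → trans (*-congˡ (trans (dot-comm z ⟪ F k ⟫) (Fz≈0 k))) (zeroʳ _)) ⟩
      0# ∎)
      where
      F : Vector (Form n) (r ℕ.+ s)
      F = F⁺ ++ F⁻
      Fz≈0 : ∀ k → ⟨ ⟪ F k ⟫ , z ⟩ ≈ 0#
      Fz≈0 k with splitAt r k
      ... | inj₁ a = F⁺z≈0 a
      ... | inj₂ b = F⁻z≈0 b
      scaled-unit : ι +[1+ e ] ·ᵥ δ i ≋ combination ⟪ C i ⟫ (⟪_⟫ ∘ F)
      scaled-unit j = begin-equality
        ι +[1+ e ] * δ i j                         ≈⟨ *-congˡ (ι-unit i j) ⟨
        ι +[1+ e ] * ι (unit i j)                  ≈⟨ ι-* +[1+ e ] (unit i j) ⟨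
        ι (+[1+ e ] ℤ.* unit i j)                  ≈⟨ reflexive (≡.cong ι (C-correct i j)) ⟨
        ι (ℤΣ.sum λ k → C i k ℤ.* F k j)           ≈⟨ ι-sum (λ k → C i k ℤ.* F k j) ⟩
        sum (λ k → ι (C i k ℤ.* F k j))            ≈⟨ sum-cong-≋ (λ k → ι-* (C i k) (F k j)) ⟩
        combination ⟪ C i ⟫ (⟪_⟫ ∘ F) j            ∎

    -- Only the squares of `F⁺` are left on this kernel. Their sum is 0 only if all the forms vanish
    -- at z, hence only for z = 0.
    positive-definite : ∀ z → 0# < ‖ z ‖² → (∀ k → ⟨ ⟪ F⁻ k ⟫ , z ⟩ ≈ 0#) → ι (+ 4) * ‖ z ‖² < Ψ z
    positive-definite z 0<z² F⁻z≈0 with nonneg-cases (sumOfSquares-nonneg w⁺ F⁺ z)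
    ... | inj₁ 0<x = <-diff (*-cancelˡ-pos (ι-pos c) (<-≤-trans 0<x (≤-reflexive (sym (trans (difference z)
      (trans (+-congˡ (trans (-‿cong (sumOfSquares-zero w⁻ F⁻ z F⁻z≈0)) -0#≈0#)) (+-identityʳ _))))))) refl
    ... | inj₂ x≈0 = contradiction (sum-zero (λ i → z i * z i) λ i → trans (*-congʳ (injective z
      (sumOfSquares-definite w⁺ F⁺ z x≈0) F⁻z≈0 i)) (zeroˡ _)) (pos⇒≉0 0<z²)

    negative-definite : ∀ z → 0# < ‖ z ‖² → (∀ k → ⟨ ⟪ F⁺ k ⟫ , z ⟩ ≈ 0#) → Ψ z < ι (+ 4) * ‖ z ‖²
    negative-definite z 0<z² F⁺z≈0 with nonneg-cases (sumOfSquares-nonneg w⁻ F⁻ z)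
    ... | inj₁ 0<y = <-diff (*-cancelˡ-pos (ι-pos c) (<-≤-trans 0<y (≤-reflexive (begin-equality
      sumOfSquares w⁻ F⁻ z                                       ≈⟨ cancel (sumOfSquares w⁺ F⁺ z) (sumOfSquares w⁻ F⁻ z) ⟩
      sumOfSquares w⁺ F⁺ z - (sumOfSquares w⁺ F⁺ z - sumOfSquares w⁻ F⁻ z)
                                                                 ≈⟨ +-cong (sumOfSquares-zero w⁺ F⁺ z F⁺z≈0) (-‿cong (sym (difference z))) ⟩
      0# - ι +[1+ c ] * (Ψ z - ι (+ 4) * ‖ z ‖²)                 ≈⟨ swap-sign (ι +[1+ c ]) (Ψ z) (ι (+ 4) * ‖ z ‖²) ⟩
      ι +[1+ c ] * (ι (+ 4) * ‖ z ‖² - Ψ z)                      ∎)))) refl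
      where
      cancel : ∀ x y → y ≈ x - (x - y)
      cancel = solve 2 (λ x y → y := x :- (x :- y)) refl
      swap-sign : ∀ c x y → 0# - c * (x - y) ≈ c * (y - x)
      swap-sign = solve 3 (λ c x y → con +0 :- c :* (x :- y) := c :* (y :- x)) refl
    ... | inj₂ y≈0 = contradiction (sum-zero (λ i → z i * z i) λ i → trans (*-congʳ (injective z
      F⁺z≈0 (sumOfSquares-definite w⁻ F⁻ z y≈0) i)) (zeroˡ _)) (pos⇒≉0 0<z²)

-- Connectedness.

module _ (G : Graph (suc n)) where
  open Graph G

  connected-from-zero : (∀ i → Star _~_ zero i) → Connected G
  connected-from-zero reach = _ , λ u v → Star.reverse ~-sym (reach u) ◅◅ reach v

  hamiltonian-connected : (∀ i → inject₁ i ~ suc i) → Connected G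
  hamiltonian-connected path = connected-from-zero
    (Fin.<-weakInduction (Star _~_ zero) Star.ε λ i reach → reach ◅◅ path i ◅ Star.ε)

module _ {H : Graph n} {root : Fin n} {S : Graph k} where
  open RootedProduct H root S

  rootedProduct-connected : Connected H → Connected S → Connected rootedProduct
  rootedProduct-connected (n≢0 , walkH) (k≢0 , walkS) = ℕ.m*n≢0 n k {{n≢0}} {{k≢0}} , λ a b →
    ≡.subst₂ (Star _) (Fin.combine-remQuot {n} k a) (Fin.combine-remQuot {n} k b)
      (walk (remQuot {n} k a) (remQuot {n} k b))
    where
    lift : ∀ {a b} → Adjacent a b → Graph._~_ rootedProduct (uncurry combine a) (uncurry combine b)
    lift {i , j} {i′ , j′} ab = ≡.subst₂ Adjacent (≡.sym (Fin.remQuot-combine i j)) (≡.sym (Fin.remQuot-combine i′ j′)) ab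

    walk : ∀ a b → Star (Graph._~_ rootedProduct) (uncurry combine a) (uncurry combine b)
    walk (i , j) (i′ , j′) =
      Star.gmap (λ i → combine i j) (λ h → lift (inj₁ (≡.refl , h))) (walkH i root) ◅◅
      Star.gmap (combine root) (λ s → lift (inj₂ ((≡.refl , ≡.refl) , s))) (walkS j j′) ◅◅
      Star.gmap (λ i → combine i j′) (λ h → lift (inj₁ (≡.refl , h))) (walkH root i′)

data StarAdjacent {n} : Fin (suc n) → Fin (suc n) → Set where
  outward : ∀ {i} → StarAdjacent zero (suc i)
  inward  : ∀ {i} → StarAdjacent (suc i) zero

-- Any tree would give the same signature; the edges of a star are the easiest to count.
star : ∀ n → Graph (suc n)
star n = record
  { _~_   = StarAdjacent
  ; _~?_  = λ { zero zero → no λ () ; zero (suc _) → yes outward ; (suc _) zero → yes inward ; (suc _) (suc _) → no λ () }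
  ; ~-sym = λ { outward → inward ; inward → outward }
  ; ~-irr = λ { zero () ; (suc _) () }
  }

star-connected : ∀ n → Connected (star n)
star-connected n = connected-from-zero (star n) λ { zero → Star.ε ; (suc _) → outward ◅ Star.ε }

-- Counting edges through ordered adjacent pairs.

module EdgeCount where
  open FiniteSums ℕ.+-0-commutativeMonoid
  open import Algebra.Properties.CommutativeMonoid.Sum ℕ.+-0-commutativeMonoid using (sum; sum-cong-≋)

  sum-ones : ∀ n → sum {n} (λ _ → 1) ≡ n
  sum-ones zero    = ≡.refl
  sum-ones (suc n) = ≡.cong suc (sum-ones n)

  sum-const : ∀ c → sum {n} (λ _ → c) ≡ n ℕ.* c
  sum-const {zero}  c = ≡.refl
  sum-const {suc n} c = ≡.cong (c ℕ.+_) (sum-const {n} c)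

  adjacentPairs : Graph n → ℕ
  adjacentPairs G = sum λ u → sum λ v → [ Graph._~?_ G u v ] 1

  double-edges : (G : Graph n) → length (edges G) ℕ.+ length (edges G) ≡ adjacentPairs G
  double-edges G = ≡.trans (≡.cong (λ m → m ℕ.+ m) (≡.sym (sum-ones (length (edges G)))))
    (handshake G (λ _ _ → 1) (λ _ _ → ≡.refl))

  star-pairs : ∀ n → adjacentPairs (star n) ≡ n ℕ.+ n
  star-pairs n = ≡.cong₂ ℕ._+_ (sum-ones n)
    (≡.trans (sum-cong-≋ {n} λ _ → ≡.cong suc (≡.trans (sum-const {n} 0) (ℕ.*-zeroʳ n))) (sum-ones n))

  rootedProduct-pairs : (H : Graph n) (root : Fin n) (S : Graph k) →
    adjacentPairs (RootedProduct.rootedProduct H root S) ≡ k ℕ.* adjacentPairs H ℕ.+ adjacentPairs S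
  rootedProduct-pairs {k = k} H root S = ≡.trans (sum-rootedProduct H root S (λ _ _ → 1))
    (≡.cong (ℕ._+ adjacentPairs S) (sum-const {k} (adjacentPairs H)))

  halve : ∀ m n → m ℕ.+ m ≡ n ℕ.+ n → m ≡ n
  halve m n eq = ℕ.*-cancelˡ-≡ m n 2 (≡.trans (twice m) (≡.trans eq (≡.sym (twice n))))
    where
    twice : ∀ m → 2 ℕ.* m ≡ m ℕ.+ m
    twice m = ≡.cong (m ℕ.+_) (ℕ.+-identityʳ m)

  rootedProduct-edges : (H : Graph n) (root : Fin n) (S : Graph k) → ∀ a b →
    adjacentPairs H ≡ a ℕ.+ a → adjacentPairs S ≡ b ℕ.+ b →
    length (edges (RootedProduct.rootedProduct H root S)) ≡ k ℕ.* a ℕ.+ b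
  rootedProduct-edges {k = k} H root S a b ∣H∣ ∣S∣ = halve _ (k ℕ.* a ℕ.+ b)
    (≡.trans (double-edges (RootedProduct.rootedProduct H root S)) (≡.trans (rootedProduct-pairs H root S)
      (≡.trans (≡.cong₂ (λ x y → k ℕ.* x ℕ.+ y) ∣H∣ ∣S∣) (arith k a b))))
    where
    open ℕ.+-*-Solver
    arith : ∀ k a b → k ℕ.* (a ℕ.+ a) ℕ.+ (b ℕ.+ b) ≡ (k ℕ.* a ℕ.+ b) ℕ.+ (k ℕ.* a ℕ.+ b)
    arith = solve 3 (λ k a b → k :* (a :+ a) :+ (b :+ b) := (k :* a :+ b) :+ (k :* a :+ b)) ≡.refl

-- Inertia of the line graph of a rooted product.

module LineGraphInertia (ℝ : RealNumbers) (G : Graph n) where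
  open RealNumbers ℝ
  open OrderedField ℝ
  open Spectra ℝ
  open Vectors ℝ
  open InertiaBounds ℝ
  open LineGraphForm ℝ G

  -- A subspace on which Q − 2I is positive (negative) definite transports to the line graph along Bᵀ (B).
  lineGraph-inertia : ∀ {p} (g : Fin r → Vector Carrier n) (f : Fin p → Vector Carrier n) →
    (∀ y → 0# < ‖ y ‖² → g ⊛ y ≋ 0ᵥ → ι (+ 4) * ‖ y ‖² < Ψ y) →
    (∀ y → 0# < ‖ y ‖² → f ⊛ y ≋ 0ᵥ → Ψ y < ι (+ 4) * ‖ y ‖²) →
    n ≡ r ℕ.+ p → ∀ q → p ℕ.+ q ≡ length (edges G) → HasInertia (lineGraph G) p q
  lineGraph-inertia g f positive negative n≡r+p = inertia-from-subspaces (lineGraph G) Bᵀ g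
    (λ y 0<y² gy≋0 → line-positive y (positive y 0<y² gy≋0))
    (λ s → Bᵀ ⊛ f s)
    (λ x 0<x² fx≋0 → line-negative x 0<x² λ 0<y² → negative (B ⊛ x) 0<y² λ s →
      trans (adjoint B (f s) x) (fx≋0 s))
    n≡r+p

module RootedProductForm (ℝ : RealNumbers) (H : Graph n) (root : Fin n) (S : Graph k) where
  open RealNumbers ℝ
  open OrderedField ℝ
  open Spectra ℝ
  open Vectors ℝ
  open FiniteSums +-commutativeMonoid using ([_]_; sum-combine; sum-rootedProduct)
  open RootedProduct H root S
  private
    module G = LineGraphForm ℝ rootedProduct
    module H = LineGraphForm ℝ H

  block : Vector Carrier (n ℕ.* k) → Fin k → Vector Carrier n
  block y j i = y (combine i j)

  -- The Kronecker product of the family with the identity matrix: the form with index `combine s j`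
  -- is `f s` evaluated on the `j`-th copy.
  copies : (Fin r → Vector Carrier n) → Fin (r ℕ.* k) → Vector Carrier (n ℕ.* k)
  copies {r} f c a = δ (proj₂ (remQuot {r} k c)) (proj₂ (remQuot {n} k a)) * f (proj₁ (remQuot {r} k c)) (proj₁ (remQuot {n} k a))

  copies-block : (f : Fin r → Vector Carrier n) → ∀ y → copies f ⊛ y ≋ 0ᵥ → ∀ j s → ⟨ f s , block y j ⟩ ≈ 0#
  copies-block {r} f y fy≋0 j s = begin-equality
    ⟨ f s , block y j ⟩
      ≈⟨ sum-cong-≋ (λ i → sym (trans (sum-cong-≋ λ j′ → *-assoc (δ j j′) (f s i) (y (combine i j′))) (dot-δ (λ j′ → f s i * y (combine i j′)) j))) ⟩
    sum (λ i → sum λ j′ → δ j j′ * f s i * y (combine i j′))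
      ≈⟨ sum-cong-≋ (λ i → sum-cong-≋ λ j′ → reflexive (≡.cong (_* y (combine i j′)) (≡.sym (entry i j′)))) ⟩
    sum (λ (i : Fin n) → sum λ (j′ : Fin k) → copies f (combine s j) (combine i j′) * y (combine i j′))
      ≈⟨ sum-combine {k} n (λ a → copies f (combine s j) a * y a) ⟨
    ⟨ copies f (combine s j) , y ⟩
      ≈⟨ fy≋0 (combine s j) ⟩
    0# ∎
    where
    entry : ∀ i j′ → copies f (combine s j) (combine i j′) ≡ δ j j′ * f s i
    entry i j′ = ≡.cong₂ (λ c a → δ (proj₂ c) (proj₂ a) * f (proj₁ c) (proj₁ a)) (Fin.remQuot-combine s j) (Fin.remQuot-combine i j′)

  norm-blocks : ∀ y → ‖ y ‖² ≈ sum (λ j → ‖ block y j ‖²)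
  norm-blocks y = trans (sum-combine {k} n (λ a → y a * y a)) (∑-comm (λ (i : Fin n) (j : Fin k) → y (combine i j) * y (combine i j)))

  4norm-blocks : ∀ y → ι (+ 4) * ‖ y ‖² ≈ sum (λ j → ι (+ 4) * ‖ block y j ‖²)
  4norm-blocks y = trans (*-congˡ (norm-blocks y)) (*-distribˡ-sum (ι (+ 4)) (λ j → ‖ block y j ‖²))

  links : Vector Carrier (n ℕ.* k) → Carrier
  links y = sum λ j → sum λ j′ → [ Graph._~?_ S j j′ ] ((block y j root + block y j′ root) * (block y j root + block y j′ root))

  Ψ-blocks : ∀ y → G.Ψ y ≈ sum (λ j → H.Ψ (block y j)) + links y
  Ψ-blocks y = sum-rootedProduct H root S (λ a b → (y a + y b) * (y a + y b))

  []-nonneg : {P : Set} (P? : Dec P) → ∀ {x} → 0# ≤ x → 0# ≤ [ P? ] x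
  []-nonneg (yes _) 0≤x = 0≤x
  []-nonneg (no _)  _   = ≤-reflexive refl

  []-zero : {P : Set} (P? : Dec P) → ∀ {x} → x ≈ 0# → [ P? ] x ≈ 0#
  []-zero (yes _) x≈0 = x≈0
  []-zero (no _)  _   = refl

  links-nonneg : ∀ y → 0# ≤ links y
  links-nonneg y = sum-nonneg _ λ j → sum-nonneg _ λ j′ → []-nonneg (Graph._~?_ S j j′) (square-nonneg (block y j root + block y j′ root))

  links-zero : ∀ y → (∀ j → block y j root ≈ 0#) → links y ≈ 0#
  links-zero y y≈0 = sum-zero _ λ j → sum-zero _ λ j′ → []-zero (Graph._~?_ S j j′)
    (trans (*-congʳ (trans (+-cong (y≈0 j) (y≈0 j′)) (+-identityʳ 0#))) (zeroˡ _))

  Ψ-zero : ∀ z → z ≋ 0ᵥ → H.Ψ z ≈ 0#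
  Ψ-zero z z≋0 = sum-zero _ λ u → sum-zero _ λ v → []-zero (Graph._~?_ H u v)
    (trans (*-congʳ (trans (+-cong (z≋0 u) (z≋0 v)) (+-identityʳ 0#))) (zeroˡ _))

  4norm-zero : ∀ (z : Vector Carrier n) → z ≋ 0ᵥ → ι (+ 4) * ‖ z ‖² ≈ 0#
  4norm-zero z z≋0 = trans (*-congˡ (sum-zero _ λ i → trans (*-congʳ (z≋0 i)) (zeroˡ _))) (zeroʳ _)

  sum-strict : ∀ {m} {f g : Vector Carrier m} → (∀ i → f i ≤ g i) → ∀ i → f i < g i → sum f < sum g
  sum-strict {suc m} {f} {g} f≤g i fi<gi = begin-strict
    sum f                                ≈⟨ sum-remove {i = i} f ⟩
    f i + sum (f ∘ Fin.punchIn i)        <⟨ +-mono-<-≤ fi<gi (sum-mono (f≤g ∘ Fin.punchIn i)) ⟩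
    g i + sum (g ∘ Fin.punchIn i)        ≈⟨ sum-remove {i = i} g ⟨
    sum g                                ∎

  nonzero-block : ∀ y → 0# < ‖ y ‖² → ∃[ j ] 0# < ‖ block y j ‖²
  nonzero-block y 0<y² with Fin.any? (λ j → 0# <? ‖ block y j ‖²)
  ... | yes found = found
  ... | no none   = contradiction (<-≤-trans 0<y² (≤-trans (≤-reflexive (norm-blocks y)) (≤-trans
    (sum-mono {g = λ _ → 0#} λ j 0<b → none (j , 0<b)) (≤-reflexive (sum-zero {k} (λ _ → 0#) λ _ → refl))))) (<-irrefl refl)

  -- Zero blocks contribute equally to both sides, and since y ≠ 0 at least one block is nonzero and
  -- makes the sum strict.
  blockwise-strict : ∀ y → 0# < ‖ y ‖² → {f g : Vector Carrier n → Carrier} →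
    (∀ j → 0# < ‖ block y j ‖² → f (block y j) < g (block y j)) →
    (∀ z → z ≋ 0ᵥ → f z ≈ g z) → sum (λ j → f (block y j)) < sum (λ j → g (block y j))
  blockwise-strict y 0<y² {f} {g} f<g f≈g = sum-strict weak (proj₁ nonzero) (f<g (proj₁ nonzero) (proj₂ nonzero))
    where
    nonzero : ∃[ j ] 0# < ‖ block y j ‖²
    nonzero = nonzero-block y 0<y²
    weak : ∀ j → f (block y j) ≤ g (block y j)
    weak j with ‖‖²-cases (block y j)
    ... | inj₁ 0<b² = <⇒≤ (f<g j 0<b²)
    ... | inj₂ b≋0  = ≤-reflexive (f≈g (block y j) b≋0)

  -- The links only add squares to `Ψ`, so positivity on the copies suffices.
  rootedProduct-positive : (g : Fin r → Vector Carrier n) →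
    (∀ z → 0# < ‖ z ‖² → (∀ s → ⟨ g s , z ⟩ ≈ 0#) → ι (+ 4) * ‖ z ‖² < H.Ψ z) →
    ∀ y → 0# < ‖ y ‖² → copies g ⊛ y ≋ 0ᵥ → ι (+ 4) * ‖ y ‖² < G.Ψ y
  rootedProduct-positive g positive y 0<y² gy≋0 = begin-strict
    ι (+ 4) * ‖ y ‖²                             ≈⟨ 4norm-blocks y ⟩
    sum (λ j → ι (+ 4) * ‖ block y j ‖²)         <⟨ blockwise-strict y 0<y² {λ z → ι (+ 4) * ‖ z ‖²} {H.Ψ}
                                                      (λ j 0<b² → positive (block y j) 0<b² (copies-block g y gy≋0 j))
                                                      (λ z z≋0 → trans (4norm-zero z z≋0) (sym (Ψ-zero z z≋0))) ⟩
    sum (λ j → H.Ψ (block y j))                  ≈⟨ +-identityʳ _ ⟨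
    sum (λ j → H.Ψ (block y j)) + 0#             ≤⟨ +-mono-≤ (≤-reflexive refl) (links-nonneg y) ⟩
    sum (λ j → H.Ψ (block y j)) + links y        ≈⟨ Ψ-blocks y ⟨
    G.Ψ y                                        ∎

  -- The links work against negativity, so the kernel of `f` is required to lie where the root
  -- coordinate is 0. There they vanish.
  rootedProduct-negative : (f : Fin r → Vector Carrier n) →
    (∀ z → 0# < ‖ z ‖² → (∀ s → ⟨ f s , z ⟩ ≈ 0#) → H.Ψ z < ι (+ 4) * ‖ z ‖²) →
    (∀ z → (∀ s → ⟨ f s , z ⟩ ≈ 0#) → z root ≈ 0#) →
    ∀ y → 0# < ‖ y ‖² → copies f ⊛ y ≋ 0ᵥ → G.Ψ y < ι (+ 4) * ‖ y ‖²
  rootedProduct-negative f negative vanish y 0<y² fy≋0 = begin-strict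
    G.Ψ y                                        ≈⟨ Ψ-blocks y ⟩
    sum (λ j → H.Ψ (block y j)) + links y        ≈⟨ +-congˡ (links-zero y λ j → vanish (block y j) (copies-block f y fy≋0 j)) ⟩
    sum (λ j → H.Ψ (block y j)) + 0#             ≈⟨ +-identityʳ _ ⟩
    sum (λ j → H.Ψ (block y j))                  <⟨ blockwise-strict y 0<y² {H.Ψ} {λ z → ι (+ 4) * ‖ z ‖²}
                                                      (λ j 0<b² → negative (block y j) 0<b² (copies-block f y fy≋0 j))
                                                      (λ z z≋0 → trans (Ψ-zero z z≋0) (sym (4norm-zero z z≋0))) ⟩
    sum (λ j → ι (+ 4) * ‖ block y j ‖²)         ≈⟨ 4norm-blocks y ⟨
    ι (+ 4) * ‖ y ‖²                             ∎

  rootedProduct-inertia : ∀ {p} (g : Fin r → Vector Carrier n) (f : Fin p → Vector Carrier n) →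
    (∀ z → 0# < ‖ z ‖² → (∀ s → ⟨ g s , z ⟩ ≈ 0#) → ι (+ 4) * ‖ z ‖² < H.Ψ z) →
    (∀ z → 0# < ‖ z ‖² → (∀ s → ⟨ f s , z ⟩ ≈ 0#) → H.Ψ z < ι (+ 4) * ‖ z ‖²) →
    (∀ z → (∀ s → ⟨ f s , z ⟩ ≈ 0#) → z root ≈ 0#) →
    n ≡ r ℕ.+ p → ∀ q → p ℕ.* k ℕ.+ q ≡ length (edges rootedProduct) → HasInertia (lineGraph rootedProduct) (p ℕ.* k) q
  rootedProduct-inertia {r} {p} g f positive negative vanish n≡r+p =
    LineGraphInertia.lineGraph-inertia ℝ rootedProduct (copies g) (copies f)
      (rootedProduct-positive g positive) (rootedProduct-negative f negative vanish)
      (≡.trans (≡.cong (ℕ._* k) n≡r+p) (ℕ.*-distribʳ-+ k r p))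

-- The family of graphs and the signatures of their line graphs.

family : ∀ n → Graph (14 ℕ.* suc n)
family n = RootedProduct.rootedProduct gadget zero (star n)

family-connected : ∀ n → Connected (family n)
family-connected n = rootedProduct-connected {14} {suc n} {gadget} {zero} {star n}
  (hamiltonian-connected gadget gadget-path) (star-connected n)

family-edges : ∀ n → length (edges (family n)) ≡ suc n ℕ.* 16 ℕ.+ n
-- Here `≡.refl` evaluates the number of ordered adjacent pairs of the gadget to 32 = 16 + 16.
family-edges n = EdgeCount.rootedProduct-edges gadget zero (star n) 16 n ≡.refl (EdgeCount.star-pairs n)

module _ (ℝ : RealNumbers) where
  open Spectra ℝ

  -- With k = `suc n`, the second number is |E| - 9k = 16k + (k - 1) - 9k.
  family-inertia : ∀ n → HasInertia (lineGraph (family n)) (9 ℕ.* suc n) (7 ℕ.* suc n ℕ.+ n)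
  family-inertia n = RootedProductForm.rootedProduct-inertia ℝ gadget zero (star n)
    (λ s → ⟪ negativeForms s ⟫) (λ s → ⟪ positiveForms s ⟫) positive-definite negative-definite root-vanishes
    ≡.refl (7 ℕ.* suc n ℕ.+ n) (≡.trans (arith n) (≡.sym (family-edges n)))
    where
    open RealNumbers ℝ using (Carrier; _≈_; 0#)
    open OrderedField ℝ using (trans; sym; refl; ι)
    open Vectors ℝ using (⟨_,_⟩; δ; dot-δ; dot-cong)
    open IntegerForms ℝ
    open Diagonalized {G = gadget} {w⁺ = positiveWeights} {F⁺ = positiveForms} {w⁻ = negativeWeights} {F⁻ = negativeForms}
      -- The factors 3 and 6 of the two identities, given by their predecessors.
      {c = 2} {e = 5} diagonalization {C = coordinates} coordinates-correct
    open ℕ.+-*-Solver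

    arith : ∀ n → 9 ℕ.* suc n ℕ.+ (7 ℕ.* suc n ℕ.+ n) ≡ suc n ℕ.* 16 ℕ.+ n
    arith = solve 1 (λ n → con 9 :* (con 1 :+ n) :+ (con 7 :* (con 1 :+ n) :+ n) := (con 1 :+ n) :* con 16 :+ n) ≡.refl

    -- The last positive form, number 8, is the root coordinate itself.
    root-vanishes : ∀ z → (∀ s → ⟨ ⟪ positiveForms s ⟫ , z ⟩ ≈ 0#) → z zero ≈ 0#
    root-vanishes z Fz≈0 = trans (sym (dot-δ z zero))
      (trans (dot-cong {x = δ zero} {x′ = ⟪ unit zero ⟫} {y = z} {y′ = z} (λ j → sym (ι-unit zero j)) (λ _ → refl)) (Fz≈0 (# 8)))

  family-signature : ∀ n → HasSignature (lineGraph (family n)) (+ (suc n ℕ.+ 1))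
  family-signature n = 9 ℕ.* suc n , 7 ℕ.* suc n ℕ.+ n , family-inertia n , ≡.sym (begin
    + (9 ℕ.* suc n) ℤ.- + q            ≡⟨ ≡.cong (λ p → + p ℤ.- + q) (arith n) ⟩
    + (q ℕ.+ (suc n ℕ.+ 1)) ℤ.- + q    ≡⟨ ℤ.m-n≡m⊖n (q ℕ.+ (suc n ℕ.+ 1)) q ⟩
    (q ℕ.+ (suc n ℕ.+ 1)) ℤ.⊖ q        ≡⟨ ℤ.⊖-≥ (ℕ.m≤m+n q _) ⟩
    + (q ℕ.+ (suc n ℕ.+ 1) ℕ.∸ q)      ≡⟨ ≡.cong +_ (ℕ.m+n∸m≡n q _) ⟩
    + (suc n ℕ.+ 1)                    ∎)
    where
    open ≡.≡-Reasoning
    q : ℕ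
    q = 7 ℕ.* suc n ℕ.+ n
    arith : ∀ n → 9 ℕ.* suc n ≡ (7 ℕ.* suc n ℕ.+ n) ℕ.+ (suc n ℕ.+ 1)
    arith = solve 1 (λ n → con 9 :* (con 1 :+ n) := (con 7 :* (con 1 :+ n) :+ n) :+ (con 1 :+ n :+ con 1)) ≡.refl
      where open ℕ.+-*-Solver

≤∣_∣ : ∀ C → C ℤ.≤ + ℤ.∣ C ∣
≤∣ + n ∣      = ℤ.≤-refl
≤∣ -[1+ n ] ∣ = ℤ.-≤+

<signature : ∀ C → C ℤ.< + (suc ℤ.∣ C ∣ ℕ.+ 1)
<signature C = ℤ.≤-<-trans ≤∣ C ∣ (ℤ.+<+ (ℕ.m≤m+n (suc ℤ.∣ C ∣) 1))

corollary6 : (ℝ : RealNumbers) → let open Spectra ℝ in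
    (∀ (k : ℕ) → 1 ℕ.≤ k →
    ∃ λ (G : Graph (14 ℕ.* k)) → Connected G × HasSignature (lineGraph G) (+ (k ℕ.+ 1)))
    ×
    (∀ (C : ℤ) → ∃ λ (n : ℕ) → ∃ λ (G : Graph n) →
    Connected G × (∃ λ (s : ℤ) → HasSignature (lineGraph G) s × C ℤ.< s))
    ×
    (¬ (∃ λ (C : ℤ) → ∀ (n : ℕ) (G : Graph n) → Connected G →
    ∀ (p q : ℕ) → HasInertia (lineGraph G) p q → + p ℤ.≤ + q ℤ.+ C))
corollary6 ℝ =
  (λ { (suc n) _ → family n , family-connected n , family-signature ℝ n }) ,
  -- With |C| + 1 copies the signature is |C| + 2, which exceeds C.
  (λ C → _ , family ℤ.∣ C ∣ , family-connected ℤ.∣ C ∣ , _ , family-signature ℝ ℤ.∣ C ∣ , <signature C) ,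
  (λ { (C , bound) → unbounded C bound (family-signature ℝ ℤ.∣ C ∣) })
  where
  open Spectra ℝ
  unbounded : ∀ C → (∀ n (G : Graph n) → Connected G → ∀ p q → HasInertia (lineGraph G) p q → + p ℤ.≤ + q ℤ.+ C) →
              ¬ HasSignature (lineGraph (family ℤ.∣ C ∣)) (+ (suc ℤ.∣ C ∣ ℕ.+ 1))
  unbounded C bound (p , q , inertia , s≡p-q) = ℤ.<⇒≱ (<signature C) (begin
    + (suc ℤ.∣ C ∣ ℕ.+ 1)     ≡⟨ s≡p-q ⟩
    + p ℤ.- + q               ≤⟨ ℤ.+-monoˡ-≤ (ℤ.- + q) (bound _ (family ℤ.∣ C ∣) (family-connected ℤ.∣ C ∣) p q inertia) ⟩
    + q ℤ.+ C ℤ.- + q         ≡⟨ ≡.cong (λ x → x ℤ.- + q) (ℤ.+-comm (+ q) C) ⟩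
    C ℤ.+ + q ℤ.- + q         ≡⟨ ℤ.+-assoc C (+ q) (ℤ.- + q) ⟩
    C ℤ.+ (+ q ℤ.- + q)       ≡⟨ ≡.cong (λ x → C ℤ.+ x) (ℤ.+-inverseʳ (+ q)) ⟩
    C ℤ.+ + 0                 ≡⟨ ℤ.+-identityʳ C ⟩
    C                         ∎)
    where open ℤ.≤-Reasoning
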